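{- Given a set $X\subset\mathbb{R}^d$ of $n$ points, let $f(S^*)$ be the optimal value of the unconstrained $k$-means problem, i.e. the minimum of $f(S)=\sum_{x\in X}\min_{c\in S}\|x-c\|^2$ over sets $S\subset\mathbb{R}^d$ subject to $|S|\le k$. For $\varepsilon>0$, one can find in time $O\!\left(n^{O(\log(1/\varepsilon)/\varepsilon^2)}dk\right)$ a set $S\subset\mathbb{R}^d$ of size $|S|=O(k)+k\log(1/\varepsilon)$ such that $f(S)\le(1+\varepsilon)f(S^*)$.
   Context: $\|\cdot\|$ is the Euclidean norm on $\mathbb{R}^d$. In the unconstrained $k$-means problem the centers may be arbitrary points of $\mathbb{R}^d$.
   Formalization: The time and size bounds are evaluated at min(ε,1/2) instead of ε, since for ε near or above 1 the literal bounds with log(1/ε) fail; for ε ≤ 1/2 they are as stated, and the (1+ε) guarantee holds for all ε > 0. -}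

module Defs where

open import Level using (0ℓ)
open import Algebra.Bundles using (CommutativeRing; Semiring)
open import Algebra.Core using (Op₁; Op₂)
open import Algebra.Structures using (IsCommutativeRing)
import Algebra.Construct.NaturalChoice.Min as Min
import Algebra.Definitions.RawSemiring as RawSemiringDefinitions
open import Data.Fin.Base using (Fin; toℕ; fromℕ<)
open import Data.Nat.Base as ℕ using (ℕ; zero; suc; _!)
open import Data.Nat.Properties using (_≟_; _<?_)
open import Data.Product.Base using (Σ; ∃; _×_; _,_)
open import Data.Unit.Base using (⊤)
open import Data.Vec.Functional using (Vector; concat; foldr; head; tail)
open import Relation.Binary.Bundles using (DecTotalOrder)
open import Relation.Binary.Core using (Rel)
import Relation.Binary.Construct.NonStrictToStrict as NonStrictToStrict
open import Relation.Binary.Structures using (IsDecTotalOrder)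
open import Relation.Nullary.Decidable.Core using (yes; no)
open import Relation.Nullary.Negation.Core using (¬_)

-- The real numbers, characterised up to isomorphism as the complete ordered
-- field.  The decidable order together with suprema of arbitrary inhabited
-- bounded predicates is the classical reading of ℝ: instances exist in the
-- presence of excluded middle.
record CompleteOrderedField : Set₁ where
  infix  9 _⁻¹
  infix  8 -_
  infixl 7 _*_
  infixl 6 _+_
  infix  4 _≈_ _≤_
  field
    Carrier : Set
    _≈_     : Rel Carrier 0ℓ
    _≤_     : Rel Carrier 0ℓ
    _+_     : Op₂ Carrier
    _*_     : Op₂ Carrier
    -_      : Op₁ Carrier
    _⁻¹     : Op₁ Carrier
    0#      : Carrier
    1#      : Carrier

    isCommutativeRing : IsCommutativeRing _≈_ _+_ _*_ -_ 0# 1#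
    isDecTotalOrder   : IsDecTotalOrder _≈_ _≤_

  UpperBound : (Carrier → Set) → Carrier → Set
  UpperBound P b = ∀ x → P x → x ≤ b

  field
    0≉1        : ¬ (0# ≈ 1#)
    ⁻¹-cong    : ∀ {x y} → x ≈ y → x ⁻¹ ≈ y ⁻¹
    ⁻¹-inverse : ∀ x → ¬ (x ≈ 0#) → x * x ⁻¹ ≈ 1#
    +-monoˡ-≤  : ∀ z {x y} → x ≤ y → x + z ≤ y + z
    *-nonNeg   : ∀ {x y} → 0# ≤ x → 0# ≤ y → 0# ≤ x * y
    supremum   : (P : Carrier → Set) → ∃ P → ∃ (UpperBound P) →
                 ∃ λ s → UpperBound P s × (∀ b → UpperBound P b → s ≤ b)

  commutativeRing : CommutativeRing 0ℓ 0ℓ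
  commutativeRing = record { isCommutativeRing = isCommutativeRing }

  decTotalOrder : DecTotalOrder 0ℓ 0ℓ 0ℓ
  decTotalOrder = record { isDecTotalOrder = isDecTotalOrder }

  open CommutativeRing commutativeRing public using (semiring; _-_)
  open Semiring semiring public using (rawSemiring)
  open DecTotalOrder decTotalOrder public using (totalOrder; _≤?_)
  open RawSemiringDefinitions rawSemiring public using (sum; _^_)
  open NonStrictToStrict _≈_ _≤_ public using (_<_)
  open Min totalOrder public using (_⊓_)

  fromℕ : ℕ → Carrier
  fromℕ n = RawSemiringDefinitions._×_ rawSemiring n 1#

  ½ : Carrier
  ½ = fromℕ 2 ⁻¹

module Transcendental (R : CompleteOrderedField) where
  open CompleteOrderedField R

  Limit : (ℕ → Carrier) → Carrier → Set
  Limit u l = ∀ δ → 0# < δ →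
    Σ ℕ λ N → ∀ m → N ℕ.≤ m → (u m ≤ l + δ) × (l ≤ u m + δ)

  -- exp, the natural logarithm and real powers are given by their graphs.

  -- Exp x y : y = eˣ
  Exp : Carrier → Carrier → Set
  Exp x = Limit λ m → sum {m} λ j → x ^ toℕ j * fromℕ (toℕ j !) ⁻¹

  -- Ln y x : x = ln y
  Ln : Carrier → Carrier → Set
  Ln y x = Exp x y

  -- Power b a p : p = bᵃ, for b > 0
  Power : Carrier → Carrier → Carrier → Set
  Power b a p = Σ Carrier λ l → Ln b l × Exp (a * l) p

module KMeans (R : CompleteOrderedField) where
  open CompleteOrderedField R

  Point : ℕ → Set
  Point d = Vector Carrier d

  _≋_ : ∀ {d} → Rel (Point d) 0ℓ
  x ≋ y = ∀ j → x j ≈ y j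

  ‖_-_‖² : ∀ {d} → Point d → Point d → Carrier
  ‖ x - y ‖² = sum λ j → (x j - y j) * (x j - y j)

  minimum : ∀ {m} → Vector Carrier (suc m) → Carrier
  minimum v = foldr _⊓_ (head v) (tail v)

  -- A finite nonempty set of centers is given by an enumeration, possibly with
  -- repetitions.  A set has at most k elements exactly when it has an
  -- enumeration of length at most k.
  cost : ∀ {n d m} → Vector (Point d) n → Vector (Point d) (suc m) → Carrier
  cost X S = sum λ i → minimum λ c → ‖ X i - S c ‖²

  IsOptimal : ∀ {n d m} → ℕ → Vector (Point d) n → Vector (Point d) (suc m) → Set
  IsOptimal {d = d} {m} k X S =
    suc m ℕ.≤ k ×
    (∀ {m′} (S′ : Vector (Point d) (suc m′)) → suc m′ ℕ.≤ k → cost X S ≤ cost X S′)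

-- A real RAM: an integer memory and a real memory, both addressed by ℕ, with
-- indirect addressing through integer cells, and structured control flow.
-- Integers have no unit-cost multiplication, and there is no conversion of
-- reals to integers: either would make the unit-cost model unreasonably strong.
-- The comments use i[a] and r[a] for the integer and real cells at address a.

data Operator : Set where
  add sub mul div : Operator

data Instruction : Set where
  constᵢ : (a c : ℕ) → Instruction                    -- i[a] := c
  addᵢ   : (a b c : ℕ) → Instruction                  -- i[a] := i[b] + i[c]
  subᵢ   : (a b c : ℕ) → Instruction                  -- i[a] := i[b] ∸ i[c]
  loadᵢ  : (a b : ℕ) → Instruction                    -- i[a] := i[i[b]]
  storeᵢ : (a b : ℕ) → Instruction                    -- i[i[a]] := i[b]
  zeroᵣ  : (a : ℕ) → Instruction                      -- r[a] := 0
  oneᵣ   : (a : ℕ) → Instruction                      -- r[a] := 1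
  opᵣ    : Operator → (a b c : ℕ) → Instruction       -- r[a] := r[b] ∙ r[c]
  loadᵣ  : (a b : ℕ) → Instruction                    -- r[a] := r[i[b]]
  storeᵣ : (a b : ℕ) → Instruction                    -- r[i[a]] := r[b]

data Test : Set where
  leᵢ : (a b : ℕ) → Test                              -- i[a] ≤ i[b]
  leᵣ : (a b : ℕ) → Test                              -- r[a] ≤ r[b]

infixr 5 _⨾_

data Program : Set where
  skip  : Program
  exec  : Instruction → Program
  _⨾_   : Program → Program → Program
  if    : Test → Program → Program → Program
  while : Test → Program → Program

_[_↦_] : {A : Set} → (ℕ → A) → ℕ → A → (ℕ → A)
(f [ a ↦ v ]) b with a ≟ b
... | yes _ = v
... | no  _ = f b

module RealRAM (R : CompleteOrderedField) where
  open CompleteOrderedField R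

  record State : Set where
    constructor ⟪_,_⟫
    field
      int  : ℕ → ℕ
      real : ℕ → Carrier

  open State public

  ⟦_⟧ₒ : Operator → Op₂ Carrier
  ⟦ add ⟧ₒ x y = x + y
  ⟦ sub ⟧ₒ x y = x - y
  ⟦ mul ⟧ₒ x y = x * y
  ⟦ div ⟧ₒ x y = x * y ⁻¹

  ⟦_⟧ᵢ : Instruction → State → State
  ⟦ constᵢ a c   ⟧ᵢ ⟪ i , r ⟫ = ⟪ i [ a ↦ c ] , r ⟫
  ⟦ addᵢ a b c   ⟧ᵢ ⟪ i , r ⟫ = ⟪ i [ a ↦ i b ℕ.+ i c ] , r ⟫
  ⟦ subᵢ a b c   ⟧ᵢ ⟪ i , r ⟫ = ⟪ i [ a ↦ i b ℕ.∸ i c ] , r ⟫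
  ⟦ loadᵢ a b    ⟧ᵢ ⟪ i , r ⟫ = ⟪ i [ a ↦ i (i b) ] , r ⟫
  ⟦ storeᵢ a b   ⟧ᵢ ⟪ i , r ⟫ = ⟪ i [ i a ↦ i b ] , r ⟫
  ⟦ zeroᵣ a      ⟧ᵢ ⟪ i , r ⟫ = ⟪ i , r [ a ↦ 0# ] ⟫
  ⟦ oneᵣ a       ⟧ᵢ ⟪ i , r ⟫ = ⟪ i , r [ a ↦ 1# ] ⟫
  ⟦ opᵣ o a b c  ⟧ᵢ ⟪ i , r ⟫ = ⟪ i , r [ a ↦ ⟦ o ⟧ₒ (r b) (r c) ] ⟫
  ⟦ loadᵣ a b    ⟧ᵢ ⟪ i , r ⟫ = ⟪ i , r [ a ↦ r (i b) ] ⟫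
  ⟦ storeᵣ a b   ⟧ᵢ ⟪ i , r ⟫ = ⟪ i , r [ i a ↦ r b ] ⟫

  -- Division by zero blocks.
  Executable : Instruction → State → Set
  Executable (opᵣ div a b c) s = ¬ (real s c ≈ 0#)
  Executable _               s = ⊤

  Holds : Test → State → Set
  Holds (leᵢ a b) s = int s a ℕ.≤ int s b
  Holds (leᵣ a b) s = real s a ≤ real s b

  infix 4 ⟨_,_⟩⇓[_]_

  -- ⟨ p , s ⟩⇓[ t ] s′ : started in s, p halts in s′ after t steps, where every
  -- instruction and every test is one step.
  data ⟨_,_⟩⇓[_]_ : Program → State → ℕ → State → Set where
    skip  : ∀ {s} → ⟨ skip , s ⟩⇓[ 1 ] s
    exec  : ∀ {i s} → Executable i s → ⟨ exec i , s ⟩⇓[ 1 ] ⟦ i ⟧ᵢ s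
    seq   : ∀ {p q s s′ s″ t u} →
            ⟨ p , s ⟩⇓[ t ] s′ → ⟨ q , s′ ⟩⇓[ u ] s″ →
            ⟨ p ⨾ q , s ⟩⇓[ t ℕ.+ u ] s″
    then  : ∀ {b p q s s′ t} → Holds b s →
            ⟨ p , s ⟩⇓[ t ] s′ → ⟨ if b p q , s ⟩⇓[ suc t ] s′
    else  : ∀ {b p q s s′ t} → ¬ Holds b s →
            ⟨ q , s ⟩⇓[ t ] s′ → ⟨ if b p q , s ⟩⇓[ suc t ] s′
    stop  : ∀ {b p s} → ¬ Holds b s → ⟨ while b p , s ⟩⇓[ 1 ] s
    loop  : ∀ {b p s s′ s″ t u} → Holds b s →
            ⟨ p , s ⟩⇓[ t ] s′ → ⟨ while b p , s′ ⟩⇓[ u ] s″ →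
            ⟨ while b p , s ⟩⇓[ suc (t ℕ.+ u) ] s″

  fromVector : ∀ {m} → Vector Carrier m → ℕ → Carrier
  fromVector {m} v a with a <? m
  ... | yes a<m = v (fromℕ< a<m)
  ... | no  _   = 0#

  -- n, d, k in the first three integer cells; ε in real cell 0, followed by the
  -- coordinates of the points, point by point.  All other cells are 0.
  input : ∀ {n d} → ℕ → Vector (Vector Carrier d) n → Carrier → State
  input {n} {d} k X ε = ⟪ i , r ⟫
    where
    i : ℕ → ℕ
    i 0 = n
    i 1 = d
    i 2 = k
    i _ = 0

    r : ℕ → Carrier
    r zero    = ε
    r (suc a) = fromVector (concat X) a

  outputSize : State → ℕ
  outputSize s = int s 0

  output : ∀ {d m} → State → Vector (Vector Carrier d) m
  output {d} s c j = real s (toℕ c ℕ.* d ℕ.+ toℕ j)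

{-# OPTIONS --safe #-}

{-
Let e = min(ε, ½), let s be the least number with s e > 4, and let t be the least
number with 64 (1 − 1/k)^t < e.

Candidate centers. For every cluster with mean μ and variance V, data points
x₁, …, x_s can be chosen one after the other such that ‖x₁ + … + x_j − j μ‖² ≤ j V,
since the cross terms cancel on average. Hence some mean of s points serves the
cluster within the factor 1 + 1/s, and the n^s such means (with the partial sums)
contain k centers S′ with f(S′) ≤ (1 + 1/s) f(S*).

Search. Among the candidates, the best addition to a set T satisfies
k f(T⁺) ≤ (k − 1) f(T) + f(S′). If |T| > k, the best removal satisfies
(|T| − k)(f(T⁻) − f(T)) ≤ f(T) + 8 f(S′): at least |T| − k centers of T are not
nearest to any center of S′, and the points of such a center may move to the center
of T nearest to their center of S′. So removals lead from T = X to 4k centers of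
cost at most 2^n · 8 f(S′), alternating additions and removals bring the cost below
14 f(S′), and t further additions bring it below (1 + 13 (1 − 1/k)^t) f(S′), which
is at most (1 + e/4)² f(S*) ≤ (1 + ε) f(S*). If n ≤ 4k, the set X itself is output.

Bounds. t ≤ k (ln(1/e) + 63) + 1 because 1 − 1/k ≤ exp(−1/k). All loops but those
over the d coordinates are executed at most n^(s+4) times, and s + 4 ≤ 10 ln(1/e)/e².
The field need not be constructively archimedean, but an integer bound on 1/e, which
makes the loops terminate, can be extracted from the convergence of the exponential
series.
-}

module Submission where

open import Defs
open import Level using (0ℓ)
open import Algebra.Bundles using (CommutativeRing; RawRing)
open import Algebra.Solver.Ring.AlmostCommutativeRing using (AlmostCommutativeRing; fromCommutativeRing; _-Raw-AlmostCommutative⟶_)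
import Algebra.Construct.NaturalChoice.Min as NaturalChoiceMin
import Algebra.Construct.NaturalChoice.MinOp as NaturalChoiceMinOp
import Algebra.Properties.CommutativeSemiring.Exp as CommutativeSemiringExp
import Algebra.Properties.Ring as RingProperties
import Algebra.Properties.Semiring.Exp as SemiringExp
import Algebra.Properties.Semiring.Mult as SemiringMult
import Algebra.Properties.Semiring.Sum as SemiringSum
import Algebra.Solver.Ring as RingSolver
open import Data.Bool.Base using (Bool; true; false; _∧_; not; T)
open import Data.Empty using (⊥-elim)
open import Data.Fin.Base using (Fin; zero; suc; toℕ; fromℕ<; combine; cast)
import Data.Fin.Properties as Fin
open import Data.Integer.Base as ℤ using (ℤ; +_; -[1+_])
import Data.Integer.Properties as ℤ
open import Data.List.Base using (List; []; _∷_)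
open import Data.Maybe.Base using (Maybe; just; nothing)
open import Data.Nat.Base as ℕ using (ℕ; zero; suc; z≤n; s≤s; _!; _≡ᵇ_; _<ᵇ_; NonZero)
import Data.Nat.Properties as ℕ
open import Data.Product.Base using (Σ; _×_; _,_; proj₁; proj₂)
open import Data.Sum.Base using (_⊎_; inj₁; inj₂; [_,_]′)
open import Data.Unit.Base using (⊤; tt)
open import Data.Vec.Functional using (Vector; concat; foldr; head; tail)
open import Function.Base using (_∘_)
open import Function.Definitions using (Injective)
open import Relation.Binary.Bundles using (DecTotalOrder)
open import Relation.Binary.Definitions using (tri<; tri≈; tri>)
open import Relation.Binary.PropositionalEquality.Core as ≡ using (_≡_; _≢_)
import Relation.Binary.Reasoning.PartialOrder as PartialOrderReasoning
import Relation.Binary.Reasoning.Setoid as SetoidReasoning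
open import Relation.Binary.Structures using (IsDecTotalOrder)
open import Relation.Nullary using (¬_; yes; no; Dec; contradiction)
open import Relation.Nullary.Decidable using (¬?)

-- Ordered fields

-- Why 4k centers: an addition gains the fraction 1/k of the excess and a removal loses the fraction
-- 1/(|T| - k) of f(T) + 8 f(S′), so alternating them contracts only if |T| is larger than 2k by a
-- constant factor. With 4k centers one pair of steps gives f ↦ (1 - 2/(3k)) f + (4/k) f(S′), whose
-- fixed point is 6 f(S′). The excess left by the reduction is at most 2^n · 8 f(S′); every n pairs
-- halve it, so n² pairs leave 8 f(S′), whence 14 = 6 + 8. Starting from X, of cost 0, makes every
-- bound relative to f(S′), with no scale to guess.
--
-- The machine has neither integer multiplication nor a conversion of reals to integers. So products
-- and the integers s and t are found by counting, and the number of rounds of each such loop must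
-- be known in advance. Logarithms and powers are given only as limits of partial sums; every fact
-- about them is first proved for truncated series. The running time is read off from the program
-- text, each loop being charged with one of two round counts.

module FieldProperties (R : CompleteOrderedField) where
  open CompleteOrderedField R public
  open CommutativeRing commutativeRing public
    using (refl; sym; trans; reflexive; setoid; +-cong; +-congˡ; +-congʳ; *-cong; *-congˡ; *-congʳ; -‿cong;
           +-comm; +-assoc; *-comm; *-assoc; +-identityˡ; +-identityʳ; *-identityˡ; *-identityʳ;
           zeroˡ; zeroʳ; distribˡ; distribʳ; -‿inverseʳ; -‿inverseˡ; ring; commutativeSemiring)
  open DecTotalOrder decTotalOrder public using (poset)
    renaming (refl to ≤-refl; trans to ≤-trans; reflexive to ≤-reflexive; antisym to ≤-antisym; total to ≤-total)
  open RingProperties ring public using (-‿distribˡ-*; -‿distribʳ-*; -0#≈0#; -‿involutive; -‿+-comm)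
  open SemiringMult semiring public using (×-homo-+; ×1-homo-*)
  open SemiringExp semiring public using (^-congˡ)
  open CommutativeSemiringExp commutativeSemiring public using (^-distrib-*)
  open SemiringSum semiring public using (sum-cong-≋; ∑-distrib-+; ∑-comm; *-distribˡ-sum; *-distribʳ-sum)

  open NaturalChoiceMin totalOrder using (minOperator)
  open NaturalChoiceMinOp minOperator public using (x⊓y≤x; x⊓y≤y; ⊓-glb)

  module ≈R = SetoidReasoning setoid
  module ≤R = PartialOrderReasoning poset

  fromℕ-+ : ∀ m n → fromℕ (m ℕ.+ n) ≈ fromℕ m + fromℕ n
  fromℕ-+ m n = ×-homo-+ 1# m n

  fromℕ-* : ∀ m n → fromℕ (m ℕ.* n) ≈ fromℕ m * fromℕ n
  fromℕ-* = ×1-homo-*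

  private
    -- Equality of integer coefficients computes, so the ring solver collects and cancels numerals.
    -- In an abstract field no such comparison evaluates.
    signed : ℤ → Carrier
    signed (+ n)      = fromℕ n
    signed (-[1+ n ]) = - fromℕ (suc n)

    signed-⊖ : ∀ m n → signed (m ℤ.⊖ n) ≈ fromℕ m + - fromℕ n
    signed-⊖ m zero = trans (sym (+-identityʳ _)) (+-congˡ (sym -0#≈0#))
    signed-⊖ zero (suc n) = sym (+-identityˡ _)
    signed-⊖ (suc m) (suc n) = begin
      signed (suc m ℤ.⊖ suc n) ≡⟨ ≡.cong signed (ℤ.[1+m]⊖[1+n]≡m⊖n m n) ⟩
      signed (m ℤ.⊖ n) ≈⟨ signed-⊖ m n ⟩
      fromℕ m + - fromℕ n ≈⟨ +-congʳ (sym (+-identityˡ _)) ⟩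
      (0# + fromℕ m) + - fromℕ n ≈⟨ +-congʳ (+-congʳ (sym (-‿inverseˡ 1#))) ⟩
      ((- 1# + 1#) + fromℕ m) + - fromℕ n ≈⟨ +-congʳ (+-assoc _ _ _) ⟩
      (- 1# + (1# + fromℕ m)) + - fromℕ n ≈⟨ +-congʳ (+-comm _ _) ⟩
      ((1# + fromℕ m) + - 1#) + - fromℕ n ≈⟨ +-assoc _ _ _ ⟩
      (1# + fromℕ m) + (- 1# + - fromℕ n) ≈⟨ +-congˡ (-‿+-comm _ _) ⟩
      fromℕ (suc m) + - fromℕ (suc n) ∎
      where open ≈R

    signed-+ : ∀ i j → signed (i ℤ.+ j) ≈ signed i + signed j
    signed-+ (+ m) (+ n) = fromℕ-+ m n
    signed-+ (+ m) -[1+ n ] = signed-⊖ m (suc n)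
    signed-+ -[1+ m ] (+ n) = trans (signed-⊖ n (suc m)) (+-comm _ _)
    signed-+ -[1+ m ] -[1+ n ] = begin
      - fromℕ (suc (suc (m ℕ.+ n))) ≡⟨ ≡.cong (λ z → - fromℕ (suc z)) (≡.sym (ℕ.+-suc m n)) ⟩
      - fromℕ (suc m ℕ.+ suc n) ≈⟨ -‿cong (fromℕ-+ (suc m) (suc n)) ⟩
      - (fromℕ (suc m) + fromℕ (suc n)) ≈⟨ sym (-‿+-comm _ _) ⟩
      - fromℕ (suc m) + - fromℕ (suc n) ∎
      where open ≈R

    signed-neg : ∀ i → signed (ℤ.- i) ≈ - signed i
    signed-neg (+ zero) = sym -0#≈0#
    signed-neg (+ suc n) = refl
    signed-neg -[1+ n ] = sym (-‿involutive _)

    signed-+* : ∀ m j → signed (+ m ℤ.* j) ≈ fromℕ m * signed j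
    signed-+* m (+ n) = trans (reflexive (≡.cong signed (≡.sym (ℤ.pos-* m n)))) (fromℕ-* m n)
    signed-+* m -[1+ n ] = begin
      signed (+ m ℤ.* -[1+ n ]) ≡⟨ ≡.cong signed (≡.sym (ℤ.neg-distribʳ-* (+ m) (+ suc n))) ⟩
      signed (ℤ.- (+ m ℤ.* + suc n)) ≈⟨ signed-neg (+ m ℤ.* + suc n) ⟩
      - signed (+ m ℤ.* + suc n) ≈⟨ -‿cong (signed-+* m (+ suc n)) ⟩
      - (fromℕ m * fromℕ (suc n)) ≈⟨ -‿distribʳ-* _ _ ⟩
      fromℕ m * - fromℕ (suc n) ∎
      where open ≈R

    signed-* : ∀ i j → signed (i ℤ.* j) ≈ signed i * signed j
    signed-* (+ m) j = signed-+* m j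
    signed-* -[1+ m ] j = begin
      signed (-[1+ m ] ℤ.* j) ≡⟨ ≡.cong signed (≡.sym (ℤ.neg-distribˡ-* (+ suc m) j)) ⟩
      signed (ℤ.- (+ suc m ℤ.* j)) ≈⟨ signed-neg (+ suc m ℤ.* j) ⟩
      - signed (+ suc m ℤ.* j) ≈⟨ -‿cong (signed-+* (suc m) j) ⟩
      - (fromℕ (suc m) * signed j) ≈⟨ -‿distribˡ-* _ _ ⟩
      - fromℕ (suc m) * signed j ∎
      where open ≈R

    -- The value at 1 is 1# rather than 1# + 0#, so that solver constants match
    -- both 1# and fromℕ n for n ≥ 2.
    fromℤ : ℤ → Carrier
    fromℤ (+ 1) = 1#
    fromℤ i     = signed i

    fromℤ≈ : ∀ i → fromℤ i ≈ signed i
    fromℤ≈ (+ zero) = refl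
    fromℤ≈ (+ suc zero) = sym (+-identityʳ 1#)
    fromℤ≈ (+ suc (suc n)) = refl
    fromℤ≈ -[1+ n ] = refl

    almostCommutativeRing : AlmostCommutativeRing 0ℓ 0ℓ
    almostCommutativeRing = fromCommutativeRing commutativeRing

    ℤ-rawRing : RawRing 0ℓ 0ℓ
    ℤ-rawRing = record { Carrier = ℤ ; _≈_ = _≡_ ; _+_ = ℤ._+_ ; _*_ = ℤ._*_ ; -_ = ℤ.-_ ; 0# = + 0 ; 1# = + 1 }

    ℤ-morphism : ℤ-rawRing -Raw-AlmostCommutative⟶ almostCommutativeRing
    ℤ-morphism = record
      { ⟦_⟧ = fromℤ
      ; +-homo = λ i j → trans (fromℤ≈ (i ℤ.+ j)) (trans (signed-+ i j) (sym (+-cong (fromℤ≈ i) (fromℤ≈ j))))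
      ; *-homo = λ i j → trans (fromℤ≈ (i ℤ.* j)) (trans (signed-* i j) (sym (*-cong (fromℤ≈ i) (fromℤ≈ j))))
      ; -‿homo = λ i → trans (fromℤ≈ (ℤ.- i)) (trans (signed-neg i) (sym (-‿cong (fromℤ≈ i))))
      ; 0-homo = refl
      ; 1-homo = refl
      }

    _coeff≟_ : ∀ i j → Maybe (fromℤ i ≈ fromℤ j)
    i coeff≟ j with i ℤ.≟ j
    ... | yes ≡.refl = just refl
    ... | no _ = nothing

  open RingSolver ℤ-rawRing almostCommutativeRing ℤ-morphism _coeff≟_ public
    using (solve; _:=_; _:+_; _:*_; _:-_; :-_; con; _:^_; Polynomial)

  K : ∀ {n} → ℕ → Polynomial n
  K c = con (+ c)

  ≤-respˡ : ∀ {x y z} → x ≈ y → x ≤ z → y ≤ z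
  ≤-respˡ e p = ≤-trans (≤-reflexive (sym e)) p

  ≤-respʳ : ∀ {x y z} → x ≈ y → z ≤ x → z ≤ y
  ≤-respʳ e p = ≤-trans p (≤-reflexive e)

  <⇒≤ : ∀ {x y} → x < y → x ≤ y
  <⇒≤ = proj₁

  <⇒≱ : ∀ {x y} → x < y → ¬ y ≤ x
  <⇒≱ (x≤y , x≉y) y≤x = x≉y (≤-antisym x≤y y≤x)

  ≰⇒> : ∀ {x y} → ¬ x ≤ y → y < x
  ≰⇒> {x} {y} x≰y with ≤-total x y
  ... | inj₁ x≤y = contradiction x≤y x≰y
  ... | inj₂ y≤x = y≤x , λ e → x≰y (≤-reflexive (sym e))

  ≮⇒≥ : ∀ {x y} → ¬ x < y → y ≤ x
  ≮⇒≥ {x} {y} x≮y with y ≤? x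
  ... | yes p = p
  ... | no p = contradiction (≰⇒> p) x≮y

  <-≤-trans : ∀ {x y z} → x < y → y ≤ z → x < z
  <-≤-trans p q = ≤-trans (<⇒≤ p) q , λ e → <⇒≱ p (≤-respʳ (sym e) q)

  ≤-<-trans : ∀ {x y z} → x ≤ y → y < z → x < z
  ≤-<-trans p q = ≤-trans p (<⇒≤ q) , λ e → <⇒≱ q (≤-respˡ e p)

  +-mono : ∀ {a b c d} → a ≤ b → c ≤ d → a + c ≤ b + d
  +-mono {a} {b} {c} {d} p q = ≤-trans (+-monoˡ-≤ c p)
    (≤-respˡ (+-comm c b) (≤-respʳ (+-comm d b) (+-monoˡ-≤ b q)))

  0≤+ : ∀ {a b} → 0# ≤ a → 0# ≤ b → 0# ≤ a + b
  0≤+ p q = ≤-respˡ (+-identityˡ 0#) (+-mono p q)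

  -- Inequalities are certified by a nonnegative slack term and a ring identity.
  ≤-by : ∀ {a b} c → 0# ≤ c → a + c ≈ b → a ≤ b
  ≤-by {a} c 0≤c e = ≤-respʳ e (≤-respˡ (+-identityʳ a) (+-mono (≤-refl {a}) 0≤c))

  slack : ∀ {a b} → a ≤ b → 0# ≤ b - a
  slack {a} p = ≤-respˡ (-‿inverseʳ a) (+-monoˡ-≤ (- a) p)

  neg-nonneg : ∀ {x} → x ≤ 0# → 0# ≤ - x
  neg-nonneg {x} p = ≤-respʳ (solve 1 (λ x → K 0 :- x := :- x) refl x) (slack p)

  0≤x² : ∀ x → 0# ≤ x * x
  0≤x² x with ≤-total 0# x
  ... | inj₁ p = *-nonNeg p p
  ... | inj₂ p = ≤-respʳ (solve 1 (λ x → (:- x) :* (:- x) := x :* x) refl x) (*-nonNeg (neg-nonneg p) (neg-nonneg p))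

  0≤1 : 0# ≤ 1#
  0≤1 = ≤-respʳ (*-identityˡ 1#) (0≤x² 1#)

  0<1 : 0# < 1#
  0<1 = 0≤1 , 0≉1

  0≤fromℕ : ∀ n → 0# ≤ fromℕ n
  0≤fromℕ zero = ≤-refl
  0≤fromℕ (suc n) = 0≤+ 0≤1 (0≤fromℕ n)

  +-≤ : ∀ {x y} → 0# ≤ y → x ≤ x + y
  +-≤ {x} {y} p = ≤-by y p refl

  0<fromℕ : ∀ n → 0# < fromℕ (suc n)
  0<fromℕ n = <-≤-trans 0<1 (+-≤ (0≤fromℕ n))

  fromℕ-mono : ∀ {m n} → m ℕ.≤ n → fromℕ m ≤ fromℕ n
  fromℕ-mono {n = n} z≤n = 0≤fromℕ n
  fromℕ-mono (s≤s p) = +-mono ≤-refl (fromℕ-mono p)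

  1≤fromℕ : ∀ {n} → 1 ℕ.≤ n → 1# ≤ fromℕ n
  1≤fromℕ {n} p = ≤-respˡ (+-identityʳ 1#) (fromℕ-mono {1} {n} p)

  *-monoˡ : ∀ {x y z} → 0# ≤ z → x ≤ y → z * x ≤ z * y
  *-monoˡ {x} {y} {z} p q = ≤-by (z * (y - x)) (*-nonNeg p (slack q))
    (solve 3 (λ x y z → z :* x :+ z :* (y :- x) := z :* y) refl x y z)

  *-monoʳ : ∀ {x y z} → 0# ≤ z → x ≤ y → x * z ≤ y * z
  *-monoʳ {x} {y} {z} p q = ≤-respˡ (*-comm z x) (≤-respʳ (*-comm z y) (*-monoˡ p q))

  *-mono : ∀ {a b c d} → 0# ≤ a → 0# ≤ c → a ≤ b → c ≤ d → a * c ≤ b * d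
  *-mono 0≤a 0≤c p q = ≤-trans (*-monoʳ 0≤c p) (*-monoˡ (≤-trans 0≤a p) q)

  +-cancelʳ-≤ : ∀ z {x y} → x + z ≤ y + z → x ≤ y
  +-cancelʳ-≤ z {x} {y} p = ≤-by ((y + z) - (x + z)) (slack p)
    (solve 3 (λ x y z → x :+ ((y :+ z) :- (x :+ z)) := y) refl x y z)

  pos⇒≉0 : ∀ {x} → 0# < x → ¬ x ≈ 0#
  pos⇒≉0 (_ , n) e = n (sym e)

  ⁻¹-inverseˡ : ∀ {x} → 0# < x → x ⁻¹ * x ≈ 1#
  ⁻¹-inverseˡ p = trans (*-comm _ _) (⁻¹-inverse _ (pos⇒≉0 p))

  ⁻¹-inverseʳ : ∀ {x} → 0# < x → x * x ⁻¹ ≈ 1#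
  ⁻¹-inverseʳ p = ⁻¹-inverse _ (pos⇒≉0 p)

  0≤⁻¹ : ∀ {x} → 0# < x → 0# ≤ x ⁻¹
  0≤⁻¹ {x} p = ≤-respʳ (begin
     x * (x ⁻¹ * x ⁻¹) ≈⟨ sym (*-assoc _ _ _) ⟩
     (x * x ⁻¹) * x ⁻¹ ≈⟨ *-congʳ (⁻¹-inverseʳ p) ⟩
     1# * x ⁻¹ ≈⟨ *-identityˡ _ ⟩
     x ⁻¹ ∎) (*-nonNeg (<⇒≤ p) (0≤x² (x ⁻¹)))
    where open ≈R

  0<⁻¹ : ∀ {x} → 0# < x → 0# < x ⁻¹
  0<⁻¹ {x} p = 0≤⁻¹ p , λ e → 0≉1 (trans (sym (zeroʳ x)) (trans (*-congˡ e) (⁻¹-inverseʳ p)))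

  *-cancelˡ-≤ : ∀ {x y z} → 0# < z → z * x ≤ z * y → x ≤ y
  *-cancelˡ-≤ {x} {y} {z} p q = ≤-respˡ (lem x) (≤-respʳ (lem y) (*-monoˡ (0≤⁻¹ p) q))
    where
    lem : ∀ x → z ⁻¹ * (z * x) ≈ x
    lem x = trans (sym (*-assoc _ _ _)) (trans (*-congʳ (⁻¹-inverseˡ p)) (*-identityˡ x))

  0<* : ∀ {x y} → 0# < x → 0# < y → 0# < x * y
  0<* {x} {y} p q = *-nonNeg (<⇒≤ p) (<⇒≤ q) , λ e →
    <⇒≱ q (*-cancelˡ-≤ p (≤-respʳ (sym (zeroʳ x)) (≤-reflexive (sym e))))

  0<+ˡ : ∀ {x y} → 0# < x → 0# ≤ y → 0# < x + y
  0<+ˡ p q = <-≤-trans p (+-≤ q)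

  0<slack : ∀ {x y} → x < y → 0# < y - x
  0<slack {x} {y} (p , n) = slack p , λ e → n (trans (sym (+-identityʳ x)) (trans (+-congˡ e)
     (solve 2 (λ x y → x :+ (y :- x) := y) refl x y)))

  ½+½ : ½ + ½ ≈ 1#
  ½+½ = trans (solve 1 (λ h → h :+ h := K 2 :* h) refl ½) (⁻¹-inverseʳ (0<fromℕ 1))

  0<½ : 0# < ½
  0<½ = 0<⁻¹ (0<fromℕ 1)

  ½<1 : ½ < 1#
  ½<1 = ≤-by ½ (<⇒≤ 0<½) ½+½ , λ e → pos⇒≉0 0<½ (trans (solve 1 (λ h → h := (h :+ h) :- h) refl ½)
     (trans (+-cong ½+½ (-‿cong e)) (-‿inverseʳ 1#)))

  0<⊓ : ∀ {x y} → 0# < x → 0# < y → 0# < x ⊓ y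
  0<⊓ {x} {y} p q with ≤-total x y
  ... | inj₁ _ = p
  ... | inj₂ _ = q

  0≤^ : ∀ {x} n → 0# ≤ x → 0# ≤ x ^ n
  0≤^ zero p = 0≤1
  0≤^ (suc n) p = *-nonNeg p (0≤^ n p)

  ^-mono : ∀ {x y} n → 0# ≤ x → x ≤ y → x ^ n ≤ y ^ n
  ^-mono zero p q = ≤-refl
  ^-mono (suc n) p q = *-mono p (0≤^ n p) q (^-mono n p q)

  fromℕ-^ : ∀ m n → fromℕ (m ℕ.^ n) ≈ fromℕ m ^ n
  fromℕ-^ m zero = +-identityʳ 1#
  fromℕ-^ m (suc n) = trans (fromℕ-* m (m ℕ.^ n)) (*-congˡ (fromℕ-^ m n))

  -- `(1 - u)(1 + (j + 1) u) = 1 + j u - (j + 1) u²`, so a further factor preserves the bound. This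
  -- gives the decay of powers without exponentials.
  bernoulli : ∀ u j → 0# ≤ u → u ≤ 1# → (1# - u) ^ j * (1# + fromℕ j * u) ≤ 1#
  bernoulli u zero p q = ≤-reflexive (solve 1 (λ u → K 1 :* (K 1 :+ K 0 :* u) := K 1) refl u)
  bernoulli u (suc j) p q = ≤-trans
    (≤-by ((1# - u) ^ j * (u * u * fromℕ (suc j))) (*-nonNeg (0≤^ j (slack q)) (*-nonNeg (0≤x² u) (0≤fromℕ (suc j))))
      (solve 3 (λ u x c → ((K 1 :- u) :* x) :* (K 1 :+ (K 1 :+ c) :* u) :+ x :* (u :* u :* (K 1 :+ c)) := x :*
            (K 1 :+ c :* u)) refl u ((1# - u) ^ j) (fromℕ j)))
    (bernoulli u j p q)

  -- Only the double negation is available: a supremum yields no natural number.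
  archimedean : ∀ x → ¬ ¬ (Σ ℕ λ n → x ≤ fromℕ n)
  archimedean x none = <⇒≱ 0<1 (≤-respˡ (solve 1 (λ s → s :- (s :- K 1) := K 1) refl s)
        (≤-respʳ (solve 1 (λ s → (s :- K 1) :- (s :- K 1) := K 0) refl s) (+-monoˡ-≤ (- (s - 1#)) (proj₂ (proj₂ bound)
              (s - 1#) s-1-upper))))
    where
    IsNatural : Carrier → Set
    IsNatural y = Σ ℕ λ n → y ≈ fromℕ n
    x-upper : UpperBound IsNatural x
    x-upper y (n , e) with ≤-total x (fromℕ n)
    ... | inj₁ p = contradiction (n , p) none
    ... | inj₂ p = ≤-respˡ (sym e) p
    bound = supremum IsNatural (0# , 0 , refl) (x , x-upper)
    s = proj₁ bound
    -- `n + 1` lies below the supremum, hence `n` below `s - 1#`; so `s` is not least.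
    s-1-upper : UpperBound IsNatural (s - 1#)
    s-1-upper y (n , e) = ≤-by (s - (1# + fromℕ n)) (slack (proj₁ (proj₂ bound) _ (suc n , refl)))
      (trans (+-congʳ e) (solve 2 (λ s n → n :+ (s :- (K 1 :+ n)) := s :- K 1) refl s (fromℕ n)))

  sum-mono : ∀ {n} {f g : Vector Carrier n} → (∀ i → f i ≤ g i) → sum f ≤ sum g
  sum-mono {zero} p = ≤-refl
  sum-mono {suc n} p = +-mono (p zero) (sum-mono (λ i → p (suc i)))

  0≤sum : ∀ {n} {f : Vector Carrier n} → (∀ i → 0# ≤ f i) → 0# ≤ sum f
  0≤sum {zero} p = ≤-refl
  0≤sum {suc n} p = 0≤+ (p zero) (0≤sum (λ i → p (suc i)))

  sum-const : ∀ n x → sum {n} (λ _ → x) ≈ fromℕ n * x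
  sum-const zero x = sym (zeroˡ x)
  sum-const (suc n) x = trans (+-cong (sym (*-identityˡ x)) (sum-const n x)) (sym (distribʳ _ _ _))

  term≤sum : ∀ {n} {f : Vector Carrier n} → (∀ i → 0# ≤ f i) → ∀ i → f i ≤ sum f
  term≤sum p zero = +-≤ (0≤sum (λ i → p (suc i)))
  term≤sum {suc n} {f} p (suc i) = ≤-trans (term≤sum (λ i → p (suc i)) i) (≤-by (f zero) (p zero) (+-comm _ _))

-- The exponential function

module ExponentialProperties (R : CompleteOrderedField) where
  open FieldProperties R
  open Transcendental R

  Seq : Set
  Seq = ℕ → Carrier

  ∑< : ℕ → Seq → Carrier
  ∑< m f = sum {m} λ j → f (toℕ j)

  ∑<-suc : ∀ m f → ∑< (suc m) f ≈ ∑< m f + f m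
  ∑<-suc zero f = +-comm _ _
  ∑<-suc (suc m) f = trans (+-congˡ (∑<-suc m (f ∘ suc))) (sym (+-assoc _ _ _))

  ∑<-cong : ∀ m {f g} → (∀ j → f j ≈ g j) → ∑< m f ≈ ∑< m g
  ∑<-cong m p = sum-cong-≋ {m} (λ j → p (toℕ j))

  0≤∑< : ∀ m {f} → (∀ j → 0# ≤ f j) → 0# ≤ ∑< m f
  0≤∑< m p = 0≤sum {m} (λ j → p (toℕ j))

  ∑<-extend : ∀ {m n f} → (∀ j → 0# ≤ f j) → m ℕ.≤ n → ∑< m f ≤ ∑< n f
  ∑<-extend {n = n} p z≤n = 0≤∑< n p
  ∑<-extend p (s≤s q) = +-mono ≤-refl (∑<-extend (p ∘ suc) q)

  -- Coefficient `m` of the Cauchy product of two power series.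
  convolution : ℕ → Seq → Seq → Carrier
  convolution zero    f g = f 0 * g 0
  convolution (suc m) f g = f 0 * g (suc m) + convolution m (f ∘ suc) g

  -- The sum of `f i * g j` over `i + j < m`, taken row by row; `triangle-≈` takes it by
  -- antidiagonals. Comparing triangles with rectangles replaces theorems on products of convergent
  -- series.
  triangle : ℕ → Seq → Seq → Carrier
  triangle zero    f g = 0#
  triangle (suc m) f g = f 0 * ∑< (suc m) g + triangle m (f ∘ suc) g

  triangle-suc : ∀ m f g → triangle (suc m) f g ≈ triangle m f g + convolution m f g
  triangle-suc zero f g = solve 2 (λ a b → a :* (b :+ K 0) :+ K 0 := K 0 :+ a :* b) refl (f 0) (g 0)
  triangle-suc (suc m) f g = trans (+-cong (*-congˡ (∑<-suc (suc m) g)) (triangle-suc m (f ∘ suc) g))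
    (solve 5 (λ a b c d e → a :* (b :+ c) :+ (d :+ e) := (a :* b :+ d) :+ (a :* c :+ e)) refl
      (f 0) (∑< (suc m) g) (g (suc m)) (triangle m (f ∘ suc) g) (convolution m (f ∘ suc) g))

  triangle-≈ : ∀ m f g → triangle m f g ≈ ∑< m (λ r → convolution r f g)
  triangle-≈ zero f g = refl
  triangle-≈ (suc m) f g = trans (triangle-suc m f g) (trans (+-congʳ (triangle-≈ m f g)) (sym (∑<-suc m (λ r →
        convolution r f g))))

  convolution-cong : ∀ m {f f′ g g′} → (∀ j → f j ≈ f′ j) → (∀ j → g j ≈ g′ j) →
        convolution m f g ≈ convolution m f′ g′
  convolution-cong zero p q = *-cong (p 0) (q 0)
  convolution-cong (suc m) p q = +-cong (*-cong (p 0) (q (suc m))) (convolution-cong m (p ∘ suc) q)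

  convolution-+ : ∀ m f f′ g → convolution m (λ j → f j + f′ j) g ≈ convolution m f g + convolution m f′ g
  convolution-+ zero f f′ g = distribʳ _ _ _
  convolution-+ (suc m) f f′ g = trans (+-congˡ (convolution-+ m (f ∘ suc) (f′ ∘ suc) g))
    (solve 5 (λ a b c d e → (a :+ b) :* c :+ (d :+ e) := (a :* c :+ d) :+ (b :* c :+ e)) refl
      (f 0) (f′ 0) (g (suc m)) (convolution m (f ∘ suc) g) (convolution m (f′ ∘ suc) g))

  convolution-*ˡ : ∀ m x f g → convolution m (λ j → x * f j) g ≈ x * convolution m f g
  convolution-*ˡ zero x f g = *-assoc _ _ _
  convolution-*ˡ (suc m) x f g = trans (+-cong (*-assoc _ _ _) (convolution-*ˡ m x (f ∘ suc) g)) (sym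
        (distribˡ _ _ _))

  convolution-*ʳ : ∀ m x f g → convolution m f (λ j → x * g j) ≈ x * convolution m f g
  convolution-*ʳ zero x f g = solve 3 (λ a b c → a :* (b :* c) := b :* (a :* c)) refl (f 0) x (g 0)
  convolution-*ʳ (suc m) x f g = trans (+-cong (solve 3 (λ a b c → a :* (b :* c) := b :* (a :* c)) refl (f 0) x (g
        (suc m)))
    (convolution-*ʳ m x (f ∘ suc) g)) (sym (distribˡ _ _ _))

  derivative : Seq → Seq
  derivative f j = fromℕ (suc j) * f (suc j)

  -- The product rule `(fg)′ = f′g + fg′` for formal power series, read at coefficient `r`.
  convolution-derivative : ∀ r f g → fromℕ (suc r) * convolution (suc r) f g ≈
    convolution r (derivative f) g + convolution r f (derivative g)
  convolution-derivative zero f g = solve 4 (λ a b c d → (K 1 :+ K 0) :* (a :* d :+ b :* c) :=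
        ((K 1 :+ K 0) :* b) :* c :+ a :* ((K 1 :+ K 0) :* d)) refl
    (f 0) (f 1) (g 0) (g 1)
  convolution-derivative (suc r) f g = begin
    (1# + c) * (f0 * g2 + convolution (suc r) f′ g)
      ≈⟨ solve 5 (λ c a b p q → (K 1 :+ c) :* (a :* b :+ (p :+ q)) := ((K 1 :+ c) :* (a :* b) :+ (p :+ q)) :+ c :*
            (p :+ q)) refl
           c f0 g2 (f 1 * g (suc r)) (convolution r (f′ ∘ suc) g) ⟩
    ((1# + c) * (f0 * g2) + (f 1 * g (suc r) + convolution r (f′ ∘ suc) g)) + c * convolution (suc r) f′ g
      ≈⟨ +-congˡ (convolution-derivative r f′ g) ⟩
    ((1# + c) * (f0 * g2) + (f 1 * g (suc r) + convolution r (f′ ∘ suc) g)) + (convolution r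
          (derivative f′) g + convolution r f′ (derivative g))
      ≈⟨ solve 8 (λ c a b x y p q s → ((K 1 :+ c) :* (a :* b) :+ (x :* y :+ p)) :+ (q :+ s) :=
            ((((K 1 :+ K 0) :* x) :* y) :+ (p :+ q)) :+ (a :* ((K 1 :+ c) :* b) :+ s)) refl
           c f0 g2 (f 1) (g (suc r)) (convolution r (f′ ∘ suc) g) (convolution r (derivative f′) g) (convolution r f′
                 (derivative g)) ⟩
    (derivative f 0 * g (suc r) + (convolution r (f′ ∘ suc) g + convolution r (derivative f′) g)) + convolution
          (suc r) f (derivative g)
      ≈⟨ +-congʳ (+-congˡ (sym (trans (convolution-cong r shift (λ _ → refl)) (convolution-+ r (f′ ∘ suc)
            (derivative f′) g)))) ⟩
    convolution (suc r) (derivative f) g + convolution (suc r) f (derivative g) ∎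
    where
    open ≈R
    c = fromℕ (suc r)
    f0 = f 0
    g2 = g (suc (suc r))
    f′ = f ∘ suc
    shift : ∀ j → derivative f (suc j) ≈ f′ (suc j) + derivative f′ j
    shift j = trans (distribʳ _ _ _) (+-congʳ (*-identityˡ _))

  ⁻¹-unique : ∀ {x y} → 0# < x → x * y ≈ 1# → y ≈ x ⁻¹
  ⁻¹-unique {x} {y} p e = begin
    y ≈⟨ sym (*-identityˡ y) ⟩
    1# * y ≈⟨ *-congʳ (sym (⁻¹-inverseˡ p)) ⟩
    (x ⁻¹ * x) * y ≈⟨ *-assoc _ _ _ ⟩
    x ⁻¹ * (x * y) ≈⟨ *-congˡ e ⟩
    x ⁻¹ * 1# ≈⟨ *-identityʳ _ ⟩
    x ⁻¹ ∎
    where open ≈R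

  0<! : ∀ j → 0# < fromℕ (j !)
  0<! j = <-≤-trans (0<fromℕ 0) (fromℕ-mono (ℕ.1≤n! j))

  expTerm : Carrier → Seq
  expTerm x j = x ^ j * fromℕ (j !) ⁻¹

  E : ℕ → Carrier → Carrier
  E m x = ∑< m (expTerm x)

  E-cong : ∀ {x y} m → x ≈ y → E m x ≈ E m y
  E-cong {x} {y} m e = ∑<-cong m {expTerm x} {expTerm y} λ j → *-congʳ (^-congˡ j e)

  derivative-expTerm : ∀ x j → derivative (expTerm x) j ≈ x * expTerm x j
  derivative-expTerm x j = begin
    c * ((x * p) * q′) ≈⟨ solve 4 (λ c x p q → c :* ((x :* p) :* q) := x :* (p :* (c :* q))) refl c x p q′ ⟩
    x * (p * (c * q′)) ≈⟨ *-congˡ (*-congˡ (⁻¹-unique (0<! j) inverse)) ⟩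
    x * (p * fromℕ (j !) ⁻¹) ∎
    where
    open ≈R
    c = fromℕ (suc j)
    p = x ^ j
    q′ = fromℕ (suc j !) ⁻¹
    inverse : fromℕ (j !) * (c * q′) ≈ 1#
    inverse = trans (solve 3 (λ a c q → a :* (c :* q) := (c :* a) :* q) refl (fromℕ (j !)) c q′)
      (trans (*-congʳ (sym (fromℕ-* (suc j) (j !)))) (⁻¹-inverseʳ (0<! (suc j))))

  *-cancelˡ : ∀ {x y z} → 0# < z → z * x ≈ z * y → x ≈ y
  *-cancelˡ p e = ≤-antisym (*-cancelˡ-≤ p (≤-reflexive e)) (*-cancelˡ-≤ p (≤-reflexive (sym e)))

  -- Both sides are the coefficients of the power series solution of `F′ = (x + y) F` with
  -- `F(0) = 1`, so induction on `r` suffices and no binomial coefficients appear.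
  convolution-expTerm : ∀ x y r → convolution r (expTerm x) (expTerm y) ≈ expTerm (x + y) r
  convolution-expTerm x y zero = trans (solve 1 (λ q → (K 1 :* q) :* (K 1 :* q) := (K 1 :* (q :* q))) refl (fromℕ
        (0 !) ⁻¹))
    (*-congˡ (trans (*-congʳ (sym (⁻¹-unique (0<! 0) (trans (*-identityʳ _) (+-identityʳ 1#))))) (*-identityˡ _)))
  convolution-expTerm x y (suc r) = *-cancelˡ (0<fromℕ r) (begin
    fromℕ (suc r) * convolution (suc r) (expTerm x) (expTerm y)
      ≈⟨ convolution-derivative r (expTerm x) (expTerm y) ⟩
    convolution r (derivative (expTerm x)) (expTerm y) + convolution r (expTerm x) (derivative (expTerm y))
      ≈⟨ +-cong (trans (convolution-cong r (derivative-expTerm x) (λ _ → refl)) (convolution-*ˡ r x _ _))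
                (trans (convolution-cong r (λ _ → refl) (derivative-expTerm y)) (convolution-*ʳ r y (expTerm x)
                      (expTerm y))) ⟩
    x * convolution r (expTerm x) (expTerm y) + y * convolution r (expTerm x) (expTerm y)
      ≈⟨ sym (distribʳ _ _ _) ⟩
    (x + y) * convolution r (expTerm x) (expTerm y)
      ≈⟨ *-congˡ (convolution-expTerm x y r) ⟩
    (x + y) * expTerm (x + y) r
      ≈⟨ sym (derivative-expTerm (x + y) r) ⟩
    fromℕ (suc r) * expTerm (x + y) (suc r) ∎)
    where open ≈R

  triangle-expTerm : ∀ x y m → triangle m (expTerm x) (expTerm y) ≈ E m (x + y)
  triangle-expTerm x y m = trans (triangle-≈ m _ _) (∑<-cong m (convolution-expTerm x y))

  0≤triangle : ∀ m {f g} → (∀ j → 0# ≤ f j) → (∀ j → 0# ≤ g j) → 0# ≤ triangle m f g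
  0≤triangle zero p q = ≤-refl
  0≤triangle (suc m) p q = 0≤+ (*-nonNeg (p 0) (0≤∑< (suc m) q)) (0≤triangle m (p ∘ suc) q)

  -- Pairs with `i < m` and `j < M` satisfy `i + j < m + M`, and the remaining terms of the triangle
  -- are nonnegative.
  product≤triangle : ∀ m M {f g} → (∀ j → 0# ≤ f j) → (∀ j → 0# ≤ g j) → ∑< m f * ∑< M g ≤ triangle (m ℕ.+ M) f g
  product≤triangle zero M p q = ≤-respˡ (sym (zeroˡ _)) (0≤triangle M p q)
  product≤triangle (suc m) M p q = ≤-respˡ (sym (distribʳ _ _ _))
    (+-mono (*-monoˡ (p 0) (∑<-extend q (ℕ.≤-trans (ℕ.m≤n+m M m) (ℕ.n≤1+n _)))) (product≤triangle m M (p ∘ suc) q))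

  triangle≤product : ∀ {m M f g} → m ℕ.≤ M → (∀ j → 0# ≤ f j) → (∀ j → 0# ≤ g j) → triangle m f g ≤ ∑< m f * ∑< M g
  triangle≤product z≤n p q = ≤-reflexive (sym (zeroˡ _))
  triangle≤product (s≤s r) p q = ≤-respʳ (sym (distribʳ _ _ _))
    (+-mono (*-monoˡ (p 0) (∑<-extend q (s≤s r))) (triangle≤product (ℕ.m≤n⇒m≤1+n r) (p ∘ suc) q))

  ∑<-gap : ∀ {a M g h} → a ℕ.≤ M → (∀ j → g j ≤ h j) → ∑< M g + ∑< a h ≤ ∑< M h + ∑< a g
  ∑<-gap {M = M} z≤n p = +-mono (sum-mono {M} (λ j → p (toℕ j))) ≤-refl
  ∑<-gap {suc a} {suc M} {g} {h} (s≤s r) p = ≤-by ((∑< M h′ + ∑< a g′) - (∑< M g′ + ∑< a h′)) (slack (∑<-gap r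
        (p ∘ suc)))
    (solve 6 (λ x y a b c d → ((x :+ a) :+ (y :+ b)) :+ ((c :+ d) :- (a :+ b)) := (y :+ c) :+ (x :+ d)) refl
      (g 0) (h 0) (∑< M g′) (∑< a h′) (∑< M h′) (∑< a g′))
    where
    g′ = g ∘ suc
    h′ = h ∘ suc

  -- product − triangle is a sum over pairs (i, j) of f i * g j, hence monotone in g.
  excess-mono : ∀ {m M f g h} → m ℕ.≤ M → (∀ j → 0# ≤ f j) → (∀ j → g j ≤ h j) →
    ∑< m f * ∑< M g + triangle m f h ≤ ∑< m f * ∑< M h + triangle m f g
  excess-mono {M = M} {g = g} {h} z≤n p q = ≤-reflexive (solve 2 (λ x y → K 0 :* x :+ K 0 := K 0 :* y :+ K 0) refl
        (∑< M g) (∑< M h))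
  excess-mono {suc m} {M} {f} {g} {h} r p q =
    ≤-by (f 0 * ((∑< M h + ∑< (suc m) g) - (∑< M g + ∑< (suc m) h)) + ((F * ∑< M h + triangle m f′ g) -
          (F * ∑< M g + triangle m f′ h)))
      (0≤+ (*-nonNeg (p 0) (slack (∑<-gap r q))) (slack (excess-mono (ℕ.≤-trans (ℕ.n≤1+n m) r) (p ∘ suc) q)))
      (solve 8 (λ a F G H g h s t → ((a :+ F) :* G :+ (a :* h :+ t)) :+ (a :* ((H :+ g) :- (G :+ h)) :+
            ((F :* H :+ s) :- (F :* G :+ t)))
             := (a :+ F) :* H :+ (a :* g :+ s)) refl
        (f 0) F (∑< M g) (∑< M h) (∑< (suc m) g) (∑< (suc m) h) (triangle m f′ g) (triangle m f′ h))
    where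
    f′ = f ∘ suc
    F = ∑< m f′

  0≤!⁻¹ : ∀ j → 0# ≤ fromℕ (j !) ⁻¹
  0≤!⁻¹ j = 0≤⁻¹ (0<! j)

  0≤expTerm : ∀ {x} → 0# ≤ x → ∀ j → 0# ≤ expTerm x j
  0≤expTerm p j = *-nonNeg (0≤^ j p) (0≤!⁻¹ j)

  0≤E : ∀ {x} m → 0# ≤ x → 0# ≤ E m x
  0≤E m p = 0≤∑< m (0≤expTerm p)

  E-mono : ∀ {x y} m → 0# ≤ x → x ≤ y → E m x ≤ E m y
  E-mono m p q = sum-mono {m} (λ j → *-monoʳ (0≤!⁻¹ (toℕ j)) (^-mono (toℕ j) p q))

  E-extend : ∀ {x m n} → 0# ≤ x → m ℕ.≤ n → E m x ≤ E n x
  E-extend p q = ∑<-extend (0≤expTerm p) q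

  E-product-≤ : ∀ {x y} m → 0# ≤ x → 0# ≤ y → E m x * E m y ≤ E (m ℕ.+ m) (x + y)
  E-product-≤ {x} {y} m p q = ≤-respʳ (triangle-expTerm x y (m ℕ.+ m)) (product≤triangle m m (0≤expTerm p)
        (0≤expTerm q))

  E-product-≥ : ∀ {x y} m → 0# ≤ x → 0# ≤ y → E m (x + y) ≤ E m x * E m y
  E-product-≥ {x} {y} m p q = ≤-respˡ (triangle-expTerm x y m) (triangle≤product (ℕ.≤-refl {m}) (0≤expTerm p)
        (0≤expTerm q))

  1⁻¹ : fromℕ 1 ⁻¹ ≈ 1#
  1⁻¹ = sym (⁻¹-unique (0<fromℕ 0) (trans (*-identityʳ _) (+-identityʳ 1#)))

  expTerm-0 : ∀ x → expTerm x 0 ≈ 1#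
  expTerm-0 x = trans (*-identityˡ _) 1⁻¹

  expTerm-1 : ∀ x → expTerm x 1 ≈ x
  expTerm-1 x = trans (*-cong (*-identityʳ x) 1⁻¹) (*-identityʳ x)

  -- The linear terms alone differ by `y - x`, and the higher terms are monotone. This slope of at
  -- least 1 turns inequalities between values into inequalities between arguments.
  E-gap : ∀ {x y} m → 0# ≤ x → x ≤ y → E (2 ℕ.+ m) x + (y - x) ≤ E (2 ℕ.+ m) y
  E-gap {x} {y} m p q = ≤-by (∑y - ∑x) (slack (sum-mono {m} (λ j → let i = 2 ℕ.+ toℕ j in *-monoʳ (0≤!⁻¹ i) (^-mono i p q))))
    (trans (+-congʳ (+-congʳ (+-cong (expTerm-0 x) (+-congʳ (expTerm-1 x)))))
      (trans (solve 4 (λ x y s t → ((K 1 :+ (x :+ s)) :+ (y :- x)) :+ (t :- s) := K 1 :+ (y :+ t)) refl x y ∑x ∑y)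
        (sym (+-cong (expTerm-0 y) (+-congʳ (expTerm-1 y))))))
    where
    ∑x = ∑< m (λ j → expTerm x (2 ℕ.+ j))
    ∑y = ∑< m (λ j → expTerm y (2 ℕ.+ j))

  E≥1 : ∀ {x} m → 0# ≤ x → 1# ≤ E (suc m) x
  E≥1 {x} m p = ≤-respˡ (expTerm-0 x) (+-≤ (0≤∑< m (λ j → 0≤expTerm p (suc j))))

  E≥1+x : ∀ {x} m → 0# ≤ x → 1# + x ≤ E (2 ℕ.+ m) x
  E≥1+x {x} m p = ≤-respˡ (trans (sym (+-assoc _ _ _)) (trans (+-congʳ (+-cong (expTerm-0 x) (expTerm-1 x)))
        (+-identityʳ _)))
    (+-mono ≤-refl (+-mono ≤-refl (0≤∑< m (λ j → 0≤expTerm p (2 ℕ.+ j)))))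

  !⁻¹≤1 : ∀ j → fromℕ (j !) ⁻¹ ≤ 1#
  !⁻¹≤1 j = *-cancelˡ-≤ (0<! j) (≤-respˡ (sym (⁻¹-inverseʳ (0<! j))) (≤-respʳ (sym (*-identityʳ _)) (1≤fromℕ
        (ℕ.1≤n! j))))

  E≤geometric : ∀ {u} m → 0# ≤ u → u ≤ 1# → (1# - u) * E m u ≤ 1#
  E≤geometric {u} m p q = ≤-trans (*-monoˡ (slack q) (sum-mono {m} λ j →
      ≤-respʳ (*-identityʳ _) (*-monoˡ (0≤^ (toℕ j) p) (!⁻¹≤1 (toℕ j))))) (geometric m)
    where
    geometric : ∀ m → (1# - u) * ∑< m (u ^_) ≤ 1#
    geometric zero = ≤-respˡ (sym (zeroʳ _)) 0≤1
    geometric (suc m) = ≤-by (u * (1# - (1# - u) * G)) (*-nonNeg p (slack (geometric m)))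
      (trans (+-congʳ (*-congˡ (+-congˡ (sym (*-distribˡ-sum {m} u (λ j → u ^ toℕ j))))))
        (solve 2 (λ u G → (K 1 :- u) :* (K 1 :+ u :* G) :+ u :* (K 1 :- (K 1 :- u) :* G) := K 1) refl u G))
      where G = ∑< m (u ^_)

  -- A truncated form of `1 - u ≤ exp(-u)`, raised to the power `j`: `E-product-≥` splits off one
  -- `u` per step, and `E≤geometric` bounds its factor.
  E-power : ∀ {u} m j → 0# ≤ u → u ≤ 1# → (1# - u) ^ j * E m (fromℕ j * u) ≤ 1#
  E-power {u} zero zero p q = ≤-respˡ (sym (zeroʳ _)) 0≤1
  E-power {u} (suc m) zero p q = ≤-respˡ (sym (trans (*-identityˡ _) (trans (+-cong (expTerm-0 (0# * u))
      (trans (sum-cong-≋ {m} (λ j → trans (*-congʳ (trans (*-congʳ (zeroˡ u)) (zeroˡ _))) (zeroˡ _))) (trans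
            (sum-const m 0#) (zeroʳ _)))) (+-identityʳ 1#)))) ≤-refl
  E-power {u} m (suc j) p q = ≤-trans
    (≤-respˡ (*-congˡ (E-cong m (sym (trans (distribʳ _ _ _) (+-congʳ (*-identityˡ u))))))
      (*-monoˡ (*-nonNeg 0≤1-u (0≤^ j 0≤1-u)) (E-product-≥ m p 0≤ju)))
    (≤-respˡ (solve 4 (λ a b c d → (a :* b) :* (c :* d) := (a :* c) :* (b :* d)) refl (1# - u) (E m u) ((1# - u) ^ j)
          (E m (fromℕ j * u)))
      (≤-respʳ (*-identityʳ 1#) (*-mono (*-nonNeg 0≤1-u (0≤E m p)) (*-nonNeg (0≤^ j 0≤1-u) (0≤E m 0≤ju))
            (E≤geometric m p q) (E-power m j p q))))
    where
    0≤1-u = slack q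
    0≤ju = *-nonNeg (0≤fromℕ j) p

  -- The quotient of consecutive terms is `z / (m + 1)`, which is at most ½ as soon as `m` reaches
  -- `2 z`.
  expTerm-halves : ∀ {z} X → 0# ≤ z → fromℕ 2 * z ≤ fromℕ X → ∀ m → X ℕ.≤ m → fromℕ 2 * expTerm z
        (suc m) ≤ expTerm z m
  expTerm-halves {z} X 0≤z 2z≤X m X≤m = *-cancelˡ-≤ (0<fromℕ m)
    (≤-respˡ (trans (*-congˡ (sym (derivative-expTerm z m))) (solve 3 (λ a b c → a :* (b :* c) := b :* (a :* c)) refl
          (fromℕ 2) (fromℕ (suc m)) (expTerm z (suc m))))
     (≤-respˡ (*-assoc _ _ _) (*-monoʳ {z = expTerm z m} (0≤expTerm 0≤z m) (≤-trans 2z≤X (fromℕ-mono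
           (ℕ.m≤n⇒m≤1+n X≤m))))))

  E-tail : ∀ {z} X → 0# ≤ z → fromℕ 2 * z ≤ fromℕ X → ∀ m i → X ℕ.≤ m → E (i ℕ.+ m) z ≤ E m z + fromℕ 2 * expTerm z m
  E-tail {z} X 0≤z 2z≤X m i X≤m = ≤-trans (+-≤ (*-nonNeg (0≤fromℕ 2) (0≤expTerm 0≤z (i ℕ.+ m)))) (go i)
    where
    -- The claim is strengthened: a partial sum plus twice its next term never grows, because that
    -- double term pays for the term itself and for twice its successor.
    go : ∀ i → E (i ℕ.+ m) z + fromℕ 2 * expTerm z (i ℕ.+ m) ≤ E m z + fromℕ 2 * expTerm z m
    go zero = ≤-refl
    go (suc i) = ≤-trans (≤-by (expTerm z (i ℕ.+ m) - fromℕ 2 * expTerm z (suc i ℕ.+ m))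
        (slack (expTerm-halves X 0≤z 2z≤X (i ℕ.+ m) (ℕ.≤-trans X≤m (ℕ.m≤n+m m i))))
        (trans (+-congʳ (+-congʳ (∑<-suc (i ℕ.+ m) (expTerm z))))
          (solve 3 (λ s a b → ((s :+ a) :+ b) :+ (a :- b) := s :+ K 2 :* a) refl (E (i ℕ.+ m) z) (expTerm z (i ℕ.+ m))
                (fromℕ 2 * expTerm z (suc i ℕ.+ m)))))
      (go i)

  -- Halving beats the growth `(i + 2)/(i + 1) ≤ 2` of the factor. A decay like `1/i` is what
  -- `archimedean` can exploit directly, without powers of two.
  expTerm-decay : ∀ {z} X → 0# ≤ z → fromℕ 2 * z ≤ fromℕ X → ∀ i → fromℕ (suc i) * expTerm z (i ℕ.+ X) ≤ expTerm z X
  expTerm-decay X 0≤z 2z≤X zero = ≤-reflexive (trans (*-congʳ (+-identityʳ 1#)) (*-identityˡ _))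
  expTerm-decay {z} X 0≤z 2z≤X (suc i) = ≤-trans
    (≤-by (fromℕ i * b + fromℕ (suc i) * (a - fromℕ 2 * b))
       (0≤+ (*-nonNeg (0≤fromℕ i) (0≤expTerm 0≤z (suc i ℕ.+ X))) (*-nonNeg (0≤fromℕ (suc i)) (slack
             (expTerm-halves X 0≤z 2z≤X (i ℕ.+ X) (ℕ.m≤n+m X i)))))
       (solve 3 (λ i a b → (K 1 :+ (K 1 :+ i)) :* b :+ (i :* b :+ (K 1 :+ i) :* (a :- K 2 :* b)) :=
             (K 1 :+ i) :* a) refl (fromℕ i) a b))
    (expTerm-decay X 0≤z 2z≤X i)
    where
    a = expTerm z (i ℕ.+ X)
    b = expTerm z (suc i ℕ.+ X)

  -- The double negation is inherited from `archimedean` and is harmless, since `Exp-nonneg` derives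
  -- a contradiction anyway. The length `m + m` is the one that `E-product-≤` produces.
  E-vanishing-tail : ∀ {z η} → 0# ≤ z → 0# < η → ¬ ¬ (Σ ℕ λ M → ∀ m → M ℕ.≤ m → E (m ℕ.+ m) z ≤ E m z + η)
  E-vanishing-tail {z} {η} 0≤z 0<η none = archimedean (fromℕ 2 * z) λ (X , 2z≤X) →
    archimedean (fromℕ 2 * expTerm z X * η ⁻¹) λ (Y , 2e≤Y) → none (Y ℕ.+ X , λ m le →
      let i = m ℕ.∸ X
          m≡ : i ℕ.+ X ≡ m
          m≡ = ℕ.m∸n+n≡m (ℕ.≤-trans (ℕ.m≤n+m X Y) le)
          Y≤i : Y ℕ.≤ i
          Y≤i = ≡.subst (ℕ._≤ i) (ℕ.m+n∸n≡m Y X) (ℕ.∸-monoˡ-≤ X le)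
          small : fromℕ 2 * expTerm z (i ℕ.+ X) ≤ η
          small = *-cancelˡ-≤ (0<fromℕ i) (≤-trans
            (≤-respˡ (solve 3 (λ a b c → b :* (a :* c) := a :* (b :* c)) refl (fromℕ (suc i)) (fromℕ 2) (expTerm z
                  (i ℕ.+ X)))
              (*-monoˡ (0≤fromℕ 2) (expTerm-decay X 0≤z 2z≤X i)))
            (≤-respˡ (trans (*-assoc _ _ _) (trans (*-congˡ (⁻¹-inverseˡ 0<η)) (*-identityʳ _)))
              (*-monoʳ (<⇒≤ 0<η) (≤-trans 2e≤Y (fromℕ-mono (ℕ.m≤n⇒m≤1+n Y≤i))))))
      in ≤-trans (E-tail X 0≤z 2z≤X m m (ℕ.≤-trans (ℕ.m≤n+m X Y) le))
           (+-mono ≤-refl (≡.subst (λ j → fromℕ 2 * expTerm z j ≤ η) m≡ small)))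

  neg-power : ∀ {x} j → 0# ≤ x → ((- x) ^ j ≤ x ^ j) × (- (x ^ j) ≤ (- x) ^ j)
  neg-power zero p = ≤-refl , ≤-trans (≤-respˡ refl (≤-by 1# 0≤1 (-‿inverseˡ 1#))) 0≤1
  neg-power {x} (suc j) p with neg-power j p
  ... | u , l = ≤-by (x * ((- x) ^ j - - (x ^ j))) (*-nonNeg p (slack l)) (solve 3 (λ x a b → (:- x) :* a :+ x :*
        (a :- (:- b)) := x :* b) refl x ((- x) ^ j) (x ^ j))
      , ≤-by (x * (x ^ j - (- x) ^ j)) (*-nonNeg p (slack u)) (solve 3 (λ x a b → :- (x :* b) :+ x :* (b :- a) :=
            (:- x) :* a) refl x ((- x) ^ j) (x ^ j))

  E-0 : ∀ m → E m 0# ≤ 1#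
  E-0 zero = 0≤1
  E-0 (suc m) = ≤-reflexive (trans (+-cong (expTerm-0 0#) (trans (sum-cong-≋ {m} (λ j → trans (*-congʳ (zeroˡ _))
        (zeroˡ _))) (trans (sum-const m 0#) (zeroʳ _)))) (+-identityʳ 1#))

  -- By `excess-mono`, product minus triangle is no larger for the arguments `x`, `- x` than for
  -- `x`, `x`, since `(- x) ^ j ≤ x ^ j`. The first triangle is `E m 0#`, at most 1; the second is
  -- `E m (x + x)`.
  E-product-neg : ∀ {x} m → 0# ≤ x → E m x * E m (- x) + E m (x + x) ≤ 1# + E (m ℕ.+ m) (x + x)
  E-product-neg {x} m p = ≤-trans (+-mono ≤-refl (≤-reflexive (sym (triangle-expTerm x x m))))
    (≤-trans (excess-mono {h = expTerm x} (ℕ.≤-refl {m}) (0≤expTerm p) (λ j → *-monoʳ (0≤!⁻¹ j) (proj₁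
          (neg-power j p))))
      (≤-respˡ (+-comm _ _) (+-mono (≤-trans (≤-reflexive (trans (triangle-expTerm x (- x) m)
          (E-cong m (-‿inverseʳ x)))) (E-0 m)) (E-product-≤ m p p))))

  -- Partial sums behave badly at negative arguments, so a negative `x = - z` is refuted through a
  -- product: `E m z` is at least `1 + z` and `E m x` at least `1 - δ`, yet their product is at most
  -- `1 + η`.
  Exp-nonneg : ∀ {x y} → 1# ≤ y → Exp x y → 0# ≤ x
  Exp-nonneg {x} {y} 1≤y lim with 0# ≤? x
  ... | yes p = p
  ... | no 0≰x = contradiction no-tail (E-vanishing-tail (0≤+ 0≤z 0≤z) 0<η)
    where
    z = - x
    0≤z = neg-nonneg (<⇒≤ (≰⇒> 0≰x))
    0<z : 0# < z
    0<z = 0≤z , λ e → <⇒≱ (≰⇒> 0≰x) (≤-reflexive (trans e (trans (solve 1 (λ x → :- x := (:- x) :+ (:- x) :-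
          (:- x)) refl x)
            (trans (+-congʳ (+-cong (sym e) (sym e))) (solve 1 (λ x → (K 0 :+ K 0) :- (:- x) := x) refl x)))))
    0<1+z : 0# < 1# + z
    0<1+z = 0<+ˡ 0<1 0≤z
    -- With `η = z/4` and `δ (1 + z) = z/2`, the bounds on the product would give
    -- `1 + z/2 ≤ 1 + z/4`.
    η = z * ½ * ½
    0<η : 0# < η
    0<η = 0<* (0<* 0<z 0<½) 0<½
    δ = z * ½ * (1# + z) ⁻¹
    0<δ : 0# < δ
    0<δ = 0<* (0<* 0<z 0<½) (0<⁻¹ 0<1+z)
    δ[1+z] : δ * (1# + z) ≈ z * ½
    δ[1+z] = trans (*-assoc _ _ _) (trans (*-congˡ (⁻¹-inverseˡ 0<1+z)) (*-identityʳ _))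
    δ≤1 : δ ≤ 1#
    δ≤1 = *-cancelˡ-≤ 0<1+z (≤-respˡ (trans (sym δ[1+z]) (*-comm _ _)) (≤-respʳ (sym (*-identityʳ _))
            (≤-by (1# + z * ½) (0≤+ 0≤1 (*-nonNeg 0≤z (<⇒≤ 0<½)))
              (trans (solve 2 (λ z h → z :* h :+ (K 1 :+ z :* h) := K 1 :+ z :* (h :+ h)) refl z ½) (+-congˡ (trans
                    (*-congˡ ½+½) (*-identityʳ z)))))))
    no-tail : ¬ (Σ ℕ λ M → ∀ m → M ℕ.≤ m → E (m ℕ.+ m) (z + z) ≤ E m (z + z) + η)
    no-tail (M , tail) = <⇒≱ 0<η (≤-trans
        (≤-by (((1# + η) - Ez * Ex) + (Ez - (1# + z)) * (1# - δ) + Ez * (Ex - (1# - δ)))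
          (0≤+ (0≤+ (slack bound) (*-nonNeg (slack (E≥1+x (M ℕ.+ N) 0≤z)) (slack δ≤1))) (*-nonNeg (0≤E m 0≤z)
                (slack Ex≥)))
          (trans (solve 6 (λ η e f z δ w → η :+ (((K 1 :+ η) :- e :* f) :+ (e :- (K 1 :+ z)) :* (K 1 :- δ) :+ e :*
                (f :- (K 1 :- δ)))
                  := (K 2 :* η :- z) :+ δ :* (K 1 :+ z)) refl η Ez Ex z δ 0#)
            (trans (+-congˡ δ[1+z]) (trans (solve 2 (λ z h → (K 2 :* (z :* h :* h) :- z) :+ z :* h := z :*
                  (h :+ h) :* h :- z :* (h :+ h) :+ z :* h :+ (z :* (h :+ h) :- z)) refl z ½)
              (trans (+-cong (+-congʳ (+-cong (*-congʳ (*-congˡ ½+½)) (-‿cong (*-congˡ ½+½)))) (+-congʳ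
                    (*-congˡ ½+½)))
                (trans (solve 2 (λ z h → (z :* K 1 :* h :- z :* K 1 :+ z :* h) :+ (z :* K 1 :- z) := z :*
                      (h :+ h) :- z) refl z ½)
                  (trans (+-congʳ (trans (*-congˡ ½+½) (*-identityʳ z))) (-‿inverseʳ z))))))))
        ≤-refl)
      where
      N = proj₁ (lim δ 0<δ)
      m = 2 ℕ.+ (M ℕ.+ N)
      M≤m : M ℕ.≤ m
      M≤m = ℕ.≤-trans (ℕ.m≤m+n M N) (ℕ.m≤n+m _ 2)
      N≤m : N ℕ.≤ m
      N≤m = ℕ.≤-trans (ℕ.m≤n+m N M) (ℕ.m≤n+m _ 2)
      Ez = E m z
      Ex = E m (- z)
      Ex≥ : 1# - δ ≤ Ex
      Ex≥ = ≤-respʳ (E-cong m (sym (-‿involutive x)))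
              (≤-by (E m x + δ - 1#) (slack (≤-trans 1≤y (proj₂ (proj₂ (lim δ 0<δ) m N≤m))))
                (solve 2 (λ δ e → (K 1 :- δ) :+ ((e :+ δ) :- K 1) := e) refl δ (E m x)))
      bound : Ez * Ex ≤ 1# + η
      bound = +-cancelʳ-≤ (E m (z + z)) (≤-trans (E-product-neg m 0≤z) (≤-trans (+-mono ≤-refl (tail m M≤m))
                (≤-reflexive (solve 2 (λ e h → K 1 :+ (e :+ h) := (K 1 :+ h) :+ e) refl (E m (z + z)) η))))

  ≤-approx : ∀ {x y} → (∀ δ → 0# < δ → x ≤ y + δ) → x ≤ y
  ≤-approx {x} {y} p with x ≤? y
  ... | yes q = q
  ... | no x≰y = contradiction
      (≤-by ((y + g * ½) - x) (slack (p (g * ½) (0<* 0<g 0<½)))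
        (trans (solve 3 (λ x y h → (x :- y) :* h :+ ((y :+ (x :- y) :* h) :- x) := (x :- y) :* (h :+ h) :-
              (x :- y)) refl x y ½)
          (trans (+-congʳ (trans (*-congˡ ½+½) (*-identityʳ g))) (-‿inverseʳ g))))
      (<⇒≱ (0<* 0<g 0<½))
    where
    g = x - y
    0<g : 0# < g
    0<g = 0<slack (≰⇒> x≰y)

  Exp-lower : ∀ {x y b} M → Exp x y → (∀ m → b ≤ E (M ℕ.+ m) x) → b ≤ y
  Exp-lower M lim p = ≤-approx λ δ 0<δ → let N , q = lim δ 0<δ in
    ≤-trans (p N) (proj₁ (q (M ℕ.+ N) (ℕ.m≤n+m N M)))

  E≤Exp : ∀ {x y} m → 0# ≤ x → Exp x y → E m x ≤ y
  E≤Exp m p lim = Exp-lower m lim λ i → E-extend p (ℕ.m≤m+n m i)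

  Exp-upper : ∀ {x y c b} → 0# ≤ c → Exp x y → (∀ m → c * E m x ≤ b) → c * y ≤ b
  Exp-upper {x} {y} {c} {b} 0≤c lim p = ≤-approx λ δ 0<δ →
    -- Dividing by `1 + c` instead of `c` keeps the divisor positive when `c` is 0.
    let δ′ = δ * (1# + c) ⁻¹
        0<1+c = 0<+ˡ 0<1 0≤c
        0<δ′ = 0<* 0<δ (0<⁻¹ 0<1+c)
        N , q = lim δ′ 0<δ′
    in ≤-trans (*-monoˡ 0≤c (proj₂ (q N ℕ.≤-refl))) (≤-respˡ (sym (distribˡ _ _ _)) (+-mono (p N)
         (≤-by δ′ (<⇒≤ 0<δ′) (trans (solve 3 (λ c d i → c :* (d :* i) :+ d :* i := d :* (i :* (K 1 :+ c))) refl c δ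
               ((1# + c) ⁻¹))
           (trans (*-congˡ (⁻¹-inverseˡ 0<1+c)) (*-identityʳ δ))))))

  -- The geometric bound gives `E m ½ ≤ 2`. If `x` were smaller than ½, then by `E-gap` all partial
  -- sums at `x` from length 2 on would stay below 2 by at least `½ - x`.
  Exp-≥2 : ∀ {x y} → fromℕ 2 ≤ y → Exp x y → ½ ≤ x
  Exp-≥2 {x} {y} 2≤y lim with ½ ≤? x
  ... | yes p = p
  ... | no ½≰x = contradiction (≤-approx (λ δ 0<δ → let N , q = lim δ 0<δ ; m = 2 ℕ.+ N in
        ≤-by ((E m x + δ - y) + (y - fromℕ 2) + (E m ½ - (E m x + (½ - x))) + fromℕ 2 * (1# - (1# - ½) * E m ½))
          (0≤+ (0≤+ (0≤+ (slack (proj₂ (q m (ℕ.m≤n+m N 2)))) (slack 2≤y)) (slack (E-gap N 0≤x x≤½)))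
               (*-nonNeg (0≤fromℕ 2) (slack (E≤geometric m (<⇒≤ 0<½) (<⇒≤ ½<1)))))
          (trans (solve 6 (λ h x δ y e f → (h :- x) :+ ((e :+ δ :- y) :+ (y :- K 2) :+ (f :- (e :+
                (h :- x))) :+ K 2 :* (K 1 :- (K 1 :- h) :* f))
              := f :* ((h :+ h) :- K 1) :+ δ) refl ½ x δ y (E m x) (E m ½))
            (+-congʳ (trans (*-congˡ (trans (+-congʳ ½+½) (-‿inverseʳ 1#))) (zeroʳ _))))))
      (<⇒≱ (0<slack (≰⇒> ½≰x)))
    where
    0≤x = Exp-nonneg (≤-trans (≤-by 1# 0≤1 (solve 0 (K 1 :+ K 1 := K 2) refl)) 2≤y) lim
    x≤½ = <⇒≤ (≰⇒> ½≰x)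

  E-^ : ∀ {x} m N → 0# ≤ x → Σ ℕ λ m′ → E m x ^ N ≤ E m′ (fromℕ N * x)
  E-^ {x} m zero p = 1 , E≥1 0 (*-nonNeg ≤-refl p)
  E-^ {x} m (suc N) p with E-^ m N p
  ... | m′ , q = (m ℕ.+ m′) ℕ.+ (m ℕ.+ m′) , ≤-trans (*-mono (0≤E m p) (0≤^ N (0≤E m p)) (E-extend p (ℕ.m≤m+n m m′))
        (≤-trans q (E-extend 0≤Nx (ℕ.m≤n+m m′ m))))
      (≤-respʳ (E-cong ((m ℕ.+ m′) ℕ.+ (m ℕ.+ m′)) (sym (trans (distribʳ _ _ _) (+-congʳ (*-identityˡ x)))))
            (E-product-≤ (m ℕ.+ m′) p 0≤Nx))
    where 0≤Nx = *-nonNeg (0≤fromℕ N) p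

  -- For the truncated series the bound is `E-^`. Since `Exp-upper` passes to the limit in one
  -- factor only, `mixed` exchanges the factors `E m l` for `y` one at a time.
  Exp-power : ∀ {l y x P} N → 0# ≤ l → 0# ≤ y → Exp l y → Exp x P → fromℕ N * l ≤ x → y ^ N ≤ P
  Exp-power {l} {y} {x} {P} N 0≤l 0≤y lim-l lim-x Nl≤x = ≤-respˡ (*-identityʳ _) (mixed N 0 (ℕ.+-identityʳ N) 0)
    where
    0≤Nl = *-nonNeg (0≤fromℕ N) 0≤l
    mixed : ∀ i j → i ℕ.+ j ≡ N → ∀ m → y ^ i * E m l ^ j ≤ P
    mixed zero j ≡.refl m = ≤-respˡ (sym (*-identityˡ _)) (let m′ , q = E-^ m j 0≤l in
      ≤-trans q (≤-trans (E-mono m′ 0≤Nl Nl≤x) (E≤Exp m′ (≤-trans 0≤Nl Nl≤x) lim-x)))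
    mixed (suc i) j e m = ≤-respˡ (solve 3 (λ a b c → (a :* b) :* c := (c :* a) :* b) refl (y ^ i) (E m l ^ j) y)
      (Exp-upper (*-nonNeg (0≤^ i 0≤y) (0≤^ j (0≤E m 0≤l))) lim-l λ m′ → ≤-trans
        (≤-respˡ (solve 3 (λ a b c → a :* (c :* b) := (a :* b) :* c) refl (y ^ i) (E m l ^ j) (E m′ l))
          (*-monoˡ (0≤^ i 0≤y) (*-mono (0≤E m′ 0≤l) (0≤^ j (0≤E m 0≤l))
            (E-extend 0≤l (ℕ.m≤n+m m′ m)) (^-mono j (0≤E m 0≤l) (E-extend 0≤l (ℕ.m≤m+n m m′))))))
        (mixed i (suc j) (≡.trans (ℕ.+-suc i j) e) (m ℕ.+ m′)))

  -- A logarithmic bound on the exponents j with e ≤ 64 (1 − u)^j; here 63 bounds ln 64.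
  decay-length : ∀ {u e L} j → 0# ≤ u → u ≤ 1# → 0# < e → e ≤ fromℕ 64 * (1# - u) ^ j → Exp L (e ⁻¹) → 0# ≤ L →
    fromℕ j * u ≤ L + fromℕ 63
  decay-length {u} {e} {L} j 0≤u u≤1 0<e e≤ lim 0≤L with fromℕ j * u ≤? L + fromℕ 63
  ... | yes p = p
  ... | no p = contradiction (≤-approx approx) (<⇒≱ (0<* 0<e 0<g))
    where
    ju = fromℕ j * u
    g = ju - (L + fromℕ 63)
    0<g : 0# < g
    0<g = 0<slack (≰⇒> p)
    c = (1# - u) ^ j
    approx : ∀ δ → 0# < δ → e * g ≤ 0# + δ
    -- On one side `e T₂ ≤ 64 c T₂ ≤ 64`. On the other, `e T₂ ≥ e T₁ + e g` and
    -- `e T₁ ≥ e (E m L)(1 + 63)`, which is within `δ` of 64 because `E m L` is close to `e ⁻¹`.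
    approx δ 0<δ = ≤-by
      ( e * (T₂ - (T₁ + g)) + (fromℕ 64 * (1# - c * T₂) + (fromℕ 64 * c - e) * T₂)
      + e * (T₁ - E m L * E m (fromℕ 63)) + e * (E m L * (E m (fromℕ 63) - (1# + fromℕ 63)))
      + fromℕ 64 * e * (E m L + δ′ - e ⁻¹))
      (0≤+ (0≤+ (0≤+ (0≤+ (*-nonNeg 0≤e (slack gap))
          (0≤+ (*-nonNeg (0≤fromℕ 64) (slack (E-power m₂ j 0≤u u≤1))) (*-nonNeg (slack e≤) (0≤E m₂ 0≤ju))))
        (*-nonNeg 0≤e (slack (E-product-≤ m 0≤L (0≤fromℕ 63)))))
        (*-nonNeg 0≤e (*-nonNeg (0≤E m 0≤L) (slack (E≥1+x N (0≤fromℕ 63))))))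
        (*-nonNeg (*-nonNeg (0≤fromℕ 64) 0≤e) (slack (proj₂ (q m (ℕ.m≤n+m N 2))))))
      (trans (solve 9 (λ e g T₁ T₂ c l f δ i → e :* g :+ (e :* (T₂ :- (T₁ :+ g)) :+ (K 64 :* (K 1 :- c :* T₂) :+
            (K 64 :* c :- e) :* T₂)
              :+ e :* (T₁ :- l :* f) :+ e :* (l :* (f :- (K 1 :+ K 63))) :+ K 64 :* e :* (l :+ δ :- i))
              := (K 64 :- K 64 :* (e :* i)) :+ (K 64 :* e) :* δ) refl e g T₁ T₂ c (E m L) (E m (fromℕ 63)) δ′ (e ⁻¹))
        (+-cong (trans (+-congˡ (-‿cong (trans (*-congˡ (⁻¹-inverseʳ 0<e)) (*-identityʳ _)))) (-‿inverseʳ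
              (fromℕ 64))) δ′-def))
      where
      0≤e = <⇒≤ 0<e
      0<64e : 0# < fromℕ 64 * e
      0<64e = 0<* (0<fromℕ 63) 0<e
      δ′ = δ * (fromℕ 64 * e) ⁻¹
      δ′-def : fromℕ 64 * e * δ′ ≈ δ
      δ′-def = trans (solve 3 (λ a d i → a :* (d :* i) := d :* (a :* i)) refl (fromℕ 64 * e) δ ((fromℕ 64 * e) ⁻¹))
                 (trans (*-congˡ (⁻¹-inverseʳ 0<64e)) (*-identityʳ δ))
      0<δ′ : 0# < δ′
      0<δ′ = 0<* 0<δ (0<⁻¹ 0<64e)
      N = proj₁ (lim δ′ 0<δ′)
      q = proj₂ (lim δ′ 0<δ′)
      m = 2 ℕ.+ N
      m₂ = m ℕ.+ m
      0≤ju = *-nonNeg (0≤fromℕ j) 0≤u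
      T₁ = E m₂ (L + fromℕ 63)
      T₂ = E m₂ ju
      gap : T₁ + g ≤ T₂
      gap = E-gap (N ℕ.+ m) (0≤+ 0≤L (0≤fromℕ 63)) (<⇒≤ (≰⇒> p))

  Bounded : Carrier → Set
  Bounded x = Σ ℕ λ n → x ≤ fromℕ n

  Bounded-+ : ∀ {x y} → Bounded x → Bounded y → Bounded (x + y)
  Bounded-+ (m , p) (n , q) = m ℕ.+ n , ≤-respʳ (sym (fromℕ-+ m n)) (+-mono p q)

  Bounded-∑< : ∀ m {f} → (∀ j → Bounded (f j)) → Bounded (∑< m f)
  Bounded-∑< zero b = 0 , ≤-refl
  Bounded-∑< (suc m) b = Bounded-+ (b 0) (Bounded-∑< m (b ∘ suc))

  -- Consecutive partial sums are eventually within 1 of each other, so x ^ m ≤ m ! for some m ≥ 1.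
  Exp-bounded-argument : ∀ {x y} → 0# ≤ x → Exp x y → Bounded x
  Exp-bounded-argument {x} {y} 0≤x lim with ≤-total x 1#
  ... | inj₁ x≤1 = 1 , ≤-trans x≤1 (≤-reflexive (sym (+-identityʳ 1#)))
  ... | inj₂ 1≤x = m ! , ≤-trans
      (≤-respˡ (*-identityʳ x) (*-monoˡ 0≤x (≤-respˡ (1^ N) (^-mono N 0≤1 1≤x))))
      (≤-respˡ (trans (solve 3 (λ a b i → a :* (b :* i) := b :* (a :* i)) refl (fromℕ (m !)) (x ^ m) (fromℕ (m !) ⁻¹))
            (trans (*-congˡ (⁻¹-inverseʳ (0<! m))) (*-identityʳ _)))
        (≤-respʳ (*-identityʳ _) (*-monoˡ (0≤fromℕ (m !)) term≤1)))
    where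
    N = proj₁ (lim ½ 0<½)
    q = proj₂ (lim ½ 0<½)
    m = suc N
    1^ : ∀ n → 1# ^ n ≈ 1#
    1^ zero = refl
    1^ (suc n) = trans (*-identityˡ _) (1^ n)
    term≤1 : expTerm x m ≤ 1#
    term≤1 = ≤-by ((y + ½ - E (suc m) x) + (E m x + ½ - y))
      (0≤+ (slack (proj₁ (q (suc m) (ℕ.≤-trans (ℕ.n≤1+n N) (ℕ.n≤1+n _))))) (slack (proj₂ (q m (ℕ.n≤1+n N)))))
      (trans (+-congˡ (+-congʳ (+-congˡ (-‿cong (∑<-suc m (expTerm x))))))
        (trans (solve 4 (λ a s y h → a :+ ((y :+ h :- (s :+ a)) :+ (s :+ h :- y)) := h :+ h) refl (expTerm x m)
              (E m x) y ½) ½+½))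

  -- The limit at precision 1 replaces `y` by a single partial sum, whose term `j` is at most
  -- `M ℕ.^ j`.
  Exp-bounded : ∀ {x y} → 0# ≤ x → Exp x y → Bounded y
  Exp-bounded {x} {y} 0≤x lim =
    let M , x≤M = Exp-bounded-argument 0≤x lim
        N , q = lim 1# 0<1
        k , Ex≤k = Bounded-∑< N {expTerm x} λ j → M ℕ.^ j , ≤-respʳ (trans (*-identityʳ _) (sym (fromℕ-^ M j)))
                     (*-mono (0≤^ j 0≤x) (0≤!⁻¹ j) (^-mono j 0≤x x≤M) (!⁻¹≤1 j))
    in k ℕ.+ 1 , ≤-trans (proj₂ (q N ℕ.≤-refl)) (≤-respʳ (sym (fromℕ-+ k 1)) (+-mono Ex≤k (≤-reflexive (sym
          (+-identityʳ 1#)))))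

-- Clustering costs

module Clustering (R : CompleteOrderedField) where
  open FieldProperties R
  open KMeans R
  open IsDecTotalOrder isDecTotalOrder using (_≟_)

  sum-linear : ∀ {n} x (f : Vector Carrier n) → sum (λ i → x * f i) ≈ x * sum f
  sum-linear x f = sym (*-distribˡ-sum x f)

  χ : ∀ {P : Set} → Dec P → Carrier
  χ (yes _) = 1#
  χ (no  _) = 0#

  0≤χ : ∀ {P : Set} (p : Dec P) → 0# ≤ χ p
  0≤χ (yes _) = 0≤1
  0≤χ (no  _) = ≤-refl

  sum-χ : ∀ {n} (a : Fin n) (g : Vector Carrier n) → sum (λ c → χ (a Fin.≟ c) * g c) ≈ g a
  sum-χ {suc n} zero g = trans (+-cong (*-identityˡ _) (trans (sum-cong-≋ {n} (λ i → zeroˡ _)) (trans (sum-const n 0#)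
        (zeroʳ _)))) (+-identityʳ _)
  sum-χ {suc n} (suc a) g = trans (+-cong (zeroˡ _) (trans (sum-cong-≋ {n} shift) (sum-χ a (g ∘ suc))))
        (+-identityˡ _)
    where
    shift : ∀ c → χ (suc a Fin.≟ suc c) * g (suc c) ≈ χ (a Fin.≟ c) * g (suc c)
    shift c with a Fin.≟ c
    ... | yes _ = refl
    ... | no  _ = refl

  -- The factor `w j` on both sides makes indices of weight 0 impose nothing, so the minimum is
  -- taken over the support of `w`.
  weighted-minimiser : ∀ {n} (w g : Vector Carrier n) → (∀ i → 0# ≤ w i) →
    (∀ i → w i ≈ 0#) ⊎ (Σ (Fin n) λ i → ¬ w i ≈ 0# × (∀ j → w j * g i ≤ w j * g j))
  weighted-minimiser {zero} w g p = inj₁ λ ()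
  weighted-minimiser {suc n} w g p with w zero ≟ 0# | weighted-minimiser (w ∘ suc) (g ∘ suc) (p ∘ suc)
  ... | yes e | inj₁ es = inj₁ λ { zero → e ; (suc i) → es i }
  ... | yes e | inj₂ (i , ne , q) = inj₂ (suc i , ne , λ { zero → ≤-reflexive (trans (*-congʳ e) (trans (zeroˡ _) (sym
        (trans (*-congʳ e) (zeroˡ _))))) ; (suc j) → q j })
  ... | no ne | inj₁ es = inj₂ (zero , ne , λ { zero → ≤-refl ; (suc j) → ≤-reflexive (trans (*-congʳ (es j)) (trans
        (zeroˡ _) (sym (trans (*-congʳ (es j)) (zeroˡ _))))) })
  ... | no ne | inj₂ (i , ne′ , q) with ≤-total (g zero) (g (suc i))
  ...   | inj₁ le = inj₂ (zero , ne , λ { zero → ≤-refl ; (suc j) → ≤-trans (*-monoˡ (p (suc j)) le) (q j) })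
  ...   | inj₂ le = inj₂ (suc i , ne′ , λ { zero → *-monoˡ (p zero) le ; (suc j) → q j })

  -- The deterministic form of the remark that some value is at most the mean. The chosen index lies
  -- in the support of the weights; `removal` relies on that.
  weighted-average : ∀ {n} (w g : Vector Carrier n) → (∀ i → 0# ≤ w i) → ¬ sum w ≈ 0# →
    Σ (Fin n) λ i → ¬ w i ≈ 0# × sum w * g i ≤ sum (λ j → w j * g j)
  weighted-average {n} w g p ne with weighted-minimiser w g p
  ... | inj₁ es = contradiction (trans (sum-cong-≋ es) (trans (sum-const n 0#) (zeroʳ _))) ne
  ... | inj₂ (i , ne′ , q) = i , ne′ , ≤-respˡ (sym (*-distribʳ-sum (g i) w)) (sum-mono q)

  private
    foldr-⊓-≤ : ∀ {m} z (v : Vector Carrier m) → foldr _⊓_ z v ≤ z × (∀ c → foldr _⊓_ z v ≤ v c)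
    foldr-⊓-≤ {zero} z v = ≤-refl , λ ()
    foldr-⊓-≤ {suc m} z v with foldr-⊓-≤ z (v ∘ suc)
    ... | p , q = ≤-trans (x⊓y≤y (v zero) _) p , λ { zero → x⊓y≤x (v zero) _ ; (suc c) → ≤-trans (x⊓y≤y (v zero) _)
          (q c) }

    foldr-⊓-attained : ∀ {m} z (v : Vector Carrier m) → (foldr _⊓_ z v ≡ z) ⊎ (Σ (Fin m) λ c → foldr _⊓_ z v ≡ v c)
    foldr-⊓-attained {zero} z v = inj₁ ≡.refl
    foldr-⊓-attained {suc m} z v with ≤-total (v zero) (foldr _⊓_ z (v ∘ suc)) | foldr-⊓-attained z (v ∘ suc)
    ... | inj₁ _ | _ = inj₂ (zero , ≡.refl)
    ... | inj₂ _ | inj₁ e = inj₁ e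
    ... | inj₂ _ | inj₂ (c , e) = inj₂ (suc c , e)

  minimum≤ : ∀ {m} (v : Vector Carrier (suc m)) c → minimum v ≤ v c
  minimum≤ v zero = proj₁ (foldr-⊓-≤ (head v) (tail v))
  minimum≤ v (suc c) = proj₂ (foldr-⊓-≤ (head v) (tail v)) c

  minimiser : ∀ {m} (v : Vector Carrier (suc m)) → Σ (Fin (suc m)) λ c → minimum v ≡ v c
  minimiser v with foldr-⊓-attained (head v) (tail v)
  ... | inj₁ e = zero , e
  ... | inj₂ (c , e) = suc c , e

  ‖-‖²-cong : ∀ {d} {x x′ y y′ : Point d} → x ≋ x′ → y ≋ y′ → ‖ x - y ‖² ≈ ‖ x′ - y′ ‖²
  ‖-‖²-cong p q = sum-cong-≋ λ l → *-cong (+-cong (p l) (-‿cong (q l))) (+-cong (p l) (-‿cong (q l)))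

  0≤‖-‖² : ∀ {d} (x y : Point d) → 0# ≤ ‖ x - y ‖²
  0≤‖-‖² {d} x y = 0≤sum {d} λ l → 0≤x² (x l - y l)

  infix 4 _∈̇_
  _∈̇_ : ∀ {d m} → Point d → Vector (Point d) m → Set
  p ∈̇ S = Σ _ λ c → S c ≋ p

  module Costs {n d} (X : Vector (Point d) n) where

    distance : ∀ {m} → Vector (Point d) (suc m) → Fin n → Carrier
    distance S i = minimum λ c → ‖ X i - S c ‖²

    nearest : ∀ {m} → Vector (Point d) (suc m) → Fin n → Fin (suc m)
    nearest S i = proj₁ (minimiser (λ c → ‖ X i - S c ‖²))

    distance-nearest : ∀ {m} (S : Vector (Point d) (suc m)) i → distance S i ≈ ‖ X i - S (nearest S i) ‖²
    distance-nearest S i = reflexive (proj₂ (minimiser (λ c → ‖ X i - S c ‖²)))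

    distance≤ : ∀ {m} (S : Vector (Point d) (suc m)) i {p} → p ∈̇ S → distance S i ≤ ‖ X i - p ‖²
    distance≤ S i (c , e) = ≤-respʳ (‖-‖²-cong (λ _ → refl) e) (minimum≤ (λ c → ‖ X i - S c ‖²) c)

    0≤distance : ∀ {m} (S : Vector (Point d) (suc m)) i → 0# ≤ distance S i
    0≤distance S i = ≤-respʳ (sym (distance-nearest S i)) (0≤‖-‖² (X i) (S (nearest S i)))

    0≤cost : ∀ {m} (S : Vector (Point d) (suc m)) → 0# ≤ cost X S
    0≤cost S = 0≤sum (0≤distance S)

    cost-cover : ∀ {m m′} (S : Vector (Point d) (suc m)) (S′ : Vector (Point d) (suc m′)) → (∀ c → S′ c ∈̇ S) →
          cost X S ≤ cost X S′
    cost-cover S S′ cover = sum-mono λ i → ≤-respʳ (sym (distance-nearest S′ i)) (distance≤ S i (cover _))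

    cost-self : ∀ {m} (S : Vector (Point d) (suc m)) → (∀ i → X i ∈̇ S) → cost X S ≤ 0#
    cost-self S cover = ≤-respʳ (trans (sum-const n 0#) (zeroʳ _)) (sum-mono λ i → ≤-respʳ
      (trans (sum-cong-≋ {d} (λ l → trans (*-congʳ (-‿inverseʳ _)) (zeroˡ _))) (trans (sum-const d 0#) (zeroʳ _)))
            (distance≤ S i (cover i)))

    module Weighted (w : Vector Carrier n) (0≤w : ∀ i → 0# ≤ w i) (W≉0 : ¬ sum w ≈ 0#) where
      W = sum w

      0<W : 0# < W
      0<W = 0≤sum 0≤w , λ e → W≉0 (sym e)

      μ : Point d
      μ l = W ⁻¹ * sum (λ i → w i * X i l)

      V : Carrier
      V = sum λ i → w i * ‖ X i - μ ‖²

      centred : ∀ l → sum (λ i → w i * (X i l - μ l)) ≈ 0#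
      centred l = begin
        sum (λ i → w i * (X i l - μ l)) ≈⟨ sum-cong-≋ (λ i → solve 3 (λ w x m → w :* (x :- m) := w :* x :+ w :*
              (:- m)) refl (w i) (X i l) (μ l)) ⟩
        sum (λ i → w i * X i l + w i * (- μ l)) ≈⟨ ∑-distrib-+ {n} _ _ ⟩
        Σx + sum (λ i → w i * (- μ l)) ≈⟨ +-congˡ (sym (*-distribʳ-sum _ w)) ⟩
        Σx + W * (- (W ⁻¹ * Σx)) ≈⟨ solve 3 (λ s W i → s :+ W :* (:- (i :* s)) := (K 1 :- W :* i) :* s) refl Σx W
              (W ⁻¹) ⟩
        (1# - W * W ⁻¹) * Σx ≈⟨ *-congʳ (trans (+-congˡ (-‿cong (⁻¹-inverseʳ 0<W))) (-‿inverseʳ 1#)) ⟩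
        0# * Σx ≈⟨ zeroˡ _ ⟩
        0# ∎
        where
        open ≈R
        Σx = sum (λ i → w i * X i l)

      -- The cross terms vanish by `centred`. With `τ = 1` this is the decomposition of the cost of
      -- a cluster at an arbitrary center (`variance-at`); with `τ = σ` it is the mean effect of
      -- appending one scaled data point (`herding`).
      variance : ∀ (a : Point d) τ → sum (λ i → w i * sum (λ l → (a l + τ * (X i l - μ l)) * (a l + τ *
            (X i l - μ l)))) ≈ W * sum (λ l → a l * a l) + τ * τ * V
      variance a τ = begin
        sum (λ i → w i * sum (λ l → (a l + τ * (X i l - μ l)) * (a l + τ * (X i l - μ l))))
          ≈⟨ sum-cong-≋ (λ i → *-distribˡ-sum (w i) (λ l → (a l + τ * (X i l - μ l)) * (a l + τ * (X i l - μ l)))) ⟩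
        sum (λ i → sum (λ l → w i * ((a l + τ * (X i l - μ l)) * (a l + τ * (X i l - μ l)))))
          ≈⟨ ∑-comm (λ i l → w i * ((a l + τ * (X i l - μ l)) * (a l + τ * (X i l - μ l)))) ⟩
        sum (λ l → sum (λ i → w i * ((a l + τ * (X i l - μ l)) * (a l + τ * (X i l - μ l)))))
          ≈⟨ sum-cong-≋ coordinate ⟩
        sum (λ l → W * (a l * a l) + τ * τ * sum (λ i → w i * ((X i l - μ l) * (X i l - μ l))))
          ≈⟨ ∑-distrib-+ {d} _ _ ⟩
        sum (λ l → W * (a l * a l)) + sum (λ l → τ * τ * sum (λ i → w i * ((X i l - μ l) * (X i l - μ l))))
          ≈⟨ +-cong (sum-linear {d} W _) (sum-linear {d} (τ * τ) _) ⟩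
        W * sum (λ l → a l * a l) + τ * τ * sum (λ l → sum (λ i → w i * ((X i l - μ l) * (X i l - μ l))))
          ≈⟨ +-congˡ (*-congˡ (∑-comm (λ l i → w i * ((X i l - μ l) * (X i l - μ l))))) ⟩
        W * sum (λ l → a l * a l) + τ * τ * sum (λ i → sum (λ l → w i * ((X i l - μ l) * (X i l - μ l))))
          ≈⟨ +-congˡ (*-congˡ (sum-cong-≋ (λ i → sum-linear {d} (w i) _))) ⟩
        W * sum (λ l → a l * a l) + τ * τ * V ∎
        where
        open ≈R
        coordinate : ∀ l → sum (λ i → w i * ((a l + τ * (X i l - μ l)) * (a l + τ * (X i l - μ l)))) ≈
          W * (a l * a l) + τ * τ * sum (λ i → w i * ((X i l - μ l) * (X i l - μ l)))
        coordinate l = begin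
          sum (λ i → w i * ((a l + τ * (X i l - μ l)) * (a l + τ * (X i l - μ l))))
            ≈⟨ sum-cong-≋ (λ i → solve 4 (λ w a t y → w :* ((a :+ t :* y) :* (a :+ t :* y)) := w :* (a :* a) :+
                  ((K 2 :* a :* t) :* (w :* y) :+ t :* t :* (w :* (y :* y)))) refl (w i) (a l) τ (X i l - μ l)) ⟩
          sum (λ i → w i * (a l * a l) + (fromℕ 2 * a l * τ * (w i * (X i l - μ l)) + τ * τ * (w i * ((X i l - μ l) *
                (X i l - μ l)))))
            ≈⟨ trans (∑-distrib-+ {n} _ _) (+-congˡ (∑-distrib-+ {n} _ _)) ⟩
          sum (λ i → w i * (a l * a l)) + (sum (λ i → fromℕ 2 * a l * τ * (w i * (X i l - μ l))) + sum (λ i → τ * τ *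
                (w i * ((X i l - μ l) * (X i l - μ l)))))
            ≈⟨ +-cong (sym (*-distribʳ-sum _ w)) (+-cong (trans (sum-linear {n} _ _) (trans (*-congˡ (centred l))
                  (zeroʳ _))) (sum-linear {n} _ _)) ⟩
          W * (a l * a l) + (0# + τ * τ * sum (λ i → w i * ((X i l - μ l) * (X i l - μ l))))
            ≈⟨ +-congˡ (+-identityˡ _) ⟩
          W * (a l * a l) + τ * τ * sum (λ i → w i * ((X i l - μ l) * (X i l - μ l))) ∎

      variance-at : ∀ (y : Point d) → sum (λ i → w i * ‖ X i - y ‖²) ≈ W * ‖ y - μ ‖² + V
      variance-at y = trans (sum-cong-≋ λ i → *-congˡ (sum-cong-≋ λ l → solve 3 (λ x y m → (x :- y) :* (x :- y) :=
            ((m :- y) :+ K 1 :* (x :- m)) :* ((m :- y) :+ K 1 :* (x :- m))) refl (X i l) (y l) (μ l)))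
        (trans (variance (λ l → μ l - y l) 1#) (+-cong (*-congˡ (sum-cong-≋ λ l → solve 2 (λ m y → (m :- y) :*
              (m :- y) := (y :- m) :* (y :- m)) refl (μ l) (y l)))
          (trans (*-congʳ (*-identityˡ 1#)) (*-identityˡ V))))

      V≤ : ∀ c → V ≤ sum (λ i → w i * ‖ X i - c ‖²)
      V≤ c = ≤-by (W * ‖ c - μ ‖²) (*-nonNeg (<⇒≤ 0<W) (0≤‖-‖² c μ)) (trans (+-comm _ _) (sym (variance-at c)))

    -- Level j holds sums of j points scaled by σ = 1/s.
    record Levels (s : ℕ) (σ : Carrier) (Level : ℕ → Point d → Set) : Set where
      field
        sσ≈1  : fromℕ s * σ ≈ 1#
        0≤σ   : 0# ≤ σ
        root  : Σ (Point d) λ y → Level 0 y × (∀ l → y l ≈ 0#)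
        child : ∀ {j y} → j ℕ.< s → Level j y → ∀ i → Σ (Point d) λ y′ → Level (suc j) y′ × (∀ l →
              y′ l ≈ y l + σ * X i l)

    module Candidates {s σ Level} (levels : Levels s σ Level) where
      open Levels levels

      Candidate : Point d → Set
      Candidate y = Σ ℕ λ j → j ℕ.≤ s × Level j y

      -- Some extension of y by a data point keeps W ‖y − jσμ‖² ≤ jσ²V, because the
      -- cross terms cancel on weighted average.
      herding : (w : Vector Carrier n) (0≤w : ∀ i → 0# ≤ w i) (W≉0 : ¬ sum w ≈ 0#) → ∀ j → j ℕ.≤ s → let open Weighted w 0≤w W≉0 in
        Σ (Point d) λ y → Level j y × W * sum (λ l → (y l - fromℕ j * σ * μ l) *
              (y l - fromℕ j * σ * μ l)) ≤ fromℕ j * (σ * σ) * V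
      herding w 0≤w W≉0 zero _ = let y , level , y≈0 = root in y , level ,
          ≤-reflexive (trans (trans (*-congˡ (trans (sum-cong-≋ λ l → trans (*-congʳ (trans (+-congʳ (y≈0 l)) (solve 2
                (λ s m → K 0 :- K 0 :* s :* m := K 0) refl σ (μ l)))) (zeroˡ _)) (trans (sum-const d 0#) (zeroʳ _))))
                (zeroʳ _))
            (solve 2 (λ s v → K 0 := K 0 :* s :* v) refl (σ * σ) V))
        where open Weighted w 0≤w W≉0
      herding w 0≤w W≉0 (suc j) j<s with herding w 0≤w W≉0 j (ℕ.<⇒≤ j<s)
      ... | y , level , near with weighted-average w (λ i → sum λ l → (a l + σ * (X i l - μ l)) * (a l + σ *
            (X i l - μ l))) 0≤w W≉0
        where
        open Weighted w 0≤w W≉0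
        a : Point d
        a l = y l - fromℕ j * σ * μ l
      ... | i , _ , le with child j<s level i
      ... | y′ , level′ , y′≈ = y′ , level′ , ≤-respˡ (*-congˡ (sum-cong-≋ λ l → sym (*-cong (step l) (step l))))
            (≤-trans le
          (≤-respˡ (sym (variance a σ)) (≤-respʳ (solve 3 (λ j s v → j :* s :* v :+ s :* v :=
                (K 1 :+ j) :* s :* v) refl (fromℕ j) (σ * σ) V) (+-mono near ≤-refl))))
        where
        open Weighted w 0≤w W≉0
        a : Point d
        a l = y l - fromℕ j * σ * μ l
        step : ∀ l → y′ l - fromℕ (suc j) * σ * μ l ≈ a l + σ * (X i l - μ l)
        step l = trans (+-congʳ (y′≈ l)) (solve 5 (λ y s x j m → (y :+ s :* x) :- (K 1 :+ j) :* s :* m :=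
              (y :- j :* s :* m) :+ s :* (x :- m)) refl (y l) σ (X i l) (fromℕ j) (μ l))

      -- Since `s σ = 1`, the final bound of `herding` reads `W ‖y - μ‖² ≤ σ V`, so the cost at `y`
      -- is at most `(1 + σ) V`, and `V` is the least cost of any center. A cluster of weight 0 is
      -- served by the root, which is why `Candidate` admits all levels up to `s`.
      cluster-candidate : (w : Vector Carrier n) → (∀ i → 0# ≤ w i) → (c : Point d) →
        Σ (Point d) λ y → Candidate y × sum (λ i → w i * ‖ X i - y ‖²) ≤ (1# + σ) * sum (λ i → w i * ‖ X i - c ‖²)
      cluster-candidate w 0≤w c with sum w ≟ 0#
      ... | yes e = let y , level , _ = root in y , (0 , z≤n , level) , ≤-trans (≤-reflexive (trans (sum-cong-≋ λ i → trans (*-congʳ (w≈0 i)) (zeroˡ _)) (trans (sum-const n 0#) (zeroʳ _))))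
              (*-nonNeg (0≤+ 0≤1 0≤σ) (0≤sum λ i → *-nonNeg (0≤w i) (0≤‖-‖² (X i) c)))
        where
        w≈0 : ∀ i → w i ≈ 0#
        w≈0 i = ≤-antisym (≤-respʳ e (term≤sum 0≤w i)) (0≤w i)
      ... | no W≉0 = let y , level , near = herding w 0≤w W≉0 s ℕ.≤-refl in y , (s , ℕ.≤-refl , level) ,
          ≤-respˡ (sym (variance-at y)) (≤-trans (+-mono (≤-respʳ simplify (≤-respˡ (*-congˡ (sum-cong-≋ λ l → *-cong
                (centre y l) (centre y l))) near)) ≤-refl)
            (≤-respˡ (solve 2 (λ s v → (K 1 :+ s) :* v := s :* v :+ v) refl σ V) (*-monoˡ (0≤+ 0≤1 0≤σ) (V≤ c))))
        where
        open Weighted w 0≤w W≉0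
        centre : ∀ (y : Point d) l → y l - fromℕ s * σ * μ l ≈ y l - μ l
        centre y l = +-congˡ (-‿cong (trans (*-congʳ sσ≈1) (*-identityˡ _)))
        simplify : fromℕ s * (σ * σ) * V ≈ σ * V
        simplify = *-congʳ (trans (sym (*-assoc _ _ _)) (trans (*-congʳ sσ≈1) (*-identityˡ σ)))

      -- Each cluster of `S` gets its own candidate. Points keep their old assignment for the
      -- estimate, even if another center of `S′` is nearer.
      candidate-solution : ∀ {m} (S : Vector (Point d) (suc m)) →
        Σ (Vector (Point d) (suc m)) λ S′ → (∀ c → Candidate (S′ c)) × cost X S′ ≤ (1# + σ) * cost X S
      candidate-solution {m} S = S′ , (λ c → proj₁ (proj₂ (cluster c))) , (begin
        cost X S′ ≤⟨ sum-mono (λ i → distance≤ S′ i (a i , λ _ → refl)) ⟩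
        sum (λ i → ‖ X i - S′ (a i) ‖²) ≈⟨ regroup S′ ⟩
        sum (λ c → sum (λ i → χ (a i Fin.≟ c) * ‖ X i - S′ c ‖²)) ≤⟨ sum-mono (λ c → proj₂ (proj₂ (cluster c))) ⟩
        sum (λ c → (1# + σ) * sum (λ i → χ (a i Fin.≟ c) * ‖ X i - S c ‖²)) ≈⟨ sum-linear {suc m} (1# + σ) (λ c → sum
              (λ i → χ (a i Fin.≟ c) * ‖ X i - S c ‖²)) ⟩
        (1# + σ) * sum (λ c → sum (λ i → χ (a i Fin.≟ c) * ‖ X i - S c ‖²)) ≈⟨ *-congˡ (sym (regroup S)) ⟩
        (1# + σ) * sum (λ i → ‖ X i - S (a i) ‖²) ≈⟨ *-congˡ (sum-cong-≋ (λ i → sym (distance-nearest S i))) ⟩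
        (1# + σ) * cost X S ∎)
        where
        open ≤R
        a = nearest S
        cluster : ∀ c → _
        cluster c = cluster-candidate (λ i → χ (a i Fin.≟ c)) (λ i → 0≤χ (a i Fin.≟ c)) (S c)
        S′ : Vector (Point d) (suc m)
        S′ c = proj₁ (cluster c)
        regroup : ∀ S → sum (λ i → ‖ X i - S (a i) ‖²) ≈ sum (λ c → sum (λ i → χ (a i Fin.≟ c) * ‖ X i - S c ‖²))
        regroup S = trans (sum-cong-≋ λ i → sym (sum-χ (a i) (λ c → ‖ X i - S c ‖²))) (∑-comm (λ i c → χ
              (a i Fin.≟ c) * ‖ X i - S c ‖²))

    -- In the sum over all trial centers `S c`, each point is charged its new distance once, for its
    -- nearest center in `S`, and its old distance otherwise. The set `T⁺` comes after `c`, so that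
    -- the bound applies to every array containing both `T` and `S c`.
    addition : ∀ {m m′ k} (T : Vector (Point d) (suc m)) (S : Vector (Point d) (suc m′)) → suc m′ ℕ.≤ k →
      Σ (Fin (suc m′)) λ c → ∀ {m⁺} (T⁺ : Vector (Point d) (suc m⁺)) → (∀ t → T t ∈̇ T⁺) → S c ∈̇ T⁺ →
        fromℕ k * cost X T⁺ + cost X T ≤ fromℕ k * cost X T + cost X S
    addition {m} {m′} {k} T S m′<k with weighted-average {suc m′} (λ _ → 1#) h (λ _ → 0≤1) (λ e → pos⇒≉0 (0<fromℕ m′)
          (trans (sym (trans (sum-const (suc m′) 1#) (*-identityʳ _))) e))
      where
      h : Fin (suc m′) → Carrier
      h c = sum λ i → distance T i ⊓ ‖ X i - S c ‖²
    ... | c , _ , le = c , λ T⁺ covers new →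
      let T⁺≤h : cost X T⁺ ≤ h c
          T⁺≤h = sum-mono λ i → ⊓-glb (≤-respʳ (sym (distance-nearest T i)) (distance≤ T⁺ i (covers (nearest T i))))
                (distance≤ T⁺ i new)
      -- The last summand covers sets `S` of fewer than `k` centers: the trial cost `h c` never
      -- exceeds the cost of `T`.
      in ≤-by (fromℕ k * (h c - cost X T⁺) + ((M′ * cost X T + cost X S) - (M′ * h c + cost X T)) + (fromℕ k - M′) *
            (cost X T - h c))
        (0≤+ (0≤+ (*-nonNeg (0≤fromℕ k) (slack T⁺≤h)) (slack average)) (*-nonNeg (slack (fromℕ-mono m′<k)) (slack
              (sum-mono {n} λ i → x⊓y≤x _ _))))
        (solve 6 (λ k m h t t⁺ s → (k :* t⁺ :+ t) :+ (k :* (h :- t⁺) :+ ((m :* t :+ s) :- (m :* h :+ t)) :+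
              (k :- m) :* (t :- h)) := k :* t :+ s) refl
          (fromℕ k) M′ (h c) (cost X T) (cost X T⁺) (cost X S))
      where
      M′ = fromℕ (suc m′)
      h : Fin (suc m′) → Carrier
      h c = sum λ i → distance T i ⊓ ‖ X i - S c ‖²
      a = nearest S
      pointwise : ∀ i c → distance T i ⊓ ‖ X i - S c ‖² ≤ distance T i + χ (a i Fin.≟ c) *
            (‖ X i - S c ‖² - distance T i)
      pointwise i c with a i Fin.≟ c
      ... | yes _ = ≤-trans (x⊓y≤y _ _) (≤-reflexive (solve 2 (λ d e → e := d :+ K 1 :* (e :- d)) refl
            (distance T i) ‖ X i - S c ‖²))
      ... | no _ = ≤-trans (x⊓y≤x _ _) (≤-reflexive (solve 2 (λ d e → d := d :+ K 0 :* (e :- d)) refl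
            (distance T i) ‖ X i - S c ‖²))
      per-point : ∀ i → sum (λ c → distance T i ⊓ ‖ X i - S c ‖²) ≤ M′ * distance T i + (distance S i - distance T i)
      per-point i = ≤-trans (sum-mono (pointwise i)) (≤-reflexive (trans (∑-distrib-+ {suc m′} (λ _ → distance T i)
            (λ c → χ (a i Fin.≟ c) * (‖ X i - S c ‖² - distance T i))) (+-cong (sum-const (suc m′) (distance T i))
        (trans (sum-χ (a i) (λ c → ‖ X i - S c ‖² - distance T i)) (+-congʳ (sym (distance-nearest S i)))))))
      Σdiff : sum (λ i → distance S i - distance T i) ≈ cost X S - cost X T
      Σdiff = trans (∑-distrib-+ (distance S) (λ i → - distance T i)) (+-congˡ
        (trans (sum-cong-≋ {n} λ i → solve 1 (λ x → :- x := (:- K 1) :* x) refl (distance T i))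
          (trans (sum-linear (- 1#) (distance T)) (solve 1 (λ x → (:- K 1) :* x := :- x) refl (cost X T)))))
      average : M′ * h c + cost X T ≤ M′ * cost X T + cost X S
      average = begin
        M′ * h c + cost X T ≈⟨ +-congʳ (*-congʳ (sym (trans (sum-const (suc m′) 1#) (*-identityʳ _)))) ⟩
        sum {suc m′} (λ _ → 1#) * h c + cost X T ≤⟨ +-mono le ≤-refl ⟩
        sum (λ c → 1# * h c) + cost X T ≈⟨ +-congʳ (sum-cong-≋ {suc m′} λ c → *-identityˡ (h c)) ⟩
        sum h + cost X T ≈⟨ +-congʳ (∑-comm (λ c i → distance T i ⊓ ‖ X i - S c ‖²)) ⟩
        sum (λ i → sum (λ c → distance T i ⊓ ‖ X i - S c ‖²)) + cost X T ≤⟨ +-mono (sum-mono per-point) ≤-refl ⟩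
        sum (λ i → M′ * distance T i + (distance S i - distance T i)) + cost X T
          ≈⟨ +-congʳ (∑-distrib-+ (λ i → M′ * distance T i) (λ i → distance S i - distance T i)) ⟩
        sum (λ i → M′ * distance T i) + sum (λ i → distance S i - distance T i) + cost X T
          ≈⟨ +-congʳ (+-cong (sum-linear M′ (distance T)) Σdiff) ⟩
        M′ * cost X T + (cost X S - cost X T) + cost X T
          ≈⟨ solve 3 (λ m t s → (m :* t :+ (s :- t)) :+ t := m :* t :+ s) refl M′ (cost X T) (cost X S) ⟩
        M′ * cost X T + cost X S ∎
        where open ≤R

  -- In norms, two triangle inequalities give `‖x - p‖ ≤ ‖x - t‖ + 2 ‖x - c‖`, and squaring costs a
  -- factor 2. To avoid square roots, the cross terms are absorbed into squares coordinate by
  -- coordinate; the factor 3 clears denominators. The right side is split into the old cost of `x`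
  -- and its increase.
  reassignment : ∀ {d} (x t c p : Point d) → ‖ c - p ‖² ≤ ‖ c - t ‖² → ‖ x - p ‖² ≤ ‖ x - t ‖² +
        (‖ x - t ‖² + fromℕ 8 * ‖ x - c ‖²)
  reassignment {d} x t c p le = *-cancelˡ-≤ (0<fromℕ 2) (begin
    fromℕ 3 * ‖ x - p ‖² ≈⟨ sym (sum-linear {d} _ _) ⟩
    sum (λ l → fromℕ 3 * ((x l - p l) * (x l - p l))) ≤⟨ sum-mono (λ l → ≤-by ((fromℕ 3 * (x l - c l) - (c l - p l)) *
          (fromℕ 3 * (x l - c l) - (c l - p l))) (0≤x² _)
        (solve 3 (λ x c p → K 3 :* ((x :- p) :* (x :- p)) :+ (K 3 :* (x :- c) :- (c :- p)) :* (K 3 :* (x :- c) :-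
              (c :- p)) := K 12 :* ((x :- c) :* (x :- c)) :+ K 4 :* ((c :- p) :* (c :- p))) refl (x l) (c l) (p l))) ⟩
    sum (λ l → fromℕ 12 * ((x l - c l) * (x l - c l)) + fromℕ 4 * ((c l - p l) * (c l - p l))) ≈⟨ linear 12 4 (λ l →
          (x l - c l) * (x l - c l)) (λ l → (c l - p l) * (c l - p l)) ⟩
    fromℕ 12 * ‖ x - c ‖² + fromℕ 4 * ‖ c - p ‖² ≤⟨ +-mono ≤-refl (*-monoˡ (0≤fromℕ 4) le) ⟩
    fromℕ 12 * ‖ x - c ‖² + fromℕ 4 * ‖ c - t ‖² ≈⟨ sym (linear 12 4 (λ l → (x l - c l) * (x l - c l)) (λ l →
          (c l - t l) * (c l - t l))) ⟩
    sum (λ l → fromℕ 12 * ((x l - c l) * (x l - c l)) + fromℕ 4 * ((c l - t l) * (c l - t l))) ≤⟨ sum-mono (λ l → ≤-by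
          (fromℕ 2 * (((x l - t l) + fromℕ 2 * (x l - c l)) * ((x l - t l) + fromℕ 2 * (x l - c l)))) (*-nonNeg
          (0≤fromℕ 2) (0≤x² _))
        (solve 3 (λ x c t → (K 12 :* ((x :- c) :* (x :- c)) :+ K 4 :* ((c :- t) :* (c :- t))) :+ K 2 :*
              (((x :- t) :+ K 2 :* (x :- c)) :* ((x :- t) :+ K 2 :* (x :- c))) := K 24 :* ((x :- c) :*
              (x :- c)) :+ K 6 :* ((x :- t) :* (x :- t))) refl (x l) (c l) (t l))) ⟩
    sum (λ l → fromℕ 24 * ((x l - c l) * (x l - c l)) + fromℕ 6 * ((x l - t l) * (x l - t l))) ≈⟨ linear 24 6 (λ l →
          (x l - c l) * (x l - c l)) (λ l → (x l - t l) * (x l - t l)) ⟩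
    fromℕ 24 * ‖ x - c ‖² + fromℕ 6 * ‖ x - t ‖² ≈⟨ solve 2 (λ u y → K 24 :* u :+ K 6 :* y := K 3 :* (y :+
          (y :+ K 8 :* u))) refl ‖ x - c ‖² ‖ x - t ‖² ⟩
    fromℕ 3 * (‖ x - t ‖² + (‖ x - t ‖² + fromℕ 8 * ‖ x - c ‖²)) ∎)
    where
    open ≤R
    linear : ∀ a b (f g : Vector Carrier d) → sum (λ l →
          fromℕ a * f l + fromℕ b * g l) ≈ fromℕ a * sum f + fromℕ b * sum g
    linear a b f g = trans (∑-distrib-+ {d} _ _) (+-cong (sum-linear _ f) (sum-linear _ g))

  module Removal {n d} (X : Vector (Point d) n) where
    open Costs X

    -- The increase is averaged over the centers of `T` outside the image of `φ`, and the nonzero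
    -- weight of the chosen one certifies that it lies there. The increase `g` is returned together
    -- with its factor, so that nothing is divided by `|T| - k`.
    removal : ∀ {m m′ k} (T : Vector (Point d) (suc m)) (S : Vector (Point d) (suc m′)) → suc m′ ℕ.≤ k → k ℕ.< suc m →
      Σ (Fin (suc m)) λ t → ∀ {m⁻} (T⁻ : Vector (Point d) (suc m⁻)) → (∀ c → c ≢ t → T c ∈̇ T⁻) →
        Σ Carrier λ g → cost X T⁻ ≤ cost X T + g × 0# ≤ g × (fromℕ
              (suc m) - fromℕ k) * g ≤ cost X T + fromℕ 8 * cost X S
    removal {m} {m′} {k} T S m′<k k<m = t , λ T⁻ keep → G t , cost-bound t (free t (proj₁ (proj₂ chosen))) T⁻ keep ,
          0≤G t , gain
      where
      α β : Fin n → Carrier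
      α = distance S
      β = distance T
      φ : Fin (suc m′) → Fin (suc m)
      φ c = proj₁ (minimiser (λ t → ‖ S c - T t ‖²))
      captured? : ∀ t → Dec (Σ (Fin (suc m′)) λ c → φ c ≡ t)
      captured? t = Fin.any? λ c → φ c Fin.≟ t
      w : Vector Carrier (suc m)
      w t = χ (¬? (captured? t))
      0≤w : ∀ t → 0# ≤ w t
      0≤w t = 0≤χ (¬? (captured? t))
      -- By `reassignment`, moving point `i` away from its center adds at most `β i + 8 α i`.
      G : Vector Carrier (suc m)
      G t = sum λ i → χ (nearest T i Fin.≟ t) * (β i + fromℕ 8 * α i)
      0≤β+8α : ∀ i → 0# ≤ β i + fromℕ 8 * α i
      0≤β+8α i = 0≤+ (0≤distance T i) (*-nonNeg (0≤fromℕ 8) (0≤distance S i))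
      0≤G : ∀ t → 0# ≤ G t
      0≤G t = 0≤sum λ i → *-nonNeg (0≤χ (nearest T i Fin.≟ t)) (0≤β+8α i)
      M = fromℕ (suc m)
      -- A center is either free or hit by some `φ c`. In the sum over `t` each `c` is counted once,
      -- so at least `|T| - |S|` centers are free.
      count : ∀ t → 1# ≤ w t + sum (λ c → χ (φ c Fin.≟ t))
      count t with captured? t
      ... | no _ = +-≤ (0≤sum λ c → 0≤χ (φ c Fin.≟ t))
      ... | yes (c , e) = ≤-respʳ (sym (+-identityˡ _)) (≤-trans (one (φ c Fin.≟ t)) (term≤sum (λ c → 0≤χ
            (φ c Fin.≟ t)) c))
        where
        one : (p : Dec (φ c ≡ t)) → 1# ≤ χ p
        one (yes _) = ≤-refl
        one (no ne) = contradiction e ne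
      M≤W+m′ : M ≤ sum w + fromℕ (suc m′)
      M≤W+m′ = begin
        M ≈⟨ sym (trans (sum-const (suc m) 1#) (*-identityʳ _)) ⟩
        sum {suc m} (λ _ → 1#) ≤⟨ sum-mono count ⟩
        sum (λ t → w t + sum (λ c → χ (φ c Fin.≟ t))) ≈⟨ ∑-distrib-+ w (λ t → sum (λ c → χ (φ c Fin.≟ t))) ⟩
        sum w + sum (λ t → sum (λ c → χ (φ c Fin.≟ t))) ≈⟨ +-congˡ (∑-comm (λ t c → χ (φ c Fin.≟ t))) ⟩
        sum w + sum (λ c → sum (λ t → χ (φ c Fin.≟ t))) ≈⟨ +-congˡ (sum-cong-≋ λ c → trans (sum-cong-≋ λ t → sym
              (*-identityʳ (χ (φ c Fin.≟ t)))) (sum-χ (φ c) (λ _ → 1#))) ⟩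
        sum w + sum {suc m′} (λ _ → 1#) ≈⟨ +-congˡ (trans (sum-const (suc m′) 1#) (*-identityʳ _)) ⟩
        sum w + fromℕ (suc m′) ∎
        where open ≤R
      M-K≤W : M - fromℕ k ≤ sum w
      M-K≤W = ≤-by ((sum w + fromℕ (suc m′) - M) + (fromℕ k - fromℕ (suc m′))) (0≤+ (slack M≤W+m′) (slack
            (fromℕ-mono m′<k)))
        (solve 4 (λ M k w m → (M :- k) :+ ((w :+ m :- M) :+ (k :- m)) := w) refl M (fromℕ k) (sum w) (fromℕ (suc m′)))
      0<W : 0# < sum w
      0<W = <-≤-trans 0<1 (≤-trans (≤-by (M - fromℕ (suc k)) (slack (fromℕ-mono k<m))
        (solve 2 (λ M k → K 1 :+ (M :- (K 1 :+ k)) := M :- k) refl M (fromℕ k))) M-K≤W)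
      chosen = weighted-average w G 0≤w (pos⇒≉0 0<W)
      t = proj₁ chosen
      free : ∀ t → ¬ w t ≈ 0# → ∀ c → φ c ≢ t
      free t ne c e with captured? t
      ... | yes _ = ne refl
      ... | no q = q (c , e)
      w≤1 : ∀ t → w t ≤ 1#
      w≤1 t with captured? t
      ... | yes _ = 0≤1
      ... | no _ = ≤-refl
      ΣG : sum G ≈ cost X T + fromℕ 8 * cost X S
      ΣG = begin
        sum G ≈⟨ ∑-comm (λ t i → χ (nearest T i Fin.≟ t) * (β i + fromℕ 8 * α i)) ⟩
        sum (λ i → sum (λ t → χ (nearest T i Fin.≟ t) * (β i + fromℕ 8 * α i))) ≈⟨ sum-cong-≋ (λ i → sum-χ
              (nearest T i) (λ _ → β i + fromℕ 8 * α i)) ⟩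
        sum (λ i → β i + fromℕ 8 * α i) ≈⟨ ∑-distrib-+ β (λ i → fromℕ 8 * α i) ⟩
        sum β + sum (λ i → fromℕ 8 * α i) ≈⟨ +-congˡ (sum-linear (fromℕ 8) α) ⟩
        cost X T + fromℕ 8 * cost X S ∎
        where open ≈R
      gain : (M - fromℕ k) * G t ≤ cost X T + fromℕ 8 * cost X S
      gain = ≤-trans (*-monoʳ (0≤G t) M-K≤W) (≤-trans (proj₂ (proj₂ chosen))
        (≤-respʳ ΣG (sum-mono λ j → ≤-respʳ (*-identityˡ (G j)) (*-monoʳ (0≤G j) (w≤1 j)))))
      cost-bound : ∀ t → (∀ c → φ c ≢ t) → ∀ {m⁻} (T⁻ : Vector (Point d) (suc m⁻)) → (∀ c → c ≢ t → T c ∈̇ T⁻) →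
            cost X T⁻ ≤ cost X T + G t
      cost-bound t t-free T⁻ keep = ≤-respʳ (∑-distrib-+ β (λ i → χ (nearest T i Fin.≟ t) * (β i + fromℕ 8 * α i)))
            (sum-mono pointwise)
        where
        pointwise : ∀ i → distance T⁻ i ≤ β i + χ (nearest T i Fin.≟ t) * (β i + fromℕ 8 * α i)
        pointwise i with nearest T i Fin.≟ t
        ... | no ne = ≤-respʳ (sym (trans (+-congˡ (zeroˡ _)) (+-identityʳ _)))
                (≤-respʳ (sym (distance-nearest T i)) (distance≤ T⁻ i (keep (nearest T i) ne)))
        ... | yes _ = ≤-trans (distance≤ T⁻ i (keep (φ (nearest S i)) (t-free (nearest S i))))
            (≤-trans (reassignment (X i) (T (nearest T i)) (S (nearest S i)) (T (φ (nearest S i)))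
                (≤-respˡ (reflexive (proj₂ (minimiser (λ t → ‖ S (nearest S i) - T t ‖²)))) (minimum≤ (λ t → ‖ S
                      (nearest S i) - T t ‖²) (nearest T i))))
              (≤-reflexive (+-cong (sym (distance-nearest T i)) (trans (+-cong (sym (distance-nearest T i)) (*-congˡ
                    (sym (distance-nearest S i)))) (sym (*-identityˡ _))))))

-- Programs and their running time

update-≡ : ∀ {A : Set} (f : ℕ → A) {a b v} → a ≡ b → (f [ a ↦ v ]) b ≡ v
update-≡ f {a} {b} e with a ℕ.≟ b
... | yes _ = ≡.refl
... | no ne = contradiction e ne

update-≢ : ∀ {A : Set} (f : ℕ → A) {a b v} → a ≢ b → (f [ a ↦ v ]) b ≡ f b
update-≢ f {a} {b} ne with a ℕ.≟ b
... | yes e = contradiction e ne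
... | no _ = ≡.refl

block : List Instruction → Program
block []       = skip
block (i ∷ is) = exec i ⨾ block is

-- Counts cell r down to 0; cell 3 is assumed to hold 1.
for : ℕ → Program → Program
for r p = while (leᵢ 3 r) (p ⨾ exec (subᵢ r r 3))

-- Loops with counter 5 run over the d coordinates, all others at most Z times.
rounds : ℕ → ℕ → Test → ℕ
rounds Z d (leᵢ _ 5) = d
rounds Z d _         = Z

-- It depends on the text alone, hence is a polynomial in `Z` and `d` for a fixed program. A loop
-- pays for one test per round and for the final failing test.
bound : ℕ → ℕ → Program → ℕ
bound Z d skip        = 1
bound Z d (exec _)    = 1
bound Z d (p ⨾ q)     = bound Z d p ℕ.+ bound Z d q
bound Z d (if _ p q)  = suc (bound Z d p ℕ.+ bound Z d q)
bound Z d (while b p) = suc (rounds Z d b ℕ.* suc (bound Z d p))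

coefficient : Program → ℕ
coefficient skip        = 1
coefficient (exec _)    = 1
coefficient (p ⨾ q)     = coefficient p ℕ.+ coefficient q
coefficient (if _ p q)  = suc (coefficient p ℕ.+ coefficient q)
coefficient (while b p) = 2 ℕ.+ coefficient p

-- `rounds 1 0 b` is 1 for a loop charged with `Z` and 0 for a loop over the coordinates; `d-degree`
-- exchanges the two values.
Z-degree : Program → ℕ
Z-degree skip        = 0
Z-degree (exec _)    = 0
Z-degree (p ⨾ q)     = Z-degree p ℕ.⊔ Z-degree q
Z-degree (if _ p q)  = Z-degree p ℕ.⊔ Z-degree q
Z-degree (while b p) = rounds 1 0 b ℕ.+ Z-degree p

d-degree : Program → ℕ
d-degree skip        = 0
d-degree (exec _)    = 0
d-degree (p ⨾ q)     = d-degree p ℕ.⊔ d-degree q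
d-degree (if _ p q)  = d-degree p ℕ.⊔ d-degree q
d-degree (while b p) = rounds 0 1 b ℕ.+ d-degree p

module _ {Z d : ℕ} (1≤Z : 1 ℕ.≤ Z) (1≤d : 1 ℕ.≤ d) where
  open ℕ.≤-Reasoning

  private
    instance
      Z≢0 : ℕ.NonZero Z
      Z≢0 = ℕ.>-nonZero 1≤Z
      d≢0 : ℕ.NonZero d
      d≢0 = ℕ.>-nonZero 1≤d

    monomial : ℕ → ℕ → ℕ
    monomial a b = Z ℕ.^ a ℕ.* d ℕ.^ b

    1≤monomial : ∀ a b → 1 ℕ.≤ monomial a b
    1≤monomial a b = ℕ.*-mono-≤ (ℕ.m^n>0 Z a) (ℕ.m^n>0 d b)

    monomial-mono : ∀ {a a′ b b′} → a ℕ.≤ a′ → b ℕ.≤ b′ → monomial a b ℕ.≤ monomial a′ b′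
    monomial-mono p q = ℕ.*-mono-≤ (ℕ.^-monoʳ-≤ Z p) (ℕ.^-monoʳ-≤ d q)

    monomial-* : ∀ a b a′ b′ → monomial a b ℕ.* monomial a′ b′ ≡ monomial (a ℕ.+ a′) (b ℕ.+ b′)
    monomial-* a b a′ b′ = ≡.trans (ℕ.[m*n]*[o*p]≡[m*o]*[n*p] (Z ℕ.^ a) (d ℕ.^ b) (Z ℕ.^ a′) (d ℕ.^ b′))
      (≡.cong₂ ℕ._*_ (≡.sym (ℕ.^-distribˡ-+-* Z a a′)) (≡.sym (ℕ.^-distribˡ-+-* d b b′)))

    rounds-monomial : ∀ b → rounds Z d b ≡ monomial (rounds 1 0 b) (rounds 0 1 b)
    rounds-monomial b with rounds-cases b
      where
      rounds-cases : ∀ b → (∀ x y → rounds x y b ≡ x) ⊎ (∀ x y → rounds x y b ≡ y)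
      rounds-cases (leᵢ _ 0) = inj₁ λ _ _ → ≡.refl
      rounds-cases (leᵢ _ 1) = inj₁ λ _ _ → ≡.refl
      rounds-cases (leᵢ _ 2) = inj₁ λ _ _ → ≡.refl
      rounds-cases (leᵢ _ 3) = inj₁ λ _ _ → ≡.refl
      rounds-cases (leᵢ _ 4) = inj₁ λ _ _ → ≡.refl
      rounds-cases (leᵢ _ 5) = inj₂ λ _ _ → ≡.refl
      rounds-cases (leᵢ _ (suc (suc (suc (suc (suc (suc _))))))) = inj₁ λ _ _ → ≡.refl
      rounds-cases (leᵣ _ _) = inj₁ λ _ _ → ≡.refl
    ... | inj₁ e rewrite e Z d | e 1 0 | e 0 1 = ≡.sym (≡.trans (ℕ.*-identityʳ _) (ℕ.*-identityʳ Z))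
    ... | inj₂ e rewrite e Z d | e 1 0 | e 0 1 = ≡.sym (≡.trans (ℕ.*-identityˡ _) (ℕ.*-identityʳ d))

    sum-bound : ∀ {x y} c c′ a a′ b b′ → x ℕ.≤ c ℕ.* monomial a b → y ℕ.≤ c′ ℕ.* monomial a′ b′ →
      x ℕ.+ y ℕ.≤ (c ℕ.+ c′) ℕ.* monomial (a ℕ.⊔ a′) (b ℕ.⊔ b′)
    sum-bound {x} {y} c c′ a a′ b b′ p q = begin
      x ℕ.+ y ≤⟨ ℕ.+-mono-≤ p q ⟩
      c ℕ.* monomial a b ℕ.+ c′ ℕ.* monomial a′ b′
        ≤⟨ ℕ.+-mono-≤ (ℕ.*-monoʳ-≤ c (monomial-mono (ℕ.m≤m⊔n a a′) (ℕ.m≤m⊔n b b′))) (ℕ.*-monoʳ-≤ c′ (monomial-mono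
              (ℕ.m≤n⊔m a a′) (ℕ.m≤n⊔m b b′))) ⟩
      c ℕ.* monomial (a ℕ.⊔ a′) (b ℕ.⊔ b′) ℕ.+ c′ ℕ.* monomial (a ℕ.⊔ a′) (b ℕ.⊔ b′) ≡⟨ ≡.sym
            (ℕ.*-distribʳ-+ _ c c′) ⟩
      (c ℕ.+ c′) ℕ.* monomial (a ℕ.⊔ a′) (b ℕ.⊔ b′) ∎

  bound≤ : ∀ p → bound Z d p ℕ.≤ coefficient p ℕ.* (Z ℕ.^ Z-degree p ℕ.* d ℕ.^ d-degree p)
  bound≤ skip = ℕ.≤-refl
  bound≤ (exec _) = ℕ.≤-refl
  bound≤ (p ⨾ q) = sum-bound (coefficient p) (coefficient q) (Z-degree p) (Z-degree q) (d-degree p) (d-degree q)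
        (bound≤ p) (bound≤ q)
  bound≤ (if b p q) = ℕ.+-mono-≤ (1≤monomial (Z-degree p ℕ.⊔ Z-degree q) (d-degree p ℕ.⊔ d-degree q))
    (sum-bound (coefficient p) (coefficient q) (Z-degree p) (Z-degree q) (d-degree p) (d-degree q) (bound≤ p)
          (bound≤ q))
  bound≤ (while b p) = begin
    suc (rounds Z d b ℕ.* suc (bound Z d p))
      ≤⟨ ℕ.+-mono-≤ (1≤monomial (za ℕ.+ Z-degree p) (db ℕ.+ d-degree p)) (ℕ.≤-trans
           (ℕ.*-monoʳ-≤ (rounds Z d b) (ℕ.+-mono-≤ (1≤monomial (Z-degree p) (d-degree p)) (bound≤ p)))
           (ℕ.≤-reflexive (≡.trans (≡.cong (ℕ._* (suc (coefficient p) ℕ.* monomial (Z-degree p) (d-degree p)))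
                 (rounds-monomial b))
              (≡.trans (≡.trans (≡.sym (ℕ.*-assoc (monomial za db) (suc (coefficient p)) _)) (≡.trans (≡.cong
                    (ℕ._* monomial (Z-degree p) (d-degree p)) (ℕ.*-comm (monomial za db) (suc (coefficient p))))
                    (ℕ.*-assoc (suc (coefficient p)) (monomial za db) _)))
                (≡.cong (suc (coefficient p) ℕ.*_) (monomial-* za db (Z-degree p) (d-degree p))))))) ⟩
    (2 ℕ.+ coefficient p) ℕ.* monomial (za ℕ.+ Z-degree p) (db ℕ.+ d-degree p) ∎
    where
    za = rounds 1 0 b
    db = rounds 0 1 b

-- Integer cells from 40 on hold an array, real cells from 16 on hold points;
-- the cells below are registers. Indirect integer stores are required to avoid
-- registers (see Ready); indirect real stores are not and may touch any cell.
keepsᵢ₁ : ℕ → Instruction → Bool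
keepsᵢ₁ x (constᵢ a c)   = not (a ≡ᵇ x)
keepsᵢ₁ x (addᵢ a b c)   = not (a ≡ᵇ x)
keepsᵢ₁ x (subᵢ a b c)   = not (a ≡ᵇ x)
keepsᵢ₁ x (loadᵢ a b)    = not (a ≡ᵇ x)
keepsᵢ₁ x (storeᵢ a b)   = x <ᵇ 40
keepsᵢ₁ x _              = true

keepsᵣ₁ : ℕ → Instruction → Bool
keepsᵣ₁ x (zeroᵣ a)      = not (a ≡ᵇ x)
keepsᵣ₁ x (oneᵣ a)       = not (a ≡ᵇ x)
keepsᵣ₁ x (opᵣ o a b c)  = not (a ≡ᵇ x)
keepsᵣ₁ x (loadᵣ a b)    = not (a ≡ᵇ x)
keepsᵣ₁ x (storeᵣ a b)   = false
keepsᵣ₁ x _              = true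

lowᵢ₁ : Instruction → Bool
lowᵢ₁ (constᵢ a c)   = a <ᵇ 40
lowᵢ₁ (addᵢ a b c)   = a <ᵇ 40
lowᵢ₁ (subᵢ a b c)   = a <ᵇ 40
lowᵢ₁ (loadᵢ a b)    = a <ᵇ 40
lowᵢ₁ (storeᵢ a b)   = false
lowᵢ₁ _              = true

lowᵣ₁ : Instruction → Bool
lowᵣ₁ (zeroᵣ a)      = a <ᵇ 16
lowᵣ₁ (oneᵣ a)       = a <ᵇ 16
lowᵣ₁ (opᵣ o a b c)  = a <ᵇ 16
lowᵣ₁ (loadᵣ a b)    = a <ᵇ 16
lowᵣ₁ (storeᵣ a b)   = false
lowᵣ₁ _              = true

everywhere : (Instruction → Bool) → Program → Bool
everywhere f skip        = true
everywhere f (exec i)    = f i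
everywhere f (p ⨾ q)     = everywhere f p ∧ everywhere f q
everywhere f (if _ p q)  = everywhere f p ∧ everywhere f q
everywhere f (while _ p) = everywhere f p

T-not : ∀ {a x} → T (not (a ≡ᵇ x)) → a ≢ x
T-not {a} {x} t ≡.refl with a ≡ᵇ a | ℕ.≡⇒≡ᵇ a a ≡.refl
... | true | _ = t

∧-split : ∀ {x y} → T (x ∧ y) → T x × T y
∧-split {true} {true} _ = tt , tt

-- Hoare triples with time bounds and frames

module Triples (R : CompleteOrderedField) (Z d : ℕ) where
  open CompleteOrderedField R using (Carrier; _≤?_)
  open RealRAM R

  record Frame (p : Program) (s s′ : State) : Set where
    constructor mkFrame
    field
      frameᵢ : ∀ x → T (everywhere (keepsᵢ₁ x) p) → int s′ x ≡ int s x
      frameᵣ : ∀ x → T (everywhere (keepsᵣ₁ x) p) → real s′ x ≡ real s x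
      frameᵢ-high : T (everywhere lowᵢ₁ p) → ∀ x → 40 ℕ.≤ x → int s′ x ≡ int s x
      frameᵣ-high : T (everywhere lowᵣ₁ p) → ∀ x → 16 ℕ.≤ x → real s′ x ≡ real s x

  open Frame public

  -- For a concrete program and cell the Boolean test evaluates, so the implicit argument has type
  -- `⊤` and is filled in silently.
  keepᵢ : ∀ {p s s′} → Frame p s s′ → ∀ x → {T (everywhere (keepsᵢ₁ x) p)} → int s′ x ≡ int s x
  keepᵢ f x {t} = frameᵢ f x t

  keepᵣ : ∀ {p s s′} → Frame p s s′ → ∀ x → {T (everywhere (keepsᵣ₁ x) p)} → real s′ x ≡ real s x
  keepᵣ f x {t} = frameᵣ f x t

  highᵢ : ∀ {p s s′} → Frame p s s′ → {T (everywhere lowᵢ₁ p)} → ∀ x → 40 ℕ.≤ x → int s′ x ≡ int s x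
  highᵢ f {t} = frameᵢ-high f t

  highᵣ : ∀ {p s s′} → Frame p s s′ → {T (everywhere lowᵣ₁ p)} → ∀ x → 16 ℕ.≤ x → real s′ x ≡ real s x
  highᵣ f {t} = frameᵣ-high f t

  frame-refl : ∀ {p s} → Frame p s s
  frame-refl = mkFrame (λ _ _ → ≡.refl) (λ _ _ → ≡.refl) (λ _ _ _ → ≡.refl) (λ _ _ _ → ≡.refl)

  frame-trans : ∀ {p s s′ s″} → Frame p s s′ → Frame p s′ s″ → Frame p s s″
  frame-trans f g = mkFrame
    (λ x t → ≡.trans (frameᵢ g x t) (frameᵢ f x t)) (λ x t → ≡.trans (frameᵣ g x t) (frameᵣ f x t))
    (λ t x q → ≡.trans (frameᵢ-high g t x q) (frameᵢ-high f t x q)) (λ t x q → ≡.trans (frameᵣ-high g t x q)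
          (frameᵣ-high f t x q))

  frame-map : ∀ {p q s s′} → (∀ f → T (everywhere f q) → T (everywhere f p)) → Frame p s s′ → Frame q s s′
  frame-map h f = mkFrame (λ x t → frameᵢ f x (h _ t)) (λ x t → frameᵣ f x (h _ t))
    (λ t → frameᵢ-high f (h _ t)) (λ t → frameᵣ-high f (h _ t))

  frame-left : ∀ {p q s s′} → Frame p s s′ → Frame (p ⨾ q) s s′
  frame-left {p} = frame-map λ f t → proj₁ (∧-split {everywhere f p} t)

  frame-right : ∀ {p q s s′} → Frame q s s′ → Frame (p ⨾ q) s s′
  frame-right {p} = frame-map λ f t → proj₂ (∧-split {everywhere f p} t)

  Ready : Instruction → State → Set
  Ready (storeᵢ a b) s = 40 ℕ.≤ int s a
  Ready i            s = Executable i s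

  ready⇒executable : ∀ i {s} → Ready i s → Executable i s
  ready⇒executable (constᵢ a c) p = tt
  ready⇒executable (addᵢ a b c) p = tt
  ready⇒executable (subᵢ a b c) p = tt
  ready⇒executable (loadᵢ a b) p = tt
  ready⇒executable (storeᵢ a b) p = tt
  ready⇒executable (zeroᵣ a) p = tt
  ready⇒executable (oneᵣ a) p = tt
  ready⇒executable (opᵣ add a b c) p = tt
  ready⇒executable (opᵣ sub a b c) p = tt
  ready⇒executable (opᵣ mul a b c) p = tt
  ready⇒executable (opᵣ div a b c) p = p
  ready⇒executable (loadᵣ a b) p = tt
  ready⇒executable (storeᵣ a b) p = tt

  private
    at : ∀ {A : Set} (f : ℕ → A) a v x → T (not (a ≡ᵇ x)) → (f [ a ↦ v ]) x ≡ f x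
    at f a v x t = update-≢ f (T-not {a} {x} t)

    above : ∀ {A : Set} (f : ℕ → A) a v c → T (a <ᵇ c) → ∀ x → c ℕ.≤ x → (f [ a ↦ v ]) x ≡ f x
    above f a v c t x q = update-≢ f (ℕ.<⇒≢ (ℕ.<-≤-trans (ℕ.<ᵇ⇒< a c t) q))

    below : ∀ {A : Set} (f : ℕ → A) a v c → c ℕ.≤ a → ∀ x → T (x <ᵇ c) → (f [ a ↦ v ]) x ≡ f x
    below f a v c q x t = update-≢ f λ e → ℕ.<⇒≢ (ℕ.<-≤-trans (ℕ.<ᵇ⇒< x c t) q) (≡.sym e)

    frame-int : ∀ i {s} a v → (∀ x → T (keepsᵢ₁ x i) → T (not (a ≡ᵇ x))) → (T (lowᵢ₁ i) → T (a <ᵇ 40)) →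
      Frame (exec i) s ⟪ int s [ a ↦ v ] , real s ⟫
    frame-int i {s} a v p q = mkFrame (λ x t → at (int s) a v x (p x t)) (λ _ _ → ≡.refl)
      (λ t x → above (int s) a v 40 (q t) x) (λ _ _ _ → ≡.refl)

    frame-real : ∀ i {s} a v → (∀ x → T (keepsᵣ₁ x i) → T (not (a ≡ᵇ x))) → (T (lowᵣ₁ i) → T (a <ᵇ 16)) →
      Frame (exec i) s ⟪ int s , real s [ a ↦ v ] ⟫
    frame-real i {s} a v p q = mkFrame (λ _ _ → ≡.refl) (λ x t → at (real s) a v x (p x t))
      (λ _ _ _ → ≡.refl) (λ t x → above (real s) a v 16 (q t) x)

  frame-exec : ∀ i {s} → Ready i s → Frame (exec i) s (⟦ i ⟧ᵢ s)
  frame-exec i@(constᵢ a c) _ = frame-int i a _ (λ _ t → t) (λ t → t)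
  frame-exec i@(addᵢ a b c) _ = frame-int i a _ (λ _ t → t) (λ t → t)
  frame-exec i@(subᵢ a b c) _ = frame-int i a _ (λ _ t → t) (λ t → t)
  frame-exec i@(loadᵢ a b) _ = frame-int i a _ (λ _ t → t) (λ t → t)
  frame-exec (storeᵢ a b) {s} q = mkFrame (below (int s) (int s a) (int s b) 40 q) (λ _ _ → ≡.refl) (λ ()) (λ _ _ _ →
        ≡.refl)
  frame-exec i@(zeroᵣ a) _ = frame-real i a _ (λ _ t → t) (λ t → t)
  frame-exec i@(oneᵣ a) _ = frame-real i a _ (λ _ t → t) (λ t → t)
  frame-exec i@(opᵣ o a b c) _ = frame-real i a _ (λ _ t → t) (λ t → t)
  frame-exec i@(loadᵣ a b) _ = frame-real i a _ (λ _ t → t) (λ t → t)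
  frame-exec (storeᵣ a b) {s} q = mkFrame (λ _ _ → ≡.refl) (λ _ ()) (λ _ _ _ → ≡.refl) (λ ())

  -- Total correctness from one given state, bundled with the time bound and the untouched cells.
  -- Preconditions are ordinary hypotheses about `s`.
  record Tri (s : State) (p : Program) (Q : State → Set) : Set where
    constructor mkTri
    field
      {time}  : ℕ
      {final} : State
      run     : ⟨ p , s ⟩⇓[ time ] final
      time≤   : time ℕ.≤ bound Z d p
      frame   : Frame p s final
      post    : Q final

  open Tri public

  weaken : ∀ {s p Q Q′} → Tri s p Q → (∀ {s′} → Frame p s s′ → Q s′ → Q′ s′) → Tri s p Q′
  weaken t f = mkTri (run t) (time≤ t) (frame t) (f (frame t) (post t))

  infixl 1 _>>=_
  _>>=_ : ∀ {s p q Q Q′} → Tri s p Q → (∀ {s′} → Frame p s s′ × Q s′ → Tri s′ q Q′) → Tri s (p ⨾ q) Q′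
  _>>=_ {p = p} {q} t f = let u = f (frame t , post t) in
    mkTri (seq (run t) (run u)) (ℕ.+-mono-≤ (time≤ t) (time≤ u))
      (frame-trans (frame-left {p} {q} (frame t)) (frame-right {p} {q} (frame u))) (post u)

  tri-skip : ∀ {s} → Tri s skip (s ≡_)
  tri-skip = mkTri skip ℕ.≤-refl frame-refl ≡.refl

  tri-exec : ∀ i {s} → Ready i s → Tri s (exec i) (⟦ i ⟧ᵢ s ≡_)
  tri-exec i r = mkTri (exec (ready⇒executable i r)) ℕ.≤-refl (frame-exec i r) ≡.refl

  runBlock : List Instruction → State → State
  runBlock []       s = s
  runBlock (i ∷ is) s = runBlock is (⟦ i ⟧ᵢ s)

  ReadyBlock : List Instruction → State → Set
  ReadyBlock []       s = ⊤
  ReadyBlock (i ∷ is) s = Ready i s × ReadyBlock is (⟦ i ⟧ᵢ s)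

  tri-block : ∀ is {s} → ReadyBlock is s → Tri s (block is) (runBlock is s ≡_)
  tri-block [] _ = tri-skip
  tri-block (i ∷ is) (r , rs) = tri-exec i r >>= λ { (_ , ≡.refl) → tri-block is rs }

  holds? : ∀ b s → Dec (Holds b s)
  holds? (leᵢ a b) s = int s a ℕ.≤? int s b
  holds? (leᵣ a b) s = real s a ≤? real s b

  tri-if : ∀ {s b p q Q} → (Holds b s → Tri s p Q) → (¬ Holds b s → Tri s q Q) → Tri s (if b p q) Q
  tri-if {s} {b} {p} {q} f g with holds? b s
  ... | yes h = let t = f h in mkTri (then h (run t)) (s≤s (ℕ.≤-trans (time≤ t) (ℕ.m≤m+n _ _))) (frame-map (λ e u → proj₁ (∧-split {everywhere e p} u)) (frame t)) (post t)
  ... | no ¬h = let t = g ¬h in mkTri (else ¬h (run t)) (s≤s (ℕ.≤-trans (time≤ t) (ℕ.m≤n+m _ _))) (frame-map (λ e u → proj₂ (∧-split {everywhere e p} u)) (frame t)) (post t)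

  -- `I` is indexed by the number of completed rounds. A successful test must imply `m ℕ.< N`, which
  -- gives both termination and the time bound. The frame back to `s` tells the body which cells no
  -- earlier round has changed.
  tri-while : ∀ {s b p} N → N ℕ.≤ rounds Z d b → (I : ℕ → State → Set) →
    (∀ m s′ → Frame p s s′ → I m s′ → Holds b s′ → m ℕ.< N × Tri s′ p (I (suc m))) →
    I 0 s → Tri s (while b p) (λ s′ → ¬ Holds b s′ × Σ ℕ λ m → m ℕ.≤ N × I m s′)
  tri-while {s} {b} {p} N N≤ I step start =
    let t = go N 0 ≡.refl frame-refl start in
    mkTri (proj₁ (proj₂ (proj₂ t))) (ℕ.≤-trans (proj₁ (proj₂ (proj₂ (proj₂ t)))) (s≤s (ℕ.*-monoˡ-≤ (suc
          (bound Z d p)) N≤)))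
      (proj₁ (proj₂ (proj₂ (proj₂ (proj₂ t))))) (proj₂ (proj₂ (proj₂ (proj₂ (proj₂ t)))))
    where
    go : ∀ fuel m → m ℕ.+ fuel ≡ N → ∀ {s′} → Frame p s s′ → I m s′ → Σ ℕ λ t → Σ State λ s″ →
      ⟨ while b p , s′ ⟩⇓[ t ] s″ × t ℕ.≤ suc (fuel ℕ.* suc (bound Z d p)) × Frame
            (while b p) s s″ × ¬ Holds b s″ × Σ ℕ λ m → m ℕ.≤ N × I m s″
    go fuel m e {s′} f inv with holds? b s′
    ... | no ¬h = 1 , s′ , stop ¬h , s≤s z≤n , frame-map (λ _ u → u) f , ¬h , m , ≡.subst (m ℕ.≤_) e
          (ℕ.m≤m+n m fuel) , inv
    ... | yes h with step m s′ f inv h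
    go zero m e f inv | yes h | m<N , _ = ⊥-elim (ℕ.<-irrefl (≡.trans (≡.sym (ℕ.+-identityʳ m)) e) m<N)
    go (suc fuel) m e f inv | yes h | m<N , t =
      let t′ , s″ , r , le , f′ , rest = go fuel (suc m) (≡.trans (≡.sym (ℕ.+-suc m fuel)) e) (frame-trans f
            (frame t)) (post t) in
      suc (time t ℕ.+ t′) , s″ , loop h (run t) r ,
      s≤s (ℕ.≤-trans (ℕ.+-mono-≤ (time≤ t) le) (ℕ.≤-reflexive (ℕ.+-suc (bound Z d p) _))) , f′ , rest

  -- The invariant is demanded after the decrement of the counter, so it need not be stable under
  -- that instruction. At the exit the counter `N ∸ m` is 0, which forces exactly `N` rounds.
  tri-for : ∀ {s p} r N → N ℕ.≤ rounds Z d (leᵢ 3 r) → r ≢ 3 → int s 3 ≡ 1 → int s r ≡ N →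
    {T (everywhere (keepsᵢ₁ 3) p)} → {T (everywhere (keepsᵢ₁ r) p)} → (I : ℕ → State → Set) →
    (∀ m s′ → m ℕ.< N → Frame (p ⨾ exec (subᵢ r r 3)) s s′ → I m s′ → Tri s′ p (λ s″ → I (suc m)
          (⟦ subᵢ r r 3 ⟧ᵢ s″))) →
    I 0 s → Tri s (for r p) (I N)
  tri-for {s} {p} r N N≤ r≢3 one count {k₃} {kᵣ} I step start =
    weaken (tri-while N N≤ J body ((count , one) , start)) λ { {s′} _ (¬h , m , m≤N , ((c , o) , inv)) →
      ≡.subst (λ m → I m s′) (ℕ.≤-antisym m≤N (ℕ.m∸n≡0⇒m≤n (ℕ.n<1⇒n≡0 (≡.subst₂ ℕ._<_ c o (ℕ.≰⇒> ¬h))))) inv }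
    where
    J : ℕ → State → Set
    J m s′ = (int s′ r ≡ N ℕ.∸ m × int s′ 3 ≡ 1) × I m s′
    body : ∀ m s′ → Frame (p ⨾ exec (subᵢ r r 3)) s s′ → J m s′ → Holds (leᵢ 3 r) s′ → m ℕ.< N × Tri s′ (p ⨾ exec
          (subᵢ r r 3)) (J (suc m))
    body m s′ f ((c , o) , inv) h = m<N , (step m s′ m<N f inv >>= λ { {s″} (g , inv′) →
        weaken (tri-exec (subᵢ r r 3) tt) λ { _ ≡.refl →
          ( ≡.trans (update-≡ (int s″) {a = r} ≡.refl) (≡.trans (≡.cong₂ ℕ._∸_ (≡.trans (frameᵢ g r kᵣ) c) (≡.trans
                (frameᵢ g 3 k₃) o)) (≡.trans (ℕ.∸-+-assoc N m 1) (≡.cong (N ℕ.∸_) (ℕ.+-comm m 1))))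
          , ≡.trans (update-≢ (int s″) r≢3) (≡.trans (frameᵢ g 3 k₃) o)) , inv′ } })
      where
      m<N : m ℕ.< N
      m<N = ℕ.m∸n≢0⇒n<m λ e → ℕ.<⇒≱ (s≤s (z≤n {0})) (≡.subst₂ ℕ._≤_ o (≡.trans c e) h)

-- The algorithm

-- Integer registers: 0 n, 1 d, 2 k, 3 one, 5 counter over the coordinates,
-- 9 address of the first data point, 10 number of current centers (whose
-- addresses form the array from cell 40 on), 17 and 18 address and number of the
-- candidates, 28 s, 29 t, 30 number of expanded tree nodes, 31 zero, 32 4k.
-- Real registers: 1 cost, 2 minimal distance, 3 distance, 5 ε ⊓ ½ and later the
-- best cost, 11 1/s, 13 1 − 1/k, 14 one, 15 zero.

-- There is no copy instruction; adding cell 31, which holds 0, serves instead.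
mov : ℕ → ℕ → Instruction
mov a b = addᵢ a b 31

copyStep copyPoints : Program
copyStep = block (loadᵣ 0 6 ∷ storeᵣ 7 0 ∷ addᵢ 6 6 3 ∷ addᵢ 7 7 3 ∷ [])
copyPoints = for 8 (block (mov 5 1 ∷ []) ⨾ for 5 copyStep)

distanceStep distanceProgram : Program
distanceStep = block
      (loadᵣ 0 15 ∷ loadᵣ 4 16 ∷ opᵣ sub 0 0 4 ∷ opᵣ mul 0 0 0 ∷ opᵣ add 3 3 0 ∷ addᵢ 15 15 3 ∷ addᵢ 16 16 3 ∷ [])
distanceProgram = block (zeroᵣ 3 ∷ mov 15 6 ∷ mov 16 14 ∷ mov 5 1 ∷ []) ⨾ for 5 distanceStep

-- The minimum starts from the first center, since no infinite value is available; the inner loop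
-- then revisits this center without effect. Adding real cell 15, which holds 0, copies a real.
minimumStep pointStep costProgram : Program
minimumStep = block (loadᵢ 14 12 ∷ []) ⨾ distanceProgram ⨾ if (leᵣ 2 3) skip (block (opᵣ add 2 3 15 ∷ [])) ⨾ block
      (addᵢ 12 12 3 ∷ [])
pointStep = block (constᵢ 12 40 ∷ mov 13 10 ∷ loadᵢ 14 12 ∷ []) ⨾ distanceProgram ⨾ block (opᵣ add 2 3 15 ∷ []) ⨾
  for 13 minimumStep ⨾ block (opᵣ add 1 1 2 ∷ addᵢ 6 6 1 ∷ [])
costProgram = block (zeroᵣ 1 ∷ mov 6 9 ∷ mov 11 0 ∷ []) ⨾ for 11 pointStep

baseSafe ctxSafe : Program → Bool
baseSafe p = everywhere (keepsᵢ₁ 0) p ∧ everywhere (keepsᵢ₁ 1) p ∧ everywhere (keepsᵢ₁ 3) p ∧ everywhere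
      (keepsᵢ₁ 31) p
ctxSafe p = baseSafe p ∧ everywhere (keepsᵢ₁ 9) p ∧ everywhere (keepsᵣ₁ 15) p ∧ everywhere lowᵣ₁ p

module Execution (R : CompleteOrderedField) (Z n d : ℕ) (n≤Z : n ℕ.≤ Z) where
  open FieldProperties R
  open ExponentialProperties R using (∑<; ∑<-suc)
  open Clustering R
  open KMeans R
  open RealRAM R
  open Triples R Z d

  record Base (s : State) : Set where
    field
      cell0  : int s 0 ≡ n
      cell1  : int s 1 ≡ d
      cell3  : int s 3 ≡ 1
      cell31 : int s 31 ≡ 0

  open Base public

  base-keep : ∀ {p s s′} → Frame p s s′ → {T (baseSafe p)} → Base s → Base s′
  base-keep {p} f {t} b =
    let t₀ , u = ∧-split {everywhere (keepsᵢ₁ 0) p} t ; t₁ , v = ∧-split {everywhere (keepsᵢ₁ 1) p} u ; t₃ ,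
          t₃₁ = ∧-split {everywhere (keepsᵢ₁ 3) p} v
    in record { cell0 = ≡.trans (frameᵢ f 0 t₀) (cell0 b) ; cell1 = ≡.trans (frameᵢ f 1 t₁) (cell1 b)
              ; cell3 = ≡.trans (frameᵢ f 3 t₃) (cell3 b) ; cell31 = ≡.trans (frameᵢ f 31 t₃₁) (cell31 b) }

  mov-value : ∀ {s a x} → Base s → int s a ≡ x → int s a ℕ.+ int s 31 ≡ x
  mov-value {x = x} b e = ≡.trans (≡.cong₂ ℕ._+_ e (cell31 b)) (ℕ.+-identityʳ x)

  increment : ∀ {x y a m} → y ≡ 1 → x ≡ a ℕ.+ m → x ℕ.+ y ≡ a ℕ.+ suc m
  increment {a = a} {m} ≡.refl ≡.refl = ≡.trans (ℕ.+-assoc a m 1) (≡.cong (a ℕ.+_) (ℕ.+-comm m 1))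

  -- Cell 0 is exempt in `old` because every coordinate passes through it.
  record Copied (s₀ : State) (src dst x : ℕ) (s : State) : Set where
    field
      source : int s 6 ≡ src ℕ.+ x
      target : int s 7 ≡ dst ℕ.+ x
      fresh  : ∀ y → y ℕ.< x → real s (dst ℕ.+ y) ≡ real s₀ (src ℕ.+ y)
      old    : ∀ a → 1 ℕ.≤ a → a ℕ.< dst → real s a ≡ real s₀ a

  copy-spec : ∀ {s₀ src dst cnt} → Base s₀ → int s₀ 6 ≡ src → int s₀ 7 ≡ dst → int s₀ 8 ≡ cnt → cnt ℕ.≤ Z →
    1 ℕ.≤ src → src ℕ.+ cnt ℕ.* d ℕ.≤ dst → 16 ℕ.≤ dst → Tri s₀ copyPoints (Copied s₀ src dst (cnt ℕ.* d))
  copy-spec {s₀} {src} {dst} {cnt} base₀ e6 e7 e8 cnt≤Z 1≤src disjoint 16≤dst =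
    tri-for 8 cnt cnt≤Z (λ ()) (cell3 base₀) e8 (λ c → Copied s₀ src dst (c ℕ.* d))
      (λ c s c<cnt f inv → let base = base-keep f base₀ in
        tri-block (mov 5 1 ∷ []) _ >>= λ { (f₁ , ≡.refl) → let base₁ = base-keep f₁ base in
        weaken (tri-for 5 d ℕ.≤-refl (λ ()) (cell3 base₁) (mov-value {s} base (cell1 base)) (λ j → Copied s₀ src dst
              (c ℕ.* d ℕ.+ j))
          (λ j s′ j<d g inv′ → ≡.subst (λ x → Tri s′ copyStep (λ s″ → Copied s₀ src dst x (⟦ subᵢ 5 5 3 ⟧ᵢ s″)))
                (≡.sym (ℕ.+-suc (c ℕ.* d) j)) (step (c ℕ.* d ℕ.+ j) (ℕ.<-≤-trans (ℕ.+-monoʳ-< (c ℕ.* d) j<d)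
                (ℕ.≤-trans (ℕ.≤-reflexive (ℕ.+-comm (c ℕ.* d) d)) (ℕ.*-monoˡ-≤ d c<cnt))) (cell3
                (base-keep g base₁)) inv′))
          (≡.subst (λ x → Copied s₀ src dst x (⟦ mov 5 1 ⟧ᵢ s)) (≡.sym (ℕ.+-identityʳ (c ℕ.* d)))
            (record { source = Copied.source inv ; target = Copied.target inv ; fresh = Copied.fresh inv ; old = Copied.old inv })))
          λ {s′} _ inv′ → ≡.subst (λ x → Copied s₀ src dst x (⟦ subᵢ 8 8 3 ⟧ᵢ s′)) (ℕ.+-comm (c ℕ.* d) d)
            (record { source = Copied.source inv′ ; target = Copied.target inv′ ; fresh = Copied.fresh inv′ ; old = Copied.old inv′ }) })
      (record { source = ≡.trans e6 (≡.sym (ℕ.+-identityʳ src)) ; target = ≡.trans e7 (≡.sym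
            (ℕ.+-identityʳ dst)) ; fresh = λ _ () ; old = λ _ _ _ → ≡.refl })
    where
    step : ∀ x {s} → x ℕ.< cnt ℕ.* d → int s 3 ≡ 1 → Copied s₀ src dst x s →
      Tri s copyStep (λ s′ → Copied s₀ src dst (suc x) (⟦ subᵢ 5 5 3 ⟧ᵢ s′))
    step x {s} x<len one inv = weaken (tri-block _ _) λ { _ ≡.refl → record
        { source = increment one (Copied.source inv)
        ; target = increment one (Copied.target inv)
        ; fresh = fresh′
        ; old = λ a 1≤a a<dst → ≡.trans (unchanged a 1≤a (ℕ.<-≤-trans a<dst (ℕ.m≤m+n dst x)))
              (Copied.old inv a 1≤a a<dst)
        } }
      where
      v = real s (int s 6)
      unchanged : ∀ a → 1 ℕ.≤ a → a ℕ.< dst ℕ.+ x → ((real s [ 0 ↦ v ]) [ int s 7 ↦ v ]) a ≡ real s a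
      unchanged a 1≤a a< = ≡.trans (update-≢ (real s [ 0 ↦ v ]) (λ e → ℕ.<⇒≢ a< (≡.sym (≡.trans (≡.sym
            (Copied.target inv)) e)))) (update-≢ (real s) (ℕ.<⇒≢ 1≤a))
      fresh′ : ∀ y → y ℕ.< suc x → ((real s [ 0 ↦ v ]) [ int s 7 ↦ v ]) (dst ℕ.+ y) ≡ real s₀ (src ℕ.+ y)
      fresh′ y (s≤s y≤x) with ℕ.m≤n⇒m<n∨m≡n y≤x
      ... | inj₁ y<x = ≡.trans (unchanged (dst ℕ.+ y) (ℕ.≤-trans (s≤s z≤n) (ℕ.≤-trans 16≤dst (ℕ.m≤m+n dst y)))
            (ℕ.+-monoʳ-< dst y<x)) (Copied.fresh inv y y<x)
      ... | inj₂ ≡.refl = ≡.trans (update-≡ (real s [ 0 ↦ v ]) (Copied.target inv))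
              (≡.trans (≡.cong (real s) (Copied.source inv)) (Copied.old inv (src ℕ.+ x) (ℕ.≤-trans 1≤src
                    (ℕ.m≤m+n src x)) (ℕ.<-≤-trans (ℕ.+-monoʳ-< src x<len) disjoint)))

  -- The search changes only integer cells and low real registers. So all points are read from one
  -- fixed memory `mem`, and a set of centers is an array of addresses into it.
  module Memory (mem : ℕ → Carrier) (xb : ℕ) (16≤xb : 16 ℕ.≤ xb) where

    point : ℕ → Point d
    point a l = mem (a ℕ.+ toℕ l)

    X′ : Vector (Point d) n
    X′ i = point (xb ℕ.+ toℕ i ℕ.* d)

    record Ctx (s : State) : Set where
      field
        base : Base s
        cell9 : int s 9 ≡ xb
        null : real s 15 ≈ 0#
        high : ∀ a → 16 ℕ.≤ a → real s a ≡ mem a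

    open Ctx public

    ctx-keep : ∀ {p s s′} → Frame p s s′ → {T (ctxSafe p)} → Ctx s → Ctx s′
    ctx-keep {p} f {t} c =
      let tb , u = ∧-split {baseSafe p} t ; t₉ , v = ∧-split {everywhere (keepsᵢ₁ 9) p} u ; t₁₅ ,
            l = ∧-split {everywhere (keepsᵣ₁ 15) p} v
      in record { base = base-keep f {tb} (base c) ; cell9 = ≡.trans (frameᵢ f 9 t₉) (cell9 c)
                ; null = trans (reflexive (frameᵣ f 15 t₁₅)) (null c) ; high = λ a q → ≡.trans (frameᵣ-high f l a q)
                      (high c a q) }

    distance-spec : ∀ {s₀ a b} → Ctx s₀ → int s₀ 6 ≡ a → int s₀ 14 ≡ b → 16 ℕ.≤ a → 16 ℕ.≤ b →
      Tri s₀ distanceProgram (λ s → real s 3 ≈ ‖ point a - point b ‖²)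
    distance-spec {s₀} {a} {b} ctx₀ e6 e14 16≤a 16≤b =
      tri-block (zeroᵣ 3 ∷ mov 15 6 ∷ mov 16 14 ∷ mov 5 1 ∷ []) _ >>= λ { (f , ≡.refl) →
        let ctx₁ = ctx-keep f ctx₀ ; base₁ = base ctx₁ in
        weaken (tri-for 5 d ℕ.≤-refl (λ ()) (cell3 base₁) (mov-value {s₀} (base ctx₀) (cell1 (base ctx₀)))
          (λ m s → real s 3 ≈ ∑< m term × int s 15 ≡ a ℕ.+ m × int s 16 ≡ b ℕ.+ m)
          (λ m s m<d g (acc , e15 , e16) → let ctx = ctx-keep g ctx₁ ; one = cell3 (base ctx) in
            weaken (tri-block _ _) λ { _ ≡.refl →
              trans (+-cong acc (*-cong (value s m ctx e15 e16) (value s m ctx e15 e16))) (sym (∑<-suc m term))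
              , increment one e15 , increment one e16 })
          (refl , ≡.trans (mov-value {s₀} (base ctx₀) e6) (≡.sym (ℕ.+-identityʳ a)) , ≡.trans (mov-value {s₀}
                (base ctx₀) e14) (≡.sym (ℕ.+-identityʳ b))))
        λ _ (acc , _) → acc }
      where
      term : ℕ → Carrier
      term j = (mem (a ℕ.+ j) - mem (b ℕ.+ j)) * (mem (a ℕ.+ j) - mem (b ℕ.+ j))
      value : ∀ s m → Ctx s → int s 15 ≡ a ℕ.+ m → int s 16 ≡ b ℕ.+ m →
        real s (int s 15) - (real s [ 0 ↦ real s (int s 15) ]) (int s 16) ≈ mem (a ℕ.+ m) - mem (b ℕ.+ m)
      value s m ctx e15 e16 = reflexive (≡.cong₂ _-_ (≡.trans (≡.cong (real s) e15) (high ctx _ (ℕ.≤-trans 16≤a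
            (ℕ.m≤m+n a m))))
        (≡.trans (≡.cong (real s [ 0 ↦ real s (int s 15) ]) e16) (≡.trans (update-≢ (real s) (ℕ.<⇒≢ (ℕ.<-≤-trans
              (s≤s z≤n) (ℕ.≤-trans 16≤b (ℕ.m≤m+n b m)))))
          (high ctx _ (ℕ.≤-trans 16≤b (ℕ.m≤m+n b m))))))

    centers : ∀ {m} → (ℕ → ℕ) → Vector (Point d) m
    centers τ c = point (τ (toℕ c))

    array : State → ℕ → ℕ
    array s c = int s (40 ℕ.+ c)

    minimum-≈ : ∀ {m v} (D : ℕ → Carrier) → (∀ c → c ℕ.< suc m → v ≤ D c) → (Σ ℕ λ c → c ℕ.< suc m × v ≈ D c) →
      v ≈ minimum {m} (λ c → D (toℕ c))
    minimum-≈ {m} {v} D lower (c , c<m , e) = ≤-antisym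
      (let c′ , e′ = minimiser {m} (λ c → D (toℕ c)) in ≤-respʳ (sym (reflexive e′)) (lower (toℕ c′) (Fin.toℕ<n c′)))
      (≤-respʳ (sym e) (≡.subst (λ x → minimum {m} (λ c → D (toℕ c)) ≤ D x) (Fin.toℕ-fromℕ< c<m) (minimum≤ {m} (λ c →
            D (toℕ c)) (fromℕ< c<m))))

    cost-spec : ∀ {s₀ m} → Ctx s₀ → int s₀ 10 ≡ suc m → suc m ℕ.≤ Z → (∀ c → c ℕ.< suc m → 16 ℕ.≤ array s₀ c) →
      Tri s₀ costProgram (λ s → real s 1 ≈ cost X′ (centers {suc m} (array s₀)))
    cost-spec {s₀} {m} ctx₀ len m<Z 16≤τ =
      tri-block (zeroᵣ 1 ∷ mov 6 9 ∷ mov 11 0 ∷ []) _ >>= λ { {s₁} (f₁ , ≡.refl) →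
        let ctx₁ = ctx-keep f₁ ctx₀ in
        weaken (tri-for 11 n n≤Z (λ ()) (cell3 (base ctx₁)) (mov-value {s₀} (base ctx₀) (cell0 (base ctx₀)))
          (λ i s → real s 1 ≈ ∑< i value × int s 6 ≡ xb ℕ.+ i ℕ.* d)
          (λ i s i<n g (acc , e6) → let ctx = ctx-keep g ctx₁ in
            point-spec i s ctx (≡.trans (keepᵢ g 10) len) (λ c → highᵢ g (40 ℕ.+ c) (ℕ.m≤m+n 40 c)) acc e6)
          (refl , ≡.trans (mov-value {s₀} (base ctx₀) (cell9 ctx₀)) (≡.sym (ℕ.+-identityʳ xb))))
        λ _ (acc , _) → acc }
      where
      τ = array s₀
      D : ℕ → ℕ → Carrier
      D i c = ‖ point (xb ℕ.+ i ℕ.* d) - point (τ c) ‖²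
      value : ℕ → Carrier
      value i = minimum {m} (λ c → D i (toℕ c))
      point-spec : ∀ i s → Ctx s → int s 10 ≡ suc m → (∀ c → array s c ≡ τ c) → real s 1 ≈ ∑< i value →
            int s 6 ≡ xb ℕ.+ i ℕ.* d →
        Tri s pointStep (λ s′ → real s′ 1 ≈ ∑< (suc i) value × int s′ 6 ≡ xb ℕ.+ suc i ℕ.* d)
      point-spec i s ctx len τ≡ acc e6 =
        tri-block (constᵢ 12 40 ∷ mov 13 10 ∷ loadᵢ 14 12 ∷ []) _ >>= λ { (f₁ , ≡.refl) →
        let ctx₁ = ctx-keep f₁ ctx in
        distance-spec ctx₁ e6 (τ≡ 0) 16≤x (16≤τ 0 (s≤s z≤n)) >>= λ (f₂ , d₀) →
        let ctx₂ = ctx-keep f₂ ctx₁ in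
        tri-block (opᵣ add 2 3 15 ∷ []) _ >>= λ { {s₃} (f₃ , ≡.refl) →
        let ctx₃ = ctx-keep f₃ ctx₂ in
        tri-for 13 (suc m) m<Z (λ ()) (cell3 (base ctx₃)) (≡.trans (keepᵢ f₂ 13) (mov-value {s} (base ctx) len))
          (λ j s′ → (∀ c → c ℕ.< j → real s′ 2 ≤ D i c) × (Σ ℕ λ c →
                c ℕ.< suc m × real s′ 2 ≈ D i c) × int s′ 12 ≡ 40 ℕ.+ j)
          (λ j s′ j<m g inv → let ctx′ = ctx-keep g ctx₃ in
            min-spec j s′ ctx′ j<m (≡.trans (keepᵢ g 6) (≡.trans (keepᵢ f₂ 6) e6))
              (≡.trans (highᵢ g (40 ℕ.+ j) (ℕ.m≤m+n 40 j)) (≡.trans (highᵢ f₂ (40 ℕ.+ j) (ℕ.m≤m+n 40 j)) (τ≡ j))) inv)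
          ((λ _ ()) , (0 , s≤s z≤n , trans (+-cong d₀ (null ctx₂)) (+-identityʳ _)) , keepᵢ f₂ 12)
        >>= λ (f₄ , (lower , attained , _)) →
        let ctx₄ = ctx-keep f₄ ctx₃ in
        weaken (tri-block (opᵣ add 1 1 2 ∷ addᵢ 6 6 1 ∷ []) _) λ { _ ≡.refl →
          trans (+-cong (trans (reflexive (≡.trans (keepᵣ f₄ 1) (keepᵣ f₂ 1))) acc) (minimum-≈ {m}
                (D i) lower attained)) (sym (∑<-suc i value)) ,
          ≡.trans (≡.cong₂ ℕ._+_ (≡.trans (keepᵢ f₄ 6) (≡.trans (keepᵢ f₂ 6) e6)) (cell1 (base ctx₄)))
            (≡.trans (ℕ.+-assoc xb (i ℕ.* d) d) (≡.cong (xb ℕ.+_) (ℕ.+-comm (i ℕ.* d) d))) } } }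
        where
        16≤x : 16 ℕ.≤ xb ℕ.+ i ℕ.* d
        16≤x = ℕ.≤-trans 16≤xb (ℕ.m≤m+n xb _)
        min-spec : ∀ j s′ → Ctx s′ → j ℕ.< suc m → int s′ 6 ≡ xb ℕ.+ i ℕ.* d → array s′ j ≡ τ j →
          ((∀ c → c ℕ.< j → real s′ 2 ≤ D i c) × (Σ ℕ λ c → c ℕ.< suc m × real s′ 2 ≈ D i c) × int s′ 12 ≡ 40 ℕ.+ j) →
          Tri s′ minimumStep (λ s′ → (∀ c → c ℕ.< suc j → real s′ 2 ≤ D i c) × (Σ ℕ λ c →
                c ℕ.< suc m × real s′ 2 ≈ D i c) × int s′ 12 ≡ 40 ℕ.+ suc j)
        min-spec j s′ ctx j<m e6 τj (lower , (c₀ , c₀<m , attained) , e12) =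
          tri-block (loadᵢ 14 12 ∷ []) _ >>= λ { (f₁ , ≡.refl) →
          let ctx₁ = ctx-keep f₁ ctx in
          distance-spec ctx₁ e6 (≡.trans (≡.cong (int s′) e12) τj) 16≤x (16≤τ j j<m) >>= λ {s₂} (f₂ , dⱼ) →
          let ctx₂ = ctx-keep f₂ ctx₁
              r2 = keepᵣ f₂ 2
              e12′ = ≡.trans (keepᵢ f₂ 12) e12
              below : ∀ {v} → v ≤ real s₂ 2 → v ≤ real s₂ 3 → ∀ c → c ℕ.< suc j → v ≤ D i c
              below v≤2 v≤3 = λ c c<j → [ (λ c<j → ≤-trans v≤2 (≤-respˡ (sym (reflexive r2)) (lower c c<j)))
                , (λ { ≡.refl → ≤-respʳ dⱼ v≤3 }) ]′ (ℕ.m≤n⇒m<n∨m≡n (ℕ.≤-pred c<j))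
          in
          tri-if {Q = λ s″ → (∀ c → c ℕ.< suc j → real s″ 2 ≤ D i c) × (Σ ℕ λ c →
                c ℕ.< suc m × real s″ 2 ≈ D i c) × int s″ 12 ≡ 40 ℕ.+ j}
            (λ le → weaken tri-skip λ { _ ≡.refl → below ≤-refl le , (c₀ , c₀<m , trans (reflexive r2) attained) ,
                  e12′ })
            (λ ¬le → weaken (tri-block (opᵣ add 2 3 15 ∷ []) _) λ { _ ≡.refl →
              let r3 = trans (+-congˡ (null ctx₂)) (+-identityʳ _) in
              below (≤-respˡ (sym r3) (<⇒≤ (≰⇒> ¬le))) (≤-reflexive r3) , (j , j<m , trans r3 dⱼ) , e12′ })
          >>= λ (f₃ , (lower′ , attained′ , e12″)) →
          weaken (tri-block (addᵢ 12 12 3 ∷ []) _) λ { _ ≡.refl →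
            lower′ , attained′ , increment {a = 40} {j} (≡.trans (keepᵢ f₃ 3) (cell3 (base ctx₂))) e12″ } }

-- Best addition and best removal of a center

recordBest : ℕ → Program
recordBest a = if (leᵣ 5 1) skip (block (opᵣ add 5 1 15 ∷ mov 23 a ∷ []))

-- A trial addition writes the candidate into the slot behind the array. A trial removal overwrites
-- a slot with the last center, which keeps the array contiguous, and cell 26 restores the slot
-- afterwards. Dropping the last center itself is the initial trial; if it wins, the final store
-- falls behind the shortened array.
addStep addProgram removeStep removeProgram initStep initProgram : Program
addStep = block (storeᵢ 21 19 ∷ []) ⨾ costProgram ⨾ recordBest 19 ⨾ block (addᵢ 19 19 1 ∷ [])
addProgram = block (mov 19 17 ∷ mov 20 18 ∷ constᵢ 22 40 ∷ addᵢ 21 22 10 ∷ addᵢ 10 10 3 ∷ storeᵢ 21 19 ∷ []) ⨾ costProgram ⨾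
  block (opᵣ add 5 1 15 ∷ mov 23 19 ∷ []) ⨾ for 20 addStep ⨾ block (storeᵢ 21 23 ∷ [])
removeStep = block (loadᵢ 26 19 ∷ storeᵢ 19 24 ∷ []) ⨾ costProgram ⨾ block (storeᵢ 19 26 ∷ []) ⨾ recordBest 19 ⨾ block
      (addᵢ 19 19 3 ∷ [])
removeProgram = block (subᵢ 10 10 3 ∷ constᵢ 22 40 ∷ addᵢ 21 22 10 ∷ loadᵢ 24 21 ∷ []) ⨾ costProgram ⨾
  block (opᵣ add 5 1 15 ∷ mov 23 21 ∷ mov 20 10 ∷ constᵢ 19 40 ∷ []) ⨾ for 20 removeStep ⨾ block (storeᵢ 23 24 ∷ [])
initStep = block (storeᵢ 21 19 ∷ addᵢ 21 21 3 ∷ addᵢ 19 19 1 ∷ [])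
initProgram = block (mov 19 9 ∷ constᵢ 21 40 ∷ mov 20 0 ∷ []) ⨾ for 20 initStep

module Searching (R : CompleteOrderedField) (Z n d : ℕ) (n≤Z : n ℕ.≤ Z) where
  open FieldProperties R
  open Clustering R
  open KMeans R
  open RealRAM R
  open Triples R Z d
  open Execution R Z n d n≤Z

  next-point : ∀ {x y} b j → x ≡ b ℕ.+ j ℕ.* d → y ≡ d → x ℕ.+ y ≡ b ℕ.+ suc j ℕ.* d
  next-point b j ≡.refl ≡.refl = ≡.trans (ℕ.+-assoc b (j ℕ.* d) d) (≡.cong (b ℕ.+_) (ℕ.+-comm (j ℕ.* d) d))

  store-array : ∀ {f τ : ℕ → ℕ} {a v w t} c → a ≡ 40 ℕ.+ t → v ≡ w → f (40 ℕ.+ c) ≡ τ c → (f [ a ↦ v ]) (40 ℕ.+ c) ≡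
        (τ [ t ↦ w ]) c
  store-array {f} {τ} {t = t} c ≡.refl ≡.refl e with t ℕ.≟ c
  ... | yes ≡.refl = update-≡ f {a = 40 ℕ.+ t} ≡.refl
  ... | no ne = ≡.trans (update-≢ f {a = 40 ℕ.+ t} (λ p → ne (ℕ.+-cancelˡ-≡ 40 t c p))) e

  init-spec : ∀ {s₀ xb} → Base s₀ → int s₀ 9 ≡ xb → Tri s₀ initProgram (λ s → ∀ c → c ℕ.< n → int s
        (40 ℕ.+ c) ≡ xb ℕ.+ c ℕ.* d)
  init-spec {s₀} {xb} base₀ e9 =
    tri-block (mov 19 9 ∷ constᵢ 21 40 ∷ mov 20 0 ∷ []) _ >>= λ { {s₁} (f₁ , ≡.refl) → let base₁ = base-keep f₁ base₀ in
    weaken (tri-for 20 n n≤Z (λ ()) (cell3 base₁) (mov-value {s₀} base₀ (cell0 base₀))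
      (λ j s → (∀ c → c ℕ.< j → int s (40 ℕ.+ c) ≡ xb ℕ.+ c ℕ.* d) × int s 19 ≡ xb ℕ.+ j ℕ.* d × int s 21 ≡ 40 ℕ.+ j)
      (λ j s j<n g (filled , e19 , e21) → let base′ = base-keep g base₁ ; high = ≡.subst (40 ℕ.≤_) (≡.sym e21) (ℕ.m≤m+n 40 j) in
        weaken (tri-block (storeᵢ 21 19 ∷ addᵢ 21 21 3 ∷ addᵢ 19 19 1 ∷ []) (high , _)) λ { _ ≡.refl →
          (λ c c<j → stored s j filled e19 e21 c (ℕ.m≤n⇒m<n∨m≡n (ℕ.≤-pred c<j)))
          , next-point xb j (≡.trans (low s 19 high) e19) (≡.trans (low s 1 high) (cell1 base′))
          , increment {a = 40} {j} (≡.trans (low s 3 high) (cell3 base′)) (≡.trans (low s 21 high) e21) })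
      ((λ _ ()) , ≡.trans (mov-value {s₀} base₀ e9) (≡.sym (ℕ.+-identityʳ xb)) , ≡.refl))
    λ _ (filled , _) → filled }
    where
    low : ∀ s x {v} → 40 ℕ.≤ int s 21 → {T (x <ᵇ 40)} → (int s [ int s 21 ↦ v ]) x ≡ int s x
    low s x q {t} = update-≢ (int s) λ e → ℕ.<⇒≢ (ℕ.<-≤-trans (ℕ.<ᵇ⇒< x 40 t) q) (≡.sym e)
    stored : ∀ s j → (∀ c → c ℕ.< j → int s (40 ℕ.+ c) ≡ xb ℕ.+ c ℕ.* d) → int s 19 ≡ xb ℕ.+ j ℕ.* d →
          int s 21 ≡ 40 ℕ.+ j →
      ∀ c → (c ℕ.< j ⊎ c ≡ j) → (int s [ int s 21 ↦ int s 19 ]) (40 ℕ.+ c) ≡ xb ℕ.+ c ℕ.* d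
    stored s j filled e19 e21 c (inj₁ c<j) = ≡.trans (update-≢ (int s) (λ e → ℕ.<⇒≢ c<j (≡.sym (ℕ.+-cancelˡ-≡ 40 j c
          (≡.trans (≡.sym e21) e))))) (filled c c<j)
    stored s j filled e19 e21 c (inj₂ ≡.refl) = ≡.trans (update-≡ (int s) e21) e19

  module Local (mem : ℕ → Carrier) (pb pc : ℕ) (16≤pb : 16 ℕ.≤ pb) (1≤pc : 1 ℕ.≤ pc) (pc≤Z : pc ℕ.≤ Z) where
    open Memory mem pb 16≤pb
    open Costs X′

    cost-array : ∀ {m} {τ τ′ : ℕ → ℕ} → (∀ c → c ℕ.< suc m → τ c ≡ τ′ c) → cost X′ (centers {suc m} τ) ≤ cost X′
          (centers {suc m} τ′)
    cost-array {m} {τ} {τ′} e = cost-cover (centers {suc m} τ) (centers {suc m} τ′) λ c → c , λ l → reflexive (≡.cong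
          (λ a → point a l) (e (toℕ c) (Fin.toℕ<n c)))

    cost-array-≈ : ∀ {m} {τ τ′ : ℕ → ℕ} → (∀ c → c ℕ.< suc m → τ c ≡ τ′ c) → cost X′ (centers {suc m} τ) ≈ cost X′
          (centers {suc m} τ′)
    cost-array-≈ {m} {τ} {τ′} e = ≤-antisym (cost-array {m} {τ} {τ′} e) (cost-array {m} {τ′} {τ} λ c q → ≡.sym
          (e c q))

    Pool : ℕ → Set
    Pool a = Σ ℕ λ q → q ℕ.< pc × a ≡ pb ℕ.+ q ℕ.* d

    16≤pool : ∀ {a} → Pool a → 16 ℕ.≤ a
    16≤pool (q , _ , ≡.refl) = ℕ.≤-trans 16≤pb (ℕ.m≤m+n pb (q ℕ.* d))

    updated : ∀ {τ : ℕ → ℕ} {P : ℕ → Set} {x v} c → P v → (c ≢ x → P (τ c)) → P ((τ [ x ↦ v ]) c)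
    updated {x = x} c pv pτ with x ℕ.≟ c
    ... | yes _ = pv
    ... | no ne = pτ (λ e → ne (≡.sym e))

    recordBest-spec : ∀ {s v} a → {T (not (a ≡ᵇ 23))} → Ctx s → real s 1 ≈ v →
      Tri s (recordBest a) (λ s′ → real s′ 5 ≤ v × real s′ 5 ≤ real s 5 ×
        ((real s′ 5 ≡ real s 5 × int s′ 23 ≡ int s 23) ⊎ (real s′ 5 ≈ v × int s′ 23 ≡ int s a)))
    recordBest-spec {s} a {t} ctx e = tri-if
      (λ le → weaken tri-skip λ { _ ≡.refl → ≤-respʳ e le , ≤-refl , inj₁ (≡.refl , ≡.refl) })
      (λ ¬le → weaken (tri-block (opᵣ add 5 1 15 ∷ mov 23 a ∷ []) _) λ { _ ≡.refl →
        let r5 = trans (+-cong e (null ctx)) (+-identityʳ _) in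
        ≤-reflexive r5 , ≤-respˡ (sym (trans r5 (sym e))) (<⇒≤ (≰⇒> ¬le)) , inj₂ (r5 , mov-value {s}
              (base ctx) ≡.refl) })

    add-spec : ∀ {s₀ m} → Ctx s₀ → int s₀ 10 ≡ suc m → suc (suc m) ℕ.≤ Z → (∀ c → c ℕ.< suc m → 16 ℕ.≤ array s₀ c) →
      int s₀ 17 ≡ pb → int s₀ 18 ≡ pc →
      Tri s₀ addProgram (λ s → int s 10 ≡ suc (suc m) × Pool (array s (suc m)) × (∀ c → c ℕ.< suc m →
            array s c ≡ array s₀ c) ×
        (∀ p → p ℕ.< pc → cost X′ (centers {suc (suc m)} (array s)) ≤ cost X′ (centers {suc (suc m)}
              (array s₀ [ suc m ↦ pb ℕ.+ p ℕ.* d ]))))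
    add-spec {s₀} {m} ctx₀ e10 m<Z 16≤τ e17 e18 =
      tri-block (mov 19 17 ∷ mov 20 18 ∷ constᵢ 22 40 ∷ addᵢ 21 22 10 ∷ addᵢ 10 10 3 ∷ storeᵢ 21 19 ∷ []) (_ , _ , _ ,
            _ , _ , ℕ.m≤m+n 40 _ , _) >>= λ { {s₁} (f₁ , ≡.refl) →
      let ctx₁ = ctx-keep f₁ ctx₀ in
      cost-spec ctx₁ len (m<Z) (trial-valid {p = 0} pb₀ (λ c _ → array₁ c)) >>= λ {s₂} (f₂ , c₂) →
      let ctx₂ = ctx-keep f₂ ctx₁ in
      tri-block (opᵣ add 5 1 15 ∷ mov 23 19 ∷ []) _ >>= λ { {s₃} (f₃ , ≡.refl) →
      let ctx₃ = ctx-keep f₃ ctx₂ in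
      tri-for 20 pc pc≤Z (λ ()) (cell3 (base ctx₃)) (≡.trans (keepᵢ f₂ 20) (mov-value {s₀} (base ctx₀) e18))
        (λ j s → int s 19 ≡ pb ℕ.+ j ℕ.* d × (∀ c → c ℕ.< suc m → array s c ≡ τ c) × (∀ p → p ℕ.< j →
              real s 5 ≤ value p)
               × (Σ ℕ λ q → q ℕ.< pc × int s 23 ≡ pb ℕ.+ q ℕ.* d × real s 5 ≈ value q))
        (λ j s j<pc g inv → let ctx = ctx-keep g ctx₃ in step j s ctx j<pc
          (≡.trans (keepᵢ g 10) (≡.trans (keepᵢ f₂ 10) len)) (≡.trans (keepᵢ g 21) (≡.trans (keepᵢ f₂ 21) e21)) inv)
        ( ≡.trans (keepᵢ f₂ 19) pb₀ , (λ c c<m → ≡.trans (highᵢ f₂ (40 ℕ.+ c) (ℕ.m≤m+n 40 c)) (≡.trans (array₁ c)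
              (update-≢ τ (λ e → ℕ.<⇒≢ c<m (≡.sym e))))) , (λ _ ())
        , (0 , 1≤pc , ≡.trans (mov-value {s₂} (base ctx₂) ≡.refl) (≡.trans (keepᵢ f₂ 19) pb₀) ,
            trans (+-cong (trans c₂ (cost-array-≈ {suc m} (λ c _ → ≡.trans (array₁ c) (≡.cong (λ v →
                  (τ [ suc m ↦ v ]) c) pb₀)))) (null ctx₂)) (+-identityʳ _)))
      >>= λ {s₄} (f₄ , (_ , kept , best , (q , q<pc , e23 , e5))) →
      let ctx₄ = ctx-keep f₄ ctx₃
          e21′ = ≡.trans (keepᵢ f₄ 21) (≡.trans (keepᵢ f₂ 21) e21)
          a₅ : ∀ c → c ℕ.< suc (suc m) → (int s₄ [ int s₄ 21 ↦ int s₄ 23 ]) (40 ℕ.+ c) ≡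
                (τ [ suc m ↦ pb ℕ.+ q ℕ.* d ]) c
          a₅ c c<m = stored {s₄} {p = q} kept e21′ e23 c (ℕ.m≤n⇒m<n∨m≡n (ℕ.≤-pred c<m))
      in
      weaken (tri-block (storeᵢ 21 23 ∷ []) (≡.subst (40 ℕ.≤_) (≡.sym e21′) (ℕ.m≤m+n 40 (suc m)) ,
            _)) λ { {s₅} f₅ ≡.refl →
        ≡.trans (keepᵢ f₅ 10) (≡.trans (keepᵢ f₄ 10) (≡.trans (keepᵢ f₂ 10) len)) ,
        (q , q<pc , ≡.trans (a₅ (suc m) ℕ.≤-refl) (update-≡ τ {a = suc m} ≡.refl)) ,
        (λ c c<m → ≡.trans (a₅ c (ℕ.m≤n⇒m≤1+n c<m)) (update-≢ τ (λ e → ℕ.<⇒≢ c<m (≡.sym e)))) ,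
        (λ p p<pc → ≤-trans (cost-array {suc m} a₅) (≤-respˡ e5 (best p p<pc))) } } }
      where
      τ = array s₀
      value : ℕ → Carrier
      value p = cost X′ (centers {suc (suc m)} (τ [ suc m ↦ pb ℕ.+ p ℕ.* d ]))
      len : int s₀ 10 ℕ.+ int s₀ 3 ≡ suc (suc m)
      len = ≡.trans (≡.cong₂ ℕ._+_ e10 (cell3 (base ctx₀))) (ℕ.+-comm (suc m) 1)
      e21 : 40 ℕ.+ int s₀ 10 ≡ 40 ℕ.+ suc m
      e21 = ≡.cong (40 ℕ.+_) e10
      pb₀ : int s₀ 17 ℕ.+ int s₀ 31 ≡ pb ℕ.+ 0 ℕ.* d
      pb₀ = ≡.trans (mov-value {s₀} (base ctx₀) e17) (≡.sym (ℕ.+-identityʳ pb))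
      array₁ : ∀ c → array (runBlock
            (mov 19 17 ∷ mov 20 18 ∷ constᵢ 22 40 ∷ addᵢ 21 22 10 ∷ addᵢ 10 10 3 ∷ storeᵢ 21 19 ∷ []) s₀) c ≡
            (τ [ suc m ↦ int s₀ 17 ℕ.+ int s₀ 31 ]) c
      array₁ c = store-array {f = int (runBlock
            (mov 19 17 ∷ mov 20 18 ∷ constᵢ 22 40 ∷ addᵢ 21 22 10 ∷ addᵢ 10 10 3 ∷ []) s₀)} {τ = τ} c e21 ≡.refl ≡.refl
      trial-valid : ∀ {σ : ℕ → ℕ} {v p} → v ≡ pb ℕ.+ p ℕ.* d → (∀ c → c ℕ.< suc (suc m) → σ c ≡ (τ [ suc m ↦ v ]) c) →
            ∀ c → c ℕ.< suc (suc m) → 16 ℕ.≤ σ c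
      trial-valid {p = p} ≡.refl e c c<m = ≡.subst (16 ℕ.≤_) (≡.sym (e c c<m)) (updated {τ} {P = 16 ℕ.≤_} c
            (ℕ.≤-trans 16≤pb (ℕ.m≤m+n pb (p ℕ.* d)))
        (λ ne → 16≤τ c (ℕ.≤∧≢⇒< (ℕ.≤-pred c<m) ne)))
      stored : ∀ {s v p} → (∀ c → c ℕ.< suc m → array s c ≡ τ c) → int s 21 ≡ 40 ℕ.+ suc m → v ≡ pb ℕ.+ p ℕ.* d →
            ∀ c → (c ℕ.< suc m ⊎ c ≡ suc m) →
        (int s [ int s 21 ↦ v ]) (40 ℕ.+ c) ≡ (τ [ suc m ↦ pb ℕ.+ p ℕ.* d ]) c
      stored {s} kept e21 e c (inj₁ c<m) = store-array {f = int s} {τ = τ} c e21 e (kept c c<m)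
      stored {s} {p = p} kept e21 e c (inj₂ ≡.refl) = ≡.trans (update-≡ (int s) e21) (≡.trans e (≡.sym
            (update-≡ τ {a = suc m} ≡.refl)))
      step : ∀ j s → Ctx s → j ℕ.< pc → int s 10 ≡ suc (suc m) → int s 21 ≡ 40 ℕ.+ suc m →
        (int s 19 ≡ pb ℕ.+ j ℕ.* d × (∀ c → c ℕ.< suc m → array s c ≡ τ c) × (∀ p → p ℕ.< j → real s 5 ≤ value p)
               × (Σ ℕ λ q → q ℕ.< pc × int s 23 ≡ pb ℕ.+ q ℕ.* d × real s 5 ≈ value q)) →
        Tri s addStep (λ s → int s 19 ≡ pb ℕ.+ suc j ℕ.* d × (∀ c → c ℕ.< suc m → array s c ≡ τ c) × (∀ p →
              p ℕ.< suc j → real s 5 ≤ value p)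
               × (Σ ℕ λ q → q ℕ.< pc × int s 23 ≡ pb ℕ.+ q ℕ.* d × real s 5 ≈ value q))
      step j s ctx j<pc e10 e21 (e19 , kept , lower , (q , q<pc , e23 , e5)) =
        tri-block (storeᵢ 21 19 ∷ []) (≡.subst (40 ℕ.≤_) (≡.sym e21) (ℕ.m≤m+n 40 (suc m)) , _) >>= λ { {s₁} (f₁ ,
              ≡.refl) →
        let ctx₁ = ctx-keep f₁ ctx
            a₁ : ∀ c → c ℕ.< suc (suc m) → array s₁ c ≡ (τ [ suc m ↦ pb ℕ.+ j ℕ.* d ]) c
            a₁ c c<m = stored {s} {p = j} kept e21 e19 c (ℕ.m≤n⇒m<n∨m≡n (ℕ.≤-pred c<m))
        in
        cost-spec ctx₁ (≡.trans (keepᵢ f₁ 10) e10) m<Z (trial-valid {p = j} ≡.refl a₁) >>= λ {s₂} (f₂ , c₂) →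
        let ctx₂ = ctx-keep f₂ ctx₁ in
        recordBest-spec 19 ctx₂ (trans c₂ (cost-array-≈ {suc m} a₁)) >>= λ {s₃} (f₃ , (≤new , ≤old , which)) →
        let ctx₃ = ctx-keep f₃ ctx₂
            r5 : real s₂ 5 ≡ real s 5
            r5 = ≡.trans (keepᵣ f₂ 5) (keepᵣ f₁ 5)
            e19′ = ≡.trans (keepᵢ f₂ 19) (≡.trans (keepᵢ f₁ 19) e19)
        in
        weaken (tri-block (addᵢ 19 19 1 ∷ []) _) λ { _ ≡.refl →
          next-point pb j (≡.trans (keepᵢ f₃ 19) e19′) (cell1 (base ctx₃)) ,
          (λ c c<m → ≡.trans (highᵢ f₃ (40 ℕ.+ c) (ℕ.m≤m+n 40 c)) (≡.trans (highᵢ f₂ (40 ℕ.+ c) (ℕ.m≤m+n 40 c))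
             (≡.trans (a₁ c (ℕ.m≤n⇒m≤1+n c<m)) (update-≢ τ (λ e → ℕ.<⇒≢ c<m (≡.sym e)))))) ,
          (λ p p<j → [ (λ p<j → ≤-trans ≤old (≤-respˡ (sym (reflexive r5)) (lower p p<j))) , (λ { ≡.refl → ≤new }) ]′
                (ℕ.m≤n⇒m<n∨m≡n (ℕ.≤-pred p<j))) ,
          [ (λ (e , e′) → q , q<pc , ≡.trans e′ (≡.trans (keepᵢ f₂ 23) (≡.trans (keepᵢ f₁ 23) e23)) , trans (reflexive
                (≡.trans e r5)) e5)
          , (λ (e , e′) → j , j<pc , ≡.trans e′ e19′ , e) ]′ which } }

    remove-spec : ∀ {s₀ m} → Ctx s₀ → int s₀ 10 ≡ suc (suc m) → suc (suc m) ℕ.≤ Z → (∀ c → c ℕ.< suc (suc m) →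
          16 ℕ.≤ array s₀ c) →
      Tri s₀ removeProgram (λ s → int s 10 ≡ suc m ×
        (Σ ℕ λ t → ∀ c → c ℕ.< suc m → array s c ≡ (array s₀ [ t ↦ array s₀ (suc m) ]) c) ×
        (∀ t → t ℕ.< suc (suc m) → cost X′ (centers {suc m} (array s)) ≤ cost X′ (centers {suc m}
              (array s₀ [ t ↦ array s₀ (suc m) ]))))
    remove-spec {s₀} {m} ctx₀ e10 m<Z 16≤τ =
      tri-block (subᵢ 10 10 3 ∷ constᵢ 22 40 ∷ addᵢ 21 22 10 ∷ loadᵢ 24 21 ∷ []) _ >>= λ { {s₁} (f₁ , ≡.refl) →
      let ctx₁ = ctx-keep f₁ ctx₀ in
      cost-spec ctx₁ len 1+m≤Z (λ c c<m → 16≤τ c (ℕ.m≤n⇒m≤1+n c<m)) >>= λ {s₂} (f₂ , c₂) →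
      let ctx₂ = ctx-keep f₂ ctx₁ in
      tri-block (opᵣ add 5 1 15 ∷ mov 23 21 ∷ mov 20 10 ∷ constᵢ 19 40 ∷ []) _ >>= λ { {s₃} (f₃ , ≡.refl) →
      let ctx₃ = ctx-keep f₃ ctx₂
          r5₃ : real s₃ 5 ≈ value (suc m)
          r5₃ = trans (+-cong (trans c₂ (cost-array-≈ {m} {τ} {τ [ suc m ↦ last ]} (λ c c<m → ≡.sym (update-≢ τ (λ e →
                ℕ.<⇒≢ c<m (≡.sym e)))))) (null ctx₂)) (+-identityʳ _)
      in
      tri-for 20 (suc m) 1+m≤Z (λ ()) (cell3 (base ctx₃)) (mov-value {s₂} (base ctx₂) (≡.trans (keepᵢ f₂ 10) len))
        (λ j s → Inv j s)
        (λ j s j<m g inv → let ctx = ctx-keep g ctx₃ in step j s ctx j<m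
          (≡.trans (keepᵢ g 10) (≡.trans (keepᵢ f₂ 10) len)) (≡.trans (keepᵢ g 24) (≡.trans (keepᵢ f₂ 24) e24)) inv)
        ( ≡.refl , (λ c c<m → highᵢ f₂ (40 ℕ.+ c) (ℕ.m≤m+n 40 c)) , ≤-reflexive r5₃ , (λ _ ())
        , (suc m , ℕ.≤-refl , ≡.trans (mov-value {s₂} (base ctx₂) ≡.refl) (≡.trans (keepᵢ f₂ 21) e21) , r5₃))
      >>= λ {s₄} (f₄ , (_ , kept , low , best , (t , t<m , e23 , e5))) →
      let ctx₄ = ctx-keep f₄ ctx₃
          e24′ = ≡.trans (keepᵢ f₄ 24) (≡.trans (keepᵢ f₂ 24) e24)
          a₅ : ∀ c → c ℕ.< suc m → (int s₄ [ int s₄ 23 ↦ int s₄ 24 ]) (40 ℕ.+ c) ≡ (τ [ t ↦ last ]) c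
          a₅ c c<m = store-array {f = int s₄} {τ = τ} c e23 e24′ (kept c (ℕ.m≤n⇒m≤1+n c<m))
      in
      weaken (tri-block (storeᵢ 23 24 ∷ []) (≡.subst (40 ℕ.≤_) (≡.sym e23) (ℕ.m≤m+n 40 t) , _)) λ { {s₅} f₅ ≡.refl →
        ≡.trans (keepᵢ f₅ 10) (≡.trans (keepᵢ f₄ 10) (≡.trans (keepᵢ f₂ 10) len)) , (t , a₅) ,
        (λ p p<m → ≤-trans (cost-array {m} a₅) (≤-respˡ e5 ([ (λ p<m → best p p<m) , (λ { ≡.refl → low }) ]′
              (ℕ.m≤n⇒m<n∨m≡n (ℕ.≤-pred p<m))))) } } }
      where
      τ = array s₀
      last = τ (suc m)
      -- At `t = suc m` the update lies behind the first `suc m` entries, so this value belongs to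
      -- the removal of the last center.
      value : ℕ → Carrier
      value t = cost X′ (centers {suc m} (τ [ t ↦ last ]))
      1+m≤Z : suc m ℕ.≤ Z
      1+m≤Z = ℕ.≤-trans (ℕ.n≤1+n _) m<Z
      len : int s₀ 10 ℕ.∸ int s₀ 3 ≡ suc m
      len = ≡.cong₂ ℕ._∸_ e10 (cell3 (base ctx₀))
      e21 : 40 ℕ.+ (int s₀ 10 ℕ.∸ int s₀ 3) ≡ 40 ℕ.+ suc m
      e21 = ≡.cong (40 ℕ.+_) len
      e24 : int s₀ (40 ℕ.+ (int s₀ 10 ℕ.∸ int s₀ 3)) ≡ last
      e24 = ≡.cong (int s₀) e21
      Inv : ℕ → State → Set
      Inv j s = int s 19 ≡ 40 ℕ.+ j × (∀ c → c ℕ.< suc (suc m) → array s c ≡ τ c) × real s 5 ≤ value (suc m) × (∀ p →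
            p ℕ.< j → real s 5 ≤ value p)
        × (Σ ℕ λ t → t ℕ.< suc (suc m) × int s 23 ≡ 40 ℕ.+ t × real s 5 ≈ value t)
      step : ∀ j s → Ctx s → j ℕ.< suc m → int s 10 ≡ suc m → int s 24 ≡ last → Inv j s → Tri s removeStep (Inv
            (suc j))
      step j s ctx j<m e10 e24 (e19 , kept , low , lower , (t , t<m , e23 , e5)) =
        tri-block (loadᵢ 26 19 ∷ storeᵢ 19 24 ∷ []) (_ , 40≤slot , _) >>= λ { {s₁} (f₁ , ≡.refl) →
        let ctx₁ = ctx-keep f₁ ctx
            a₁ : ∀ c → c ℕ.< suc (suc m) → array s₁ c ≡ (τ [ j ↦ last ]) c
            a₁ c c<m = store-array {f = int s [ 26 ↦ int s (int s 19) ]} {τ = τ} c e19 e24 (kept c c<m)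
        in
        cost-spec ctx₁ (≡.trans (keepᵢ f₁ 10) e10) 1+m≤Z (λ c c<m → ≡.subst (16 ℕ.≤_) (≡.sym (a₁ c (ℕ.m≤n⇒m≤1+n c<m)))
            (updated {τ} {16 ℕ.≤_} {j} c (16≤τ (suc m) ℕ.≤-refl) (λ _ → 16≤τ c (ℕ.m≤n⇒m≤1+n c<m)))) >>= λ {s₂} (f₂ ,
                  c₂) →
        let ctx₂ = ctx-keep f₂ ctx₁
            e19₂ = ≡.trans (keepᵢ f₂ 19) (≡.trans (keepᵢ f₁ 19) e19)
            e26₂ : int s₂ 26 ≡ τ j
            e26₂ = ≡.trans (keepᵢ f₂ 26) (≡.trans (low26 s 40≤slot) (≡.trans (≡.cong (int s) e19) (kept j
                  (ℕ.m≤n⇒m≤1+n j<m))))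
        in
        tri-block (storeᵢ 19 26 ∷ []) (≡.subst (40 ℕ.≤_) (≡.sym e19₂) (ℕ.m≤m+n 40 j) , _) >>= λ { {s₃} (f₃ , ≡.refl) →
        let ctx₃ = ctx-keep f₃ ctx₂
            a₃ : ∀ c → c ℕ.< suc (suc m) → array s₃ c ≡ τ c
            a₃ c c<m = ≡.trans (store-array {f = int s₂} {τ = τ [ j ↦ last ]} c e19₂ e26₂ (≡.trans (highᵢ f₂
                  (40 ℕ.+ c) (ℕ.m≤m+n 40 c)) (a₁ c c<m))) (restore j c)
        in
        recordBest-spec 19 ctx₃ (trans c₂ (cost-array-≈ {m} (λ c c<m → a₁ c (ℕ.m≤n⇒m≤1+n c<m)))) >>= λ {s₄} (f₄ ,
              (≤new , ≤old , which)) →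
        let ctx₄ = ctx-keep f₄ ctx₃
            r5 : real s₃ 5 ≡ real s 5
            r5 = ≡.trans (keepᵣ f₂ 5) (keepᵣ f₁ 5)
            e19₃ = ≡.trans (keepᵢ f₃ 19) e19₂
        in
        weaken (tri-block (addᵢ 19 19 3 ∷ []) _) λ { _ ≡.refl →
          increment {a = 40} {j} (cell3 (base ctx₄)) (≡.trans (keepᵢ f₄ 19) e19₃) ,
          (λ c c<m → ≡.trans (highᵢ f₄ (40 ℕ.+ c) (ℕ.m≤m+n 40 c)) (a₃ c c<m)) ,
          ≤-trans ≤old (≤-respˡ (sym (reflexive r5)) low) ,
          (λ p p<j → [ (λ p<j → ≤-trans ≤old (≤-respˡ (sym (reflexive r5)) (lower p p<j))) , (λ { ≡.refl → ≤new }) ]′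
                (ℕ.m≤n⇒m<n∨m≡n (ℕ.≤-pred p<j))) ,
          [ (λ (e , e′) → t , t<m , ≡.trans e′ (≡.trans (keepᵢ f₃ 23) (≡.trans (keepᵢ f₂ 23) (≡.trans
                (keepᵢ f₁ 23) e23))) , trans (reflexive (≡.trans e r5)) e5)
          , (λ (e , e′) → j , ℕ.m≤n⇒m≤1+n j<m , ≡.trans e′ e19₃ , e) ]′ which } } }
        where
        40≤slot : 40 ℕ.≤ int s 19
        40≤slot = ≡.subst (40 ℕ.≤_) (≡.sym e19) (ℕ.m≤m+n 40 j)
        low26 : ∀ s {v w} → 40 ℕ.≤ int s 19 → ((int s [ 26 ↦ v ]) [ int s 19 ↦ w ]) 26 ≡ v
        low26 s {v} q = update-≢ (int s [ 26 ↦ v ]) λ e → ℕ.<⇒≢ (ℕ.<-≤-trans (ℕ.<ᵇ⇒< 26 40 tt) q) (≡.sym e)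
        restore : ∀ j c → ((τ [ j ↦ last ]) [ j ↦ τ j ]) c ≡ τ c
        restore j c with j ℕ.≟ c
        ... | yes ≡.refl = ≡.refl
        ... | no ne = update-≢ τ ne

-- Nesting two loops in `improvement` yields `n * n` swaps without multiplying integers: `n` swaps
-- halve the excess, and `n` such runs undo the powers of two accumulated by `reduction`.
reduction improvement refinement searchProgram : Program
reduction = block (subᵢ 25 0 32 ∷ []) ⨾ for 25 removeProgram
improvement = block (mov 25 0 ∷ []) ⨾ for 25 (block (mov 27 0 ∷ []) ⨾ for 27 (addProgram ⨾ removeProgram))
refinement = for 29 addProgram
searchProgram = reduction ⨾ improvement ⨾ refinement

-- Contraction rates of the search

module Bounds (R : CompleteOrderedField) where
  open FieldProperties R

  -- f, f⁺, f⁻: costs before and after an addition and after the next removal; h: cost of the reference solution.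
  swap-bound : ∀ k {f f⁺ f⁻ g h x} → 1 ℕ.≤ k → 0# ≤ f → 0# ≤ h → 0# ≤ g →
    fromℕ k * f⁺ + f ≤ fromℕ k * f + h → f⁻ ≤ f⁺ + g → fromℕ (3 ℕ.* k) * g ≤ f⁺ + fromℕ 8 * h → f ≤ fromℕ 6 * h + x →
    f⁻ ≤ fromℕ 6 * h + (1# - fromℕ 2 * fromℕ (3 ℕ.* k) ⁻¹) * x
  -- Eliminating `f⁺` and `g` gives `f⁻ ≤ (1 - 2/(3k)) f + (4/k) h`. The fixed point of this map is
  -- `6 h`, so only `x` is contracted. The inequality is proved after multiplication by `3 k` and by
  -- `k`.
  swap-bound k@(suc k₁) {f} {f⁺} {f⁻} {g} {h} {x} 1≤k 0≤f 0≤h 0≤g adding remove gain start =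
    *-cancelˡ-≤ 0<3K (*-cancelˡ-≤ 0<K (≤-by
      ( (3K * κ) * (f⁺ + g - f⁻) + κ * (f⁺ + fromℕ 8 * h - 3K * g) + (3K + 1#) * (κ * f + h - (κ * f⁺ + f))
      + f + (κ - 1#) * h + κ * ((3K - fromℕ 2) * (fromℕ 6 * h + x - f)))
      (0≤+ (0≤+ (0≤+ (0≤+ (0≤+ (*-nonNeg (*-nonNeg (<⇒≤ 0<3K) (<⇒≤ 0<K)) (slack remove)) (*-nonNeg (<⇒≤ 0<K)
            (slack gain)))
        (*-nonNeg (0≤+ (<⇒≤ 0<3K) 0≤1) (slack adding))) 0≤f) (*-nonNeg (slack (1≤fromℕ 1≤k)) 0≤h))
        (*-nonNeg (<⇒≤ 0<K) (*-nonNeg (slack 2≤3K) (slack start))))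
      (trans (+-cong (*-congˡ (*-congʳ (fromℕ-* 3 k))) (slack-≈))
        (trans (solve 7 (λ K f f⁺ f⁻ g h x →
            K :* ((K3 :* K) :* f⁻) :+ (((K3 :* K) :* K) :* (f⁺ :+ g :- f⁻) :+ K :* (f⁺ :+ K8 :* h :-
                  (K3 :* K) :* g) :+ ((K3 :* K) :+ K1) :* (K :* f :+ h :- (K :* f⁺ :+ f))
              :+ f :+ (K :- K1) :* h :+ K :* (((K3 :* K) :- K2) :* (K6 :* h :+ x :- f)))
            := K :* ((K3 :* K) :* (K6 :* h) :+ (K3 :* K) :* x :- K2 :* x)) refl κ f f⁺ f⁻ g h x)
          (*-congˡ (sym target))))))
    where
    K1 K2 K3 K6 K8 : ∀ {n} → Polynomial n
    K1 = K 1
    K2 = K 2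
    K3 = K 3
    K6 = K 6
    K8 = K 8
    κ = fromℕ k
    3K = fromℕ (3 ℕ.* k)
    0<K : 0# < κ
    0<K = 0<fromℕ k₁
    0<3K : 0# < 3K
    0<3K = <-≤-trans 0<K (fromℕ-mono (ℕ.m≤m+n k _))
    2≤3K : fromℕ 2 ≤ 3K
    2≤3K = fromℕ-mono (ℕ.≤-trans (s≤s (s≤s z≤n)) (ℕ.*-monoʳ-≤ 3 1≤k))
    slack-≈ = let e = fromℕ-* 3 k in
      +-cong (+-cong (+-cong (+-cong (+-cong (*-congʳ (*-congʳ e)) (*-congˡ (+-congˡ (-‿cong (*-congʳ e))))) (*-congʳ
            (+-congʳ e))) refl) refl)
        (*-congˡ (*-congʳ (+-congʳ e)))
    target : 3K * (fromℕ 6 * h + (1# - fromℕ 2 * 3K ⁻¹) * x) ≈ (fromℕ 3 * κ) * (fromℕ 6 * h) +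
          (fromℕ 3 * κ) * x - fromℕ 2 * x
    target = trans (solve 4 (λ T i h x → T :* (K6 :* h :+ (K1 :- K2 :* i) :* x) := T :* (K6 :* h) :+ T :* x :-
          (T :* i) :* (K2 :* x)) refl 3K (3K ⁻¹) h x)
      (+-cong (+-cong (*-congʳ (fromℕ-* 3 k)) (*-congʳ (fromℕ-* 3 k))) (-‿cong (trans (*-congʳ (⁻¹-inverseʳ 0<3K))
            (*-identityˡ _))))

  rounds-halve : ∀ k n → 1 ℕ.≤ k → 4 ℕ.* k ℕ.≤ n → let ρ = 1# - fromℕ 2 * fromℕ (3 ℕ.* k) ⁻¹ in 0# ≤ ρ × fromℕ 2 * ρ ^ n ≤ 1#
  rounds-halve k@(suc k₁) n 1≤k 4k≤n = slack u≤1 , ≤-trans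
      (≤-respˡ (*-comm _ _) (*-monoˡ (0≤^ n (slack u≤1)) (+-mono (≤-refl {1#}) 1≤nu))) (bernoulli u n 0≤u u≤1)
    where
    3K = fromℕ (3 ℕ.* k)
    0<3K : 0# < 3K
    0<3K = <-≤-trans (0<fromℕ k₁) (fromℕ-mono (ℕ.m≤m+n k _))
    u = fromℕ 2 * 3K ⁻¹
    0≤u = *-nonNeg (0≤fromℕ 2) (0≤⁻¹ 0<3K)
    3Ku : 3K * u ≈ fromℕ 2
    3Ku = trans (solve 2 (λ t i → t :* (K 2 :* i) := K 2 :* (t :* i)) refl 3K (3K ⁻¹)) (trans (*-congˡ
          (⁻¹-inverseʳ 0<3K)) (*-identityʳ _))
    u≤1 : u ≤ 1#
    u≤1 = *-cancelˡ-≤ 0<3K (≤-respˡ (sym 3Ku) (≤-respʳ (sym (*-identityʳ _)) (fromℕ-mono (ℕ.≤-trans (s≤s (s≤s z≤n))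
          (ℕ.*-monoʳ-≤ 3 1≤k)))))
    1≤nu : fromℕ 1 ≤ fromℕ n * u
    1≤nu = ≤-trans (fromℕ-mono {1} {2} (s≤s z≤n)) (≤-respˡ 3Ku (*-monoʳ 0≤u (fromℕ-mono (ℕ.≤-trans (ℕ.*-monoˡ-≤ k
          (ℕ.n≤1+n 3)) 4k≤n))))

  add-bound : ∀ k {f f⁺ h x} → 1 ℕ.≤ k → fromℕ k * f⁺ + f ≤ fromℕ k * f + h → f ≤ h + x → f⁺ ≤ h +
        (1# - fromℕ k ⁻¹) * x
  add-bound k@(suc k₁) {f} {f⁺} {h} {x} 1≤k adding start = *-cancelˡ-≤ 0<K (≤-by ((κ * f + h - (κ * f⁺ + f)) +
        (κ - 1#) * (h + x - f))
      (0≤+ (slack adding) (*-nonNeg (slack (1≤fromℕ 1≤k)) (slack start)))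
      (trans (solve 5 (λ K f f⁺ h x → K :* f⁺ :+ ((K :* f :+ h :- (K :* f⁺ :+ f)) :+ (K :- one) :*
            (h :+ x :- f)) := K :* h :+ K :* x :- one :* x) refl κ f f⁺ h x)
        (sym (trans (solve 4 (λ K i h x → K :* (h :+ (one :- i) :* x) := K :* h :+ K :* x :- (K :* i) :* x) refl κ
              (κ ⁻¹) h x) (+-congˡ (-‿cong (*-congʳ (⁻¹-inverseʳ 0<K))))))))
    where
    one : ∀ {n} → Polynomial n
    one = K 1
    κ = fromℕ k
    0<K : 0# < κ
    0<K = 0<fromℕ k₁

-- The phases of the search

module Search (R : CompleteOrderedField) (Z n d : ℕ) (n≤Z : n ℕ.≤ Z) where
  open FieldProperties R
  open Bounds R
  open Clustering R
  open KMeans R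
  open RealRAM R
  open Triples R Z d
  open Execution R Z n d n≤Z
  open Searching R Z n d n≤Z

  module Run (mem : ℕ → Carrier) (pb pc : ℕ) (16≤pb : 16 ℕ.≤ pb) (1≤pc : 1 ℕ.≤ pc) (pc≤Z : pc ℕ.≤ Z)
             (n≤pc : n ℕ.≤ pc) (k : ℕ) (1≤k : 1 ℕ.≤ k) (4k<n : 4 ℕ.* k ℕ.< n) where
    open Local mem pb pc 16≤pb 1≤pc pc≤Z
    open Memory mem pb 16≤pb
    open Costs X′
    open Removal X′

    -- A reference solution made of candidates. The program does not know it, so the invariants
    -- below hold for all such solutions at once.
    record Solution : Set where
      field
        {size}  : ℕ
        size≤k  : suc size ℕ.≤ k
        set     : Vector (Point d) (suc size)
        in-pool : ∀ c → Σ ℕ λ a → Pool a × (∀ l → point a l ≈ set c l)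

    open Solution

    optimum : Solution → Carrier
    optimum S = cost X′ (set S)

    value : ℕ → State → Carrier
    value m s = cost X′ (centers {suc m} (array s))

    0≤value : ∀ m s → 0# ≤ value m s
    0≤value m s = 0≤cost (centers {suc m} (array s))

    0≤optimum : ∀ S → 0# ≤ optimum S
    0≤optimum S = 0≤cost (set S)

    record Phase (m : ℕ) (s : State) : Set where
      field
        ctx    : Ctx s
        cell10 : int s 10 ≡ suc m
        cell17 : int s 17 ≡ pb
        cell18 : int s 18 ≡ pc
        pool   : ∀ c → c ℕ.< suc m → Pool (array s c)

    open Phase

    add-step : ∀ {m s} → Phase m s → suc (suc m) ℕ.≤ Z → Tri s addProgram (λ s′ → Phase (suc m) s′ ×
      (∀ S → fromℕ k * value (suc m) s′ + value m s ≤ fromℕ k * value m s + optimum S))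
    add-step {m} {s} φ m<Z = weaken (add-spec (ctx φ) (cell10 φ) m<Z (λ c c<m → 16≤pool (pool φ c c<m)) (cell17 φ)
          (cell18 φ))
      λ { {s′} f (e10 , new , kept , best) →
        record { ctx = ctx-keep f (ctx φ) ; cell10 = e10 ; cell17 = ≡.trans (keepᵢ f 17) (cell17 φ) ; cell18 = ≡.trans
              (keepᵢ f 18) (cell18 φ)
               ; pool = λ c c<m → [ (λ c<m → ≡.subst Pool (≡.sym (kept c c<m)) (pool φ c c<m)) , (λ { ≡.refl →
                     new }) ]′ (ℕ.m≤n⇒m<n∨m≡n (ℕ.≤-pred c<m)) } ,
        (λ S → let c , bound = addition {k = k} (centers {suc m} (array s)) (set S) (size≤k S)
                   a , (q , q<pc , a≡) , a≈ = in-pool S c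
                   T⁺ = array s [ suc m ↦ pb ℕ.+ q ℕ.* d ]
                   covers : ∀ t → centers {suc m} (array s) t ∈̇ centers {suc (suc m)} T⁺
                   covers t = fromℕ< (ℕ.m≤n⇒m≤1+n (Fin.toℕ<n t)) , λ l → reflexive (≡.cong (λ x → point x l)
                     (≡.trans (≡.cong T⁺ (Fin.toℕ-fromℕ< (ℕ.m≤n⇒m≤1+n (Fin.toℕ<n t)))) (update-≢ (array s) (λ e →
                           ℕ.<⇒≢ (Fin.toℕ<n t) (≡.sym e)))))
                   new : set S c ∈̇ centers {suc (suc m)} T⁺
                   new = fromℕ< (ℕ.n<1+n (suc m)) , λ l → trans (reflexive (≡.cong (λ x → point x l)
                     (≡.trans (≡.cong T⁺ (Fin.toℕ-fromℕ< (ℕ.n<1+n (suc m)))) (≡.trans (update-≡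
                           (array s) {a = suc m} ≡.refl) (≡.sym a≡))))) (a≈ l)
               in ≤-trans (+-mono (*-monoˡ (0≤fromℕ k) (best q q<pc)) ≤-refl) (bound (centers {suc
                     (suc m)} T⁺) covers new)) }

    remove-step : ∀ {m s} → Phase (suc m) s → suc (suc m) ℕ.≤ Z → k ℕ.< suc (suc m) → Tri s removeProgram (λ s′ →
          Phase m s′ ×
      (∀ S → Σ Carrier λ g → value m s′ ≤ value (suc m) s + g × 0# ≤ g × (fromℕ (suc (suc m)) - fromℕ k) * g ≤ value
            (suc m) s + fromℕ 8 * optimum S))
    remove-step {m} {s} φ m<Z k<m = weaken (remove-spec (ctx φ) (cell10 φ) m<Z (λ c c<m → 16≤pool (pool φ c c<m)))
      λ { {s′} f (e10 , (t , kept) , best) →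
        record { ctx = ctx-keep f (ctx φ) ; cell10 = e10 ; cell17 = ≡.trans (keepᵢ f 17) (cell17 φ) ; cell18 = ≡.trans
              (keepᵢ f 18) (cell18 φ)
               ; pool = λ c c<m → ≡.subst Pool (≡.sym (kept c c<m)) (updated {array s} {Pool} {t} c (pool φ
                     (suc m) ℕ.≤-refl) (λ _ → pool φ c (ℕ.m≤n⇒m≤1+n c<m))) } ,
        (λ S → let t , bound = removal {k = k} (centers {suc (suc m)} (array s)) (set S) (size≤k S) k<m
                   T⁻ = array s [ toℕ t ↦ array s (suc m) ]
                   g , le , rest = bound (centers {suc m} T⁻) (λ c ne → keep t c ne (ℕ.m≤n⇒m<n∨m≡n (ℕ.≤-pred
                         (Fin.toℕ<n c))))
               in g , ≤-trans (best (toℕ t) (Fin.toℕ<n t)) le , rest) }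
      where
      keep : ∀ (t c : Fin (suc (suc m))) → c ≢ t → (toℕ c ℕ.< suc m ⊎ toℕ c ≡ suc m) → centers {suc (suc m)}
            (array s) c ∈̇ centers {suc m} (array s [ toℕ t ↦ array s (suc m) ])
      keep t c ne (inj₁ c<m) = fromℕ< c<m , λ l → reflexive (≡.cong (λ x → point x l)
        (≡.trans (≡.cong (array s [ toℕ t ↦ array s (suc m) ]) (Fin.toℕ-fromℕ< c<m)) (update-≢ (array s) (λ e → ne
              (Fin.toℕ-injective (≡.sym e))))))
      keep t c ne (inj₂ e) = fromℕ< t<m , λ l → reflexive (≡.cong (λ x → point x l)
        (≡.trans (≡.cong (array s [ toℕ t ↦ array s (suc m) ]) (Fin.toℕ-fromℕ< t<m)) (≡.trans (update-≡
              (array s) {a = toℕ t} ≡.refl) (≡.cong (array s) (≡.sym e)))))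
        where
        t<m : toℕ t ℕ.< suc m
        t<m = ℕ.≤∧≢⇒< (ℕ.≤-pred (Fin.toℕ<n t)) λ e′ → ne (Fin.toℕ-injective (≡.trans e (≡.sym e′)))

    4k = 4 ℕ.* k

    k≤4k : k ℕ.≤ 4k
    k≤4k = ℕ.m≤m+n k _

    room : ∀ {j} → j ℕ.< n ℕ.∸ 4k → j ℕ.+ 4k ℕ.< n
    room {j} j< = ℕ.<-≤-trans (ℕ.+-monoˡ-< 4k j<) (ℕ.≤-reflexive (ℕ.m∸n+n≡m (ℕ.<⇒≤ 4k<n)))

    -- As long as more than `k` centers remain, `removal` gives an increase of at most `v + 8 h`,
    -- where `v` is the current cost and `h` the reference cost. Hence each removal at most doubles
    -- `v + 8 h`.
    Reduced : ℕ → State → Set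
    Reduced j s = Σ ℕ λ m → suc m ℕ.+ j ≡ n × Phase m s × (∀ S → value m s + fromℕ 8 * optimum S ≤ fromℕ 2 ^ j *
          (fromℕ 8 * optimum S))

    reduction-spec : ∀ {s₀} → Reduced 0 s₀ → int s₀ 32 ≡ 4k → Tri s₀ reduction (Reduced (n ℕ.∸ 4k))
    reduction-spec {s₀} (m , e , φ , start) e32 =
      tri-block (subᵢ 25 0 32 ∷ []) _ >>= λ { {s₁} (f , ≡.refl) →
      tri-for 25 (n ℕ.∸ 4k) (ℕ.≤-trans (ℕ.m∸n≤m n 4k) n≤Z) (λ ()) (cell3 (base (ctx φ))) (≡.cong₂ ℕ._∸_ (cell0 (base
            (ctx φ))) e32) Reduced step
        (m , e , record { ctx = ctx-keep f
              (ctx φ) ; cell10 = cell10 φ ; cell17 = cell17 φ ; cell18 = cell18 φ ; pool = pool φ } , start) }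
      where
      step : ∀ {p s} j s′ → j ℕ.< n ℕ.∸ 4k → Frame p s s′ → Reduced j s′ → Tri s′ removeProgram (λ s″ → Reduced
            (suc j) (⟦ subᵢ 25 25 3 ⟧ᵢ s″))
      step j s′ j< _ (zero , e , _) = ⊥-elim (ℕ.<⇒≱ (room j<) (ℕ.≤-trans (ℕ.≤-reflexive (≡.trans (≡.sym e)
            (ℕ.+-comm 1 j))) (ℕ.+-monoʳ-≤ j (ℕ.≤-trans 1≤k k≤4k))))
      step j s′ j< _ (suc m , e , φ , bound) = weaken (remove-step φ (ℕ.≤-trans (ℕ.m≤m+n _ j) (ℕ.≤-trans
            (ℕ.≤-reflexive e) n≤Z)) k<m)
        λ { {s″} f (φ′ , removal) → m , ≡.trans (ℕ.+-suc (suc m) j) e ,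
          record { ctx = ctx-keep (frame-exec (subᵢ 25 25 3) tt)
                (ctx φ′) ; cell10 = cell10 φ′ ; cell17 = cell17 φ′ ; cell18 = cell18 φ′ ; pool = pool φ′ } ,
          λ S → let g , le , 0≤g , gain = removal S in
            ≤-trans (≤-by ((value (suc m) s′ + g - value m s″) + (value (suc m) s′ + fromℕ 8 * optimum S - (fromℕ (suc
                  (suc m)) - fromℕ k) * g) + (fromℕ (suc (suc m)) - fromℕ (suc k)) * g)
                 (0≤+ (0≤+ (slack le) (slack gain)) (*-nonNeg (slack (fromℕ-mono k<m)) 0≤g))
                 (solve 6 (λ v v′ g h m k → (v′ :+ h) :+ ((v :+ g :- v′) :+ (v :+ h :- (m :- k) :* g) :+ (m :-
                       (K 1 :+ k)) :* g) := K 2 :* (v :+ h)) refl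
                   (value (suc m) s′) (value m s″) g (fromℕ 8 * optimum S) (fromℕ (suc (suc m))) (fromℕ k)))
              (≤-respʳ (sym (*-assoc _ _ _)) (*-monoˡ (0≤fromℕ 2) (bound S))) }
        where
        k<m : k ℕ.< suc (suc m)
        k<m = ℕ.≤-<-trans k≤4k (ℕ.+-cancelʳ-< j 4k (suc (suc m)) (ℕ.<-≤-trans (ℕ.≤-<-trans (ℕ.≤-reflexive
              (ℕ.+-comm 4k j)) (room j<)) (ℕ.≤-reflexive (≡.sym e))))

    module Improve (m : ℕ) (m≡ : suc m ≡ 4k) where

      excess : Solution → Carrier
      excess S = fromℕ 2 ^ n * (fromℕ 8 * optimum S)

      0≤excess : ∀ S → 0# ≤ excess S
      0≤excess S = *-nonNeg (0≤^ n (0≤fromℕ 2)) (*-nonNeg (0≤fromℕ 8) (0≤optimum S))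

      ρ : Carrier
      ρ = 1# - fromℕ 2 * fromℕ (3 ℕ.* k) ⁻¹

      0≤ρ : 0# ≤ ρ
      0≤ρ = proj₁ (rounds-halve k n 1≤k (ℕ.<⇒≤ 4k<n))

      Improved : (Solution → Carrier) → State → Set
      Improved x s = Phase m s × (∀ S → value m s ≤ fromℕ 6 * optimum S + x S)

      2+m≤Z : suc (suc m) ℕ.≤ Z
      2+m≤Z = ℕ.≤-trans (s≤s (ℕ.≤-reflexive m≡)) (ℕ.≤-trans 4k<n n≤Z)

      phase-keep : ∀ {p s s′ m} → Frame p s s′ → {T (ctxSafe p)} → {T (everywhere (keepsᵢ₁ 10) p)} → {T (everywhere
            (keepsᵢ₁ 17) p)} →
        {T (everywhere (keepsᵢ₁ 18) p)} → {T (everywhere lowᵢ₁ p)} → Phase m s → Phase m s′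
      phase-keep f {t} {u} {v} {w} {l} φ = record
        { ctx = ctx-keep f {t} (ctx φ) ; cell10 = ≡.trans (keepᵢ f 10 {u}) (cell10 φ) ; cell17 = ≡.trans
              (keepᵢ f 17 {v}) (cell17 φ)
        ; cell18 = ≡.trans (keepᵢ f 18 {w}) (cell18 φ) ; pool = λ c c<m → ≡.subst Pool (≡.sym (highᵢ f {l} (40 ℕ.+ c)
              (ℕ.m≤m+n 40 c))) (pool φ c c<m) }

      value-keep : ∀ {p s s′ m x} → Frame p s s′ → {T (everywhere lowᵢ₁ p)} → value m s ≤ x → value m s′ ≤ x
      value-keep {s = s} {s′} {m} f {l} le = ≤-trans (cost-array {m} {array s′} {array s} (λ c _ → highᵢ f {l}
            (40 ℕ.+ c) (ℕ.m≤m+n 40 c))) le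

      improve-step : ∀ {x s} → Improved x s → Tri s (addProgram ⨾ removeProgram) (Improved (λ S → ρ * x S))
      improve-step {x} {s} (φ , bound) = add-step φ 2+m≤Z >>= λ {s₁} (f₁ , (φ₁ , gained)) →
        weaken (remove-step φ₁ 2+m≤Z (s≤s (ℕ.≤-trans k≤4k (ℕ.≤-reflexive (≡.sym m≡))))) λ { {s₂} f₂ (φ₂ , lost) → φ₂ ,
              λ S →
          let g , le , 0≤g , gain = lost S in
          swap-bound k 1≤k (0≤value m s) (0≤optimum S) 0≤g (gained S) le (≤-trans (*-monoʳ 0≤g 3K≤) gain) (bound S) }
        where
        -- The removal acts on `4 k + 1` centers, the addition having come first.
        3K≤ : fromℕ (3 ℕ.* k) ≤ fromℕ (suc (suc m)) - fromℕ k
        3K≤ = ≤-by 1# 0≤1 (trans (solve 3 (λ t k one → t :+ one := (one :+ (k :+ t)) :- k) refl (fromℕ (3 ℕ.* k))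
              (fromℕ k) 1#)
          (+-congʳ (+-congˡ (trans (sym (fromℕ-+ k (3 ℕ.* k))) (reflexive (≡.cong fromℕ (≡.sym m≡)))))))

      improvement-spec : ∀ {s} → Improved excess s → Tri s improvement (Improved (λ S → (ρ ^ n) ^ n * excess S))
      improvement-spec {s₀} (φ₀ , bound₀) =
        tri-block (mov 25 0 ∷ []) _ >>= λ { {s₁} (f , ≡.refl) →
        let φ₁ = phase-keep f φ₀ in
        tri-for 25 n n≤Z (λ ()) (cell3 (base (ctx φ₁))) (mov-value {s₀} (base (ctx φ₀)) (cell0 (base (ctx φ₀))))
          (λ c s → Improved (λ S → (ρ ^ n) ^ c * excess S) s)
          (λ c s c<n g (φ , bound) → tri-block (mov 27 0 ∷ []) _ >>= λ { {s₁} (f , ≡.refl) → let φ₁ = phase-keep f φ in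
            weaken (tri-for 27 n n≤Z (λ ()) (cell3 (base (ctx φ₁))) (mov-value {s} (base (ctx φ)) (cell0 (base
                  (ctx φ))))
              (λ j s → Improved (λ S → ρ ^ j * ((ρ ^ n) ^ c * excess S)) s)
              (λ j s′ j<n g′ inv → weaken (improve-step inv) λ { {s″} _ (φ , bound) → let f″ = frame-exec (subᵢ 27 27 3) {s″} tt in
                 phase-keep f″ φ , λ S → value-keep {m = m} f″ (≤-respʳ (+-congˡ (sym (*-assoc _ _ _))) (bound S)) })
              (φ₁ , λ S → value-keep {m = m} f (≤-respʳ (+-congˡ (sym (*-identityˡ _))) (bound S))))
            λ { {s″} _ (φ , bound) → let f″ = frame-exec (subᵢ 25 25 3) {s″} tt in
              phase-keep f″ φ , λ S → value-keep {m = m} f″ (≤-respʳ (+-congˡ (sym (*-assoc _ _ _))) (bound S)) } })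
          (φ₁ , λ S → value-keep {m = m} f (≤-respʳ (+-congˡ (sym (*-identityˡ _))) (bound₀ S))) }

      -- The remaining excess is `(2 ρ^n)^n` times `8 optimum S`, and `2 ρ^n` is at most 1. The
      -- total `6 + 8` is written as `1 + 13`, because the refinement contracts only the part above
      -- `optimum S`.
      improved-value : ∀ {s} → Improved (λ S → (ρ ^ n) ^ n * excess S) s → ∀ S →
            value m s ≤ optimum S + fromℕ 13 * optimum S
      improved-value (_ , bound) S = ≤-trans (bound S) (≤-trans (+-mono ≤-refl (≤-respˡ
          (trans (*-assoc _ _ _) refl)
          (≤-trans (*-monoʳ (*-nonNeg (0≤fromℕ 8) (0≤optimum S)) (≤-trans (≤-reflexive (sym (^-distrib-* (ρ ^ n)
                (fromℕ 2) n)))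
            (≤-respʳ (1^ n) (^-mono n (*-nonNeg (0≤^ n 0≤ρ) (0≤fromℕ 2)) (≤-respˡ (*-comm _ _) (proj₂
                  (rounds-halve k n 1≤k (ℕ.<⇒≤ 4k<n))))))))
            (≤-reflexive (*-identityˡ _)))))
          (≤-reflexive (solve 1 (λ h → K 6 :* h :+ K 8 :* h := h :+ K 13 :* h) refl (optimum S))))
        where
        1^ : ∀ j → 1# ^ j ≈ 1#
        1^ zero = refl
        1^ (suc j) = trans (*-identityˡ _) (1^ j)

      κ : Carrier
      κ = 1# - fromℕ k ⁻¹

      Refined : ℕ → State → Set
      Refined j s = Phase (j ℕ.+ m) s × (∀ S → value (j ℕ.+ m) s ≤ optimum S + κ ^ j * (fromℕ 13 * optimum S))

      refinement-spec : ∀ {s} t → t ℕ.+ 4k ℕ.≤ Z → int s 29 ≡ t → Refined 0 s → Tri s refinement (Refined t)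
      refinement-spec {s₀} t t≤Z e29 inv₀ = tri-for 29 t (ℕ.≤-trans (ℕ.m≤m+n t 4k) t≤Z) (λ ()) (cell3 (base (ctx
            (proj₁ inv₀)))) e29 Refined
        (λ j s j<t g (φ , bound) → weaken (add-step φ (room′ j<t)) λ { {s′} f (φ′ , gained) →
          let f′ = frame-exec (subᵢ 29 29 3) {s′} tt in
          phase-keep f′ φ′ , λ S → value-keep {m = suc j ℕ.+ m} f′ (≤-respʳ (+-congˡ (sym (*-assoc _ _ _)))
                (add-bound k 1≤k (gained S) (bound S))) })
        inv₀
        where
        room′ : ∀ {j} → j ℕ.< t → suc (suc (j ℕ.+ m)) ℕ.≤ Z
        room′ {j} j<t = ℕ.≤-trans (ℕ.≤-reflexive (≡.cong suc (≡.sym (ℕ.+-suc j m)))) (ℕ.≤-trans (ℕ.+-mono-≤ j<t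
              (ℕ.≤-reflexive m≡)) t≤Z)

    search-spec : ∀ {s₀} t → t ℕ.+ 4k ℕ.≤ Z → Reduced 0 s₀ → int s₀ 32 ≡ 4k → int s₀ 29 ≡ t →
      Tri s₀ searchProgram (λ s → Σ ℕ λ m → suc m ≡ t ℕ.+ 4k × Phase m s × (∀ S → value m s ≤ optimum S +
            (1# - fromℕ k ⁻¹) ^ t * (fromℕ 13 * optimum S)))
    search-spec {s₀} t t≤Z inv e32 e29 = reduction-spec inv e32 >>= λ {s₁} (f₁ , (m , e , φ , bound)) →
      let m≡ = ℕ.+-cancelʳ-≡ (n ℕ.∸ 4k) (suc m) 4k (≡.trans e (≡.sym (ℕ.m+[n∸m]≡n (ℕ.<⇒≤ 4k<n))))
          open Improve m m≡
      in
      improvement-spec (φ , λ S → ≤-by (fromℕ 6 * optimum S + (excess S - fromℕ 2 ^ (n ℕ.∸ 4k) *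
            (fromℕ 8 * optimum S)) + (fromℕ 2 ^ (n ℕ.∸ 4k) * (fromℕ 8 * optimum S) -
            (value m s₁ + fromℕ 8 * optimum S)) + fromℕ 8 * optimum S)
          (0≤+ (0≤+ (0≤+ (*-nonNeg (0≤fromℕ 6) (0≤optimum S)) (slack (*-monoʳ (*-nonNeg (0≤fromℕ 8) (0≤optimum S))
                (2^-mono (ℕ.m∸n≤m n 4k))))) (slack (bound S))) (*-nonNeg (0≤fromℕ 8) (0≤optimum S)))
          (solve 4 (λ v e h w → v :+ (K 6 :* h :+ (e :- w) :+ (w :-
                (v :+ K 8 :* h)) :+ K 8 :* h) := K 6 :* h :+ e) refl (value m s₁) (excess S) (optimum S) (fromℕ 2 ^
                (n ℕ.∸ 4k) * (fromℕ 8 * optimum S))))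
      >>= λ {s₂} (f₂ , inv₂) →
      weaken (refinement-spec t t≤Z (≡.trans (keepᵢ f₂ 29) (≡.trans (keepᵢ f₁ 29) e29)) (proj₁ inv₂ , λ S → ≤-trans
            (improved-value {s₂} inv₂ S) (≤-reflexive (+-congˡ (sym (*-identityˡ _))))))
      λ _ (φ , bound) → t ℕ.+ m , ≡.trans (≡.sym (ℕ.+-suc t m)) (≡.cong (t ℕ.+_) m≡) , φ , bound
      where
      2^-mono : ∀ {i j} → i ℕ.≤ j → fromℕ 2 ^ i ≤ fromℕ 2 ^ j
      2^-mono {i} {j} p = ≤-respˡ (fromℕ-^ 2 i) (≤-respʳ (fromℕ-^ 2 j) (fromℕ-mono (ℕ.^-monoʳ-≤ 2 p)))

-- Parameters, candidate pool and output

relocate scaleStep decayStep scalars countNodes pad place growStep grow : Program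
relocate = block (constᵢ 3 1 ∷ constᵢ 27 16 ∷ mov 20 0 ∷ []) ⨾ for 20 (block (addᵢ 27 27 1 ∷ [])) ⨾
  block (addᵢ 7 27 3 ∷ mov 9 7 ∷ storeᵣ 27 0 ∷ constᵢ 6 1 ∷ mov 8 0 ∷ mov 10 0 ∷ addᵢ 32 2 2 ∷ addᵢ 32 32 32 ∷ []) ⨾ copyPoints
scaleStep = block (opᵣ add 9 9 5 ∷ opᵣ add 10 10 14 ∷ addᵢ 28 28 3 ∷ [])
decayStep = block (opᵣ mul 9 9 13 ∷ addᵢ 29 29 3 ∷ [])
scalars = block (loadᵣ 5 27 ∷ zeroᵣ 15 ∷ oneᵣ 14 ∷ opᵣ add 6 14 14 ∷ opᵣ div 7 14 6 ∷ []) ⨾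
  if (leᵣ 5 7) skip (block (opᵣ add 5 7 15 ∷ [])) ⨾
  block (opᵣ add 8 6 6 ∷ zeroᵣ 9 ∷ zeroᵣ 10 ∷ constᵢ 28 0 ∷ []) ⨾ while (leᵣ 9 8) scaleStep ⨾
  block (opᵣ div 11 14 10 ∷ zeroᵣ 12 ∷ mov 20 2 ∷ []) ⨾ for 20 (block (opᵣ add 12 12 14 ∷ [])) ⨾
  block (opᵣ sub 13 12 14 ∷ opᵣ div 13 13 12 ∷ opᵣ mul 9 8 8 ∷ opᵣ mul 9 9 8 ∷ constᵢ 29 0 ∷ []) ⨾ while
        (leᵣ 5 9) decayStep
countNodes = block (mov 20 28 ∷ constᵢ 30 0 ∷ []) ⨾
  for 20 (block (constᵢ 4 1 ∷ mov 11 0 ∷ []) ⨾ for 11 (block (addᵢ 4 4 30 ∷ [])) ⨾ block (mov 30 4 ∷ []))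
pad = block (mov 17 7 ∷ addᵢ 20 29 32 ∷ []) ⨾ for 20 (block (addᵢ 17 17 1 ∷ []))
place = block (mov 6 9 ∷ mov 7 17 ∷ mov 8 0 ∷ mov 9 17 ∷ []) ⨾ copyPoints ⨾
  block (mov 19 7 ∷ mov 5 1 ∷ []) ⨾ for 5 (block (storeᵣ 7 15 ∷ addᵢ 7 7 3 ∷ []))
growStep = block (loadᵣ 0 15 ∷ loadᵣ 1 6 ∷ opᵣ mul 1 1 11 ∷ opᵣ add 0 0 1 ∷ storeᵣ 7 0 ∷ addᵢ 15 15 3 ∷ addᵢ 6 6 3 ∷ addᵢ 7 7 3 ∷ [])
grow = block (addᵢ 18 0 3 ∷ mov 20 30 ∷ []) ⨾
  for 20 (block (mov 6 17 ∷ mov 11 0 ∷ []) ⨾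
    for 11 (block (mov 15 19 ∷ mov 5 1 ∷ []) ⨾ for 5 growStep ⨾ block (addᵢ 18 18 3 ∷ [])) ⨾ block
          (addᵢ 19 19 1 ∷ []))

-- The output is written from its last coordinate down to its first. Real cell 0 serves as the
-- transfer register and is itself an output cell, so it must be written last.
outputStep outputProgram : Program
outputStep = block (subᵢ 6 6 3 ∷ subᵢ 7 7 3 ∷ loadᵣ 0 6 ∷ storeᵣ 7 0 ∷ [])
outputProgram = block (constᵢ 7 0 ∷ mov 20 10 ∷ []) ⨾ for 20 (block (addᵢ 7 7 1 ∷ [])) ⨾
  block (constᵢ 19 40 ∷ addᵢ 19 19 10 ∷ mov 20 10 ∷ []) ⨾
  for 20 (block (subᵢ 19 19 3 ∷ loadᵢ 6 19 ∷ addᵢ 6 6 1 ∷ mov 5 1 ∷ []) ⨾ for 5 outputStep) ⨾ block (mov 0 10 ∷ [])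

quotient-unique : ∀ {d q q′ l l′} → l ℕ.< d → l′ ℕ.< d → q ℕ.* d ℕ.+ l ≡ q′ ℕ.* d ℕ.+ l′ → q ≡ q′ × l ≡ l′
quotient-unique {d} {q} {q′} {l} {l′} l<d l′<d e with ℕ.<-cmp q q′
... | tri≈ _ ≡.refl _ = ≡.refl , ℕ.+-cancelˡ-≡ (q ℕ.* d) l l′ e
... | tri< q<q′ _ _ = ⊥-elim (ℕ.<⇒≢ (ℕ.<-≤-trans (ℕ.+-monoʳ-< (q ℕ.* d) l<d) (ℕ.≤-trans (ℕ.≤-reflexive (ℕ.+-comm
      (q ℕ.* d) d)) (ℕ.≤-trans (ℕ.*-monoˡ-≤ d q<q′) (ℕ.m≤m+n _ l′)))) e)
... | tri> _ _ q′<q = ⊥-elim (ℕ.<⇒≢ (ℕ.<-≤-trans (ℕ.+-monoʳ-< (q′ ℕ.* d) l′<d) (ℕ.≤-trans (ℕ.≤-reflexive (ℕ.+-comm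
      (q′ ℕ.* d) d)) (ℕ.≤-trans (ℕ.*-monoˡ-≤ d q′<q) (ℕ.m≤m+n _ l)))) (≡.sym e))

-- The number of nodes on the first j levels of the tree whose nodes have n children each.
nodes : ℕ → ℕ → ℕ
nodes n zero    = 0
nodes n (suc j) = suc (n ℕ.* nodes n j)

module Preparation (R : CompleteOrderedField) (Z n d : ℕ) (n≤Z : n ℕ.≤ Z) where
  open FieldProperties R
  open RealRAM R
  open Triples R Z d
  open Execution R Z n d n≤Z
  open Searching R Z n d n≤Z using (next-point)

  -- Integer multiplication by repeated addition.
  sum-for : ∀ {s} a b {x y} N r → N ℕ.≤ rounds Z d (leᵢ 3 r) → r ≢ 3 → {T (everywhere (keepsᵢ₁ 3) (block
        (addᵢ a a b ∷ [])))} → {T (everywhere (keepsᵢ₁ r) (block (addᵢ a a b ∷ [])))} →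
    {T (everywhere (keepsᵢ₁ b) (for r (block (addᵢ a a b ∷ []))))} → r ≢ a →
    int s 3 ≡ 1 → int s r ≡ N → int s a ≡ x → int s b ≡ y → Tri s (for r (block (addᵢ a a b ∷ []))) (λ s′ →
          int s′ a ≡ x ℕ.+ N ℕ.* y)
  sum-for {s} a b {x} {y} N r N≤ r≢3 {k₃} {kᵣ} {k_b} r≢a one er ea eb =
    tri-for r N N≤ r≢3 one er {k₃} {kᵣ} (λ j s → int s a ≡ x ℕ.+ j ℕ.* y)
      (λ j s′ j<N f e → weaken (tri-block (addᵢ a a b ∷ []) _) λ { _ ≡.refl →
        ≡.trans (update-≢ (int s′ [ a ↦ int s′ a ℕ.+ int s′ b ]) r≢a) (≡.trans (update-≡ (int s′) {a = a} ≡.refl)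
          (≡.trans (≡.cong₂ ℕ._+_ e (≡.trans (frameᵢ f b k_b) eb)) (≡.trans (ℕ.+-assoc x (j ℕ.* y) y) (≡.cong (x ℕ.+_)
                (ℕ.+-comm (j ℕ.* y) y))))) })
      (≡.trans ea (≡.sym (ℕ.+-identityʳ x)))

  -- The input fills real cells 0 to `n * d`, registers included. The copy starts above both the
  -- registers and the input, with `ε` just before the points.
  record Relocated (s₀ : State) (k : ℕ) (s : State) : Set where
    field
      base   : Base s
      cell2  : int s 2 ≡ k
      cell7  : int s 7 ≡ 17 ℕ.+ n ℕ.* d ℕ.+ n ℕ.* d
      cell9  : int s 9 ≡ 17 ℕ.+ n ℕ.* d
      cell10 : int s 10 ≡ n
      cell27 : int s 27 ≡ 16 ℕ.+ n ℕ.* d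
      cell32 : int s 32 ≡ 4 ℕ.* k
      saved  : real s (16 ℕ.+ n ℕ.* d) ≡ real s₀ 0
      points : ∀ x → x ℕ.< n ℕ.* d → real s (17 ℕ.+ n ℕ.* d ℕ.+ x) ≡ real s₀ (1 ℕ.+ x)

  relocate-spec : ∀ {s₀ k} → int s₀ 0 ≡ n → int s₀ 1 ≡ d → int s₀ 2 ≡ k → int s₀ 31 ≡ 0 → Tri s₀ relocate
        (Relocated s₀ k)
  relocate-spec {s₀} {k} e0 e1 e2 e31 =
    tri-block (constᵢ 3 1 ∷ constᵢ 27 16 ∷ mov 20 0 ∷ []) _ >>= λ { {s₁} (f₁ , ≡.refl) →
    let base₁ : Base s₁
        base₁ = record { cell0 = e0 ; cell1 = e1 ; cell3 = ≡.refl ; cell31 = e31 }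
    in
    sum-for 27 1 n 20 n≤Z (λ ()) (λ ()) ≡.refl (≡.trans (≡.cong₂ ℕ._+_ e0 e31) (ℕ.+-identityʳ n)) ≡.refl e1 >>= λ {s₂}
          (f₂ , e27) →
    let base₂ = base-keep f₂ base₁
        e7 : int s₂ 27 ℕ.+ int s₂ 3 ≡ 17 ℕ.+ n ℕ.* d
        e7 = ≡.trans (≡.cong₂ ℕ._+_ e27 (cell3 base₂)) (ℕ.+-comm (16 ℕ.+ n ℕ.* d) 1)
        e2₂ = ≡.trans (keepᵢ f₂ 2) e2
        r₂ : ∀ x → real s₂ x ≡ real s₀ x
        r₂ x = keepᵣ f₂ x
    in
    tri-block (addᵢ 7 27 3 ∷ mov 9 7 ∷ storeᵣ 27 0 ∷ constᵢ 6 1 ∷ mov 8 0 ∷ mov 10 0 ∷ addᵢ 32 2 2 ∷ addᵢ 32 32 32 ∷ []) _ >>= λ { {s₃} (f₃ , ≡.refl) →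
    let base₃ = base-keep f₃ base₂ in
    weaken (copy-spec base₃ ≡.refl e7 (mov-value {s₂} base₂ (cell0 base₂)) n≤Z (s≤s z≤n) (ℕ.+-monoˡ-≤ (n ℕ.* d)
          (s≤s z≤n)) (ℕ.m≤n⇒m≤1+n (ℕ.m≤m+n 16 (n ℕ.* d)))) λ {s₄} f₄ copied → record
      { base = base-keep f₄ base₃
      ; cell2 = ≡.trans (keepᵢ f₄ 2) e2₂
      ; cell7 = Copied.target copied
      ; cell9 = ≡.trans (keepᵢ f₄ 9) (≡.trans (≡.cong₂ ℕ._+_ e7 (cell31 base₂)) (ℕ.+-identityʳ _))
      ; cell10 = ≡.trans (keepᵢ f₄ 10) (mov-value {s₂} base₂ (cell0 base₂))
      ; cell27 = ≡.trans (keepᵢ f₄ 27) e27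
      ; cell32 = ≡.trans (keepᵢ f₄ 32) (≡.trans (≡.cong (λ x → (x ℕ.+ x) ℕ.+ (x ℕ.+ x)) e2₂)
          (≡.trans (ℕ.+-assoc k k (k ℕ.+ k)) (≡.cong (λ x → k ℕ.+ (k ℕ.+ (k ℕ.+ x))) (≡.sym (ℕ.+-identityʳ k)))))
      ; saved = ≡.trans (Copied.old copied (16 ℕ.+ n ℕ.* d) (s≤s z≤n) ℕ.≤-refl) (≡.trans (update-≡ (real s₂) e27)
            (r₂ 0))
      ; points = λ x x< → ≡.trans (Copied.fresh copied x x<) (≡.trans (update-≢ (real s₂) (λ e → ℕ.<⇒≢ (ℕ.<-≤-trans
            (s≤s x<) (ℕ.+-monoˡ-≤ (n ℕ.* d) (s≤s (z≤n {15})))) (≡.trans (≡.sym e) e27))) (r₂ (1 ℕ.+ x)))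
      } } }

  record Scaled (s t : ℕ) (σ : Carrier) (st : State) : Set where
    field
      base   : Base st
      cell7  : int st 7 ≡ 17 ℕ.+ n ℕ.* d ℕ.+ n ℕ.* d
      cell9  : int st 9 ≡ 17 ℕ.+ n ℕ.* d
      cell10 : int st 10 ≡ n
      cell28 : int st 28 ≡ s
      cell29 : int st 29 ≡ t
      scale  : real st 11 ≈ σ
      null   : real st 15 ≈ 0#

  module Scalars (k : ℕ) (1≤k : 1 ℕ.≤ k) (k≤Z : k ℕ.≤ Z) (ε : Carrier) (0<ε : 0# < ε) (s t : ℕ) (s≤Z : s ℕ.≤ Z) (t≤Z : t ℕ.≤ Z) where
    e κ : Carrier
    e = ε ⊓ ½
    κ = 1# - fromℕ k ⁻¹

    0<k : 0# < fromℕ k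
    0<k = <-≤-trans 0<1 (1≤fromℕ 1≤k)

    -- The loops count in integers while a real quantity approaches its threshold. `above-s` and
    -- `above-t` bound the number of rounds, `below-s` and `below-t` exclude an earlier exit, so the
    -- counters end at exactly `s` and `t`.
    scalars-spec : ∀ {s₀ s₁} → Relocated s₀ k s₁ → real s₀ 0 ≡ ε →
      1 ℕ.≤ s → (∀ m → m ℕ.< s → fromℕ m * e ≤ fromℕ 4) → (∀ m → fromℕ m * e ≤ fromℕ 4 → m ℕ.< s) →
      (∀ m → m ℕ.< t → e ≤ fromℕ 64 * κ ^ m) → (∀ m → e ≤ fromℕ 64 * κ ^ m → m ℕ.< t) →
      Tri s₁ scalars (Scaled s t (fromℕ s ⁻¹))
    scalars-spec {s₀} {s₁} rel r0 1≤s below-s above-s below-t above-t =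
      tri-block (loadᵣ 5 27 ∷ zeroᵣ 15 ∷ oneᵣ 14 ∷ opᵣ add 6 14 14 ∷ opᵣ div 7 14 6 ∷ []) (_ , _ , _ , _ ,
            pos⇒≉0 0<2 , _) >>= λ { {s₂} (f₂ , ≡.refl) →
      tri-if {Q = λ s → real s 5 ≈ e}
        (λ le → weaken tri-skip λ { _ ≡.refl → trans (reflexive r5) (min-left (≤-respʳ half (≤-respˡ
              (reflexive r5) le))) })
        (λ ¬le → weaken (tri-block (opᵣ add 5 7 15 ∷ []) _) λ { _ ≡.refl → trans (+-identityʳ _) (trans half
              (min-right (<⇒≤ (≰⇒> λ le → ¬le (≤-respʳ (sym half) (≤-respˡ (sym (reflexive r5)) le)))))) })
      >>= λ {s₃} (f₃ , r5) →
      tri-block (opᵣ add 8 6 6 ∷ zeroᵣ 9 ∷ zeroᵣ 10 ∷ constᵢ 28 0 ∷ []) _ >>= λ { {s₄} (f₄ , ≡.refl) →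
      let r8 : real s₄ 8 ≈ fromℕ 4
          r8 = trans (+-cong (reflexive (keepᵣ f₃ 6)) (reflexive (keepᵣ f₃ 6))) (solve 0 ((K 1 :+ K 1) :+
                (K 1 :+ K 1) := K 4) refl)
          base₄ = base-keep f₄ (base-keep f₃ (base-keep f₂ (Relocated.base rel)))
      in
      tri-while s s≤Z (λ m s′ → real s′ 9 ≈ fromℕ m * e × real s′ 10 ≈ fromℕ m × int s′ 28 ≡ m)
        (λ m s′ g (r9 , r10 , e28) le → above-s m (≤-respˡ r9 (≤-respʳ (trans (reflexive (keepᵣ g 8)) r8) le)) ,
          weaken (tri-block _ _) λ { _ ≡.refl →
            trans (+-cong r9 (trans (reflexive (keepᵣ g 5)) r5)) (solve 2 (λ m e → m :* e :+ e :=
                  (K 1 :+ m) :* e) refl (fromℕ m) e) ,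
            trans (+-cong r10 (reflexive (≡.trans (keepᵣ g 14) (keepᵣ f₃ 14)))) (+-comm _ _) ,
            increment {a = 0} (≡.trans (keepᵢ g 3) (cell3 base₄)) e28 })
        (sym (zeroˡ e) , refl , ≡.refl)
      >>= λ {s₅} (f₅ , (¬le , m , m≤s , (r9 , r10 , e28))) →
      let m≡s : m ≡ s
          m≡s = ℕ.≤-antisym m≤s (ℕ.≮⇒≥ λ m<s → ¬le (≤-respˡ (sym r9) (≤-respʳ (sym (trans (reflexive
                (keepᵣ f₅ 8)) r8)) (below-s m m<s))))
          r10′ = trans r10 (reflexive (≡.cong fromℕ m≡s))
          base₅ = base-keep f₅ base₄
          e2₅ = ≡.trans (keepᵢ f₅ 2) (≡.trans (keepᵢ f₃ 2) (Relocated.cell2 rel))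
          r14₅ : real s₅ 14 ≡ 1#
          r14₅ = ≡.trans (keepᵣ f₅ 14) (keepᵣ f₃ 14)
      in
      tri-block (opᵣ div 11 14 10 ∷ zeroᵣ 12 ∷ mov 20 2 ∷ []) ((λ z → pos⇒≉0 0<s (trans (sym r10′) z)) ,
            _) >>= λ { {s₆} (f₆ , ≡.refl) →
      let base₆ = base-keep f₆ base₅ in
      tri-for 20 k k≤Z (λ ()) (cell3 base₆) (mov-value {s₅} base₅ e2₅) (λ j s′ → real s′ 12 ≈ fromℕ j)
        (λ j s′ j<k g r12 → weaken (tri-block _ _) λ { _ ≡.refl → trans (+-cong r12 (reflexive (≡.trans
              (keepᵣ g 14) r14₅))) (+-comm _ _) })
        refl
      >>= λ {s₇} (f₇ , r12) →
      let base₇ = base-keep f₇ base₆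
          r14₇ : real s₇ 14 ≡ 1#
          r14₇ = ≡.trans (keepᵣ f₇ 14) r14₅
          r8₇ : real s₇ 8 ≈ fromℕ 4
          r8₇ = trans (reflexive (≡.trans (keepᵣ f₇ 8) (keepᵣ f₅ 8))) r8
      in
      tri-block (opᵣ sub 13 12 14 ∷ opᵣ div 13 13 12 ∷ opᵣ mul 9 8 8 ∷ opᵣ mul 9 9 8 ∷ constᵢ 29 0 ∷ []) (_ , (λ z →
            pos⇒≉0 0<k (trans (sym r12) z)) , _) >>= λ { {s₈} (f₈ , ≡.refl) →
      let base₈ = base-keep f₈ base₇
          r13 : real s₈ 13 ≈ κ
          r13 = trans (*-cong (+-cong r12 (-‿cong (reflexive r14₇))) (⁻¹-cong r12))
            (trans (solve 2 (λ k i → (k :- K 1) :* i := k :* i :- i) refl (fromℕ k) (fromℕ k ⁻¹)) (+-congʳ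
                  (⁻¹-inverseʳ 0<k)))
          r5₈ : real s₈ 5 ≈ e
          r5₈ = trans (reflexive (≡.trans (keepᵣ f₇ 5) (≡.trans (keepᵣ f₆ 5) (≡.trans (keepᵣ f₅ 5) (keepᵣ f₄ 5))))) r5
      in
      weaken (tri-while t t≤Z (λ m s′ → real s′ 9 ≈ fromℕ 64 * κ ^ m × int s′ 29 ≡ m)
        (λ m s′ g (r9 , e29) le → above-t m (≤-respˡ (trans (reflexive (keepᵣ g 5)) r5₈) (≤-respʳ r9 le)) ,
          weaken (tri-block _ _) λ { _ ≡.refl →
            trans (*-cong r9 (trans (reflexive (keepᵣ g 13)) r13)) (solve 2 (λ x c → K 64 :* x :* c := K 64 :*
                  (c :* x)) refl (κ ^ m) κ) ,
            increment {a = 0} (≡.trans (keepᵢ g 3) (cell3 base₈)) e29 })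
        (trans (*-cong (*-cong r8₇ r8₇) r8₇) (solve 0 (K 4 :* K 4 :* K 4 := K 64 :* K 1) refl) , ≡.refl))
      λ { {s₉} f₉ (¬le , m , m≤t , (r9 , e29)) → record
        { base = base-keep f₉ base₈
        ; cell7 = ≡.trans (keepᵢ f₉ 7) (≡.trans (keepᵢ f₇ 7) (≡.trans (keepᵢ f₅ 7) (≡.trans (keepᵢ f₃ 7)
              (Relocated.cell7 rel))))
        ; cell9 = ≡.trans (keepᵢ f₉ 9) (≡.trans (keepᵢ f₇ 9) (≡.trans (keepᵢ f₅ 9) (≡.trans (keepᵢ f₃ 9)
              (Relocated.cell9 rel))))
        ; cell10 = ≡.trans (keepᵢ f₉ 10) (≡.trans (keepᵢ f₇ 10) (≡.trans (keepᵢ f₅ 10) (≡.trans (keepᵢ f₃ 10)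
              (Relocated.cell10 rel))))
        ; cell28 = ≡.trans (keepᵢ f₉ 28) (≡.trans (keepᵢ f₇ 28) (≡.trans e28 m≡s))
        ; cell29 = ≡.trans e29 (ℕ.≤-antisym m≤t (ℕ.≮⇒≥ λ m<t → ¬le (≤-respˡ (sym (trans (reflexive (keepᵣ f₉ 5)) r5₈))
              (≤-respʳ (sym r9) (below-t m m<t)))))
        ; scale = trans (reflexive (≡.trans (keepᵣ f₉ 11) (keepᵣ f₇ 11))) (trans (*-cong (reflexive r14₅)
              (⁻¹-cong r10′)) (*-identityˡ _))
        ; null = reflexive (≡.trans (keepᵣ f₉ 15) (≡.trans (keepᵣ f₇ 15) (≡.trans (keepᵣ f₅ 15) (keepᵣ f₃ 15))))
        } } } } } }
      where
      0<2 : 0# < 1# + 1#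
      0<2 = 0<+ˡ 0<1 0≤1
      0<s : 0# < fromℕ s
      0<s = <-≤-trans 0<1 (1≤fromℕ 1≤s)
      r5 : real s₁ (int s₁ 27) ≡ ε
      r5 = ≡.trans (≡.cong (real s₁) (Relocated.cell27 rel)) (≡.trans (Relocated.saved rel) r0)
      half : 1# * (1# + 1#) ⁻¹ ≈ ½
      half = trans (*-identityˡ _) (⁻¹-cong (+-congˡ (sym (+-identityʳ 1#))))
      min-left : ε ≤ ½ → ε ≈ e
      min-left le = ≤-antisym (⊓-glb ≤-refl le) (x⊓y≤x _ _)
      min-right : ½ ≤ ε → ½ ≈ e
      min-right le = ≤-antisym (⊓-glb le ≤-refl) (x⊓y≤y _ _)

  nodes-spec : ∀ {s₀ s} → Base s₀ → int s₀ 28 ≡ s → s ℕ.≤ Z → Tri s₀ countNodes (λ st → int st 30 ≡ nodes n s)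
  nodes-spec {s₀} {s} base₀ e28 s≤Z =
    tri-block (mov 20 28 ∷ constᵢ 30 0 ∷ []) _ >>= λ { {s₁} (f₁ , ≡.refl) →
    let base₁ = base-keep f₁ base₀ in
    tri-for 20 s s≤Z (λ ()) (cell3 base₁) (mov-value {s₀} base₀ e28) (λ j st → int st 30 ≡ nodes n j)
      (λ j st j<s g e30 → let base = base-keep g base₁ in
        tri-block (constᵢ 4 1 ∷ mov 11 0 ∷ []) _ >>= λ { {s₂} (f₂ , ≡.refl) →
        let base₂ = base-keep f₂ base in
        sum-for 4 30 n 11 n≤Z (λ ()) (λ ()) (cell3 base₂) (mov-value {st} base (cell0 base)) ≡.refl e30 >>= λ {s₃}
              (f₃ , e4) →
        weaken (tri-block (mov 30 4 ∷ []) _) λ { _ ≡.refl → mov-value {s₃} (base-keep f₃ base₂) e4 } })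
      ≡.refl }

  module Building (s t k : ℕ) (σ : Carrier) (s≤Z : s ℕ.≤ Z) (t+4k≤Z : t ℕ.+ 4 ℕ.* k ℕ.≤ Z) (N≤Z : nodes n s ℕ.≤ Z) (1≤n : 1 ℕ.≤ n) (1≤d : 1 ℕ.≤ d) where

    -- The points lie at `xb`, then follow `(t + 4 k) d` spare cells, the points again at `pb`, and
    -- the tree nodes at `qb`. The spare cells put all candidates above the area that the output
    -- will fill. From `pb` on, points and nodes form one pool of stride `d`, so the data points are
    -- candidates too.
    xb pb qb N pc : ℕ
    xb = 17 ℕ.+ n ℕ.* d
    pb = xb ℕ.+ n ℕ.* d ℕ.+ (t ℕ.+ 4 ℕ.* k) ℕ.* d
    qb = pb ℕ.+ n ℕ.* d
    N = nodes n s
    pc = n ℕ.+ 1 ℕ.+ N ℕ.* n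

    17≤pb : 17 ℕ.≤ pb
    17≤pb = ℕ.≤-trans (ℕ.m≤m+n 17 (n ℕ.* d)) (ℕ.≤-trans (ℕ.m≤m+n xb (n ℕ.* d)) (ℕ.m≤m+n (xb ℕ.+ n ℕ.* d)
          ((t ℕ.+ 4 ℕ.* k) ℕ.* d)))

    17≤qb : 17 ℕ.≤ qb
    17≤qb = ℕ.≤-trans 17≤pb (ℕ.m≤m+n pb _)

    record Placed (s₁ st : State) : Set where
      field
        base   : Base st
        cell7  : int st 7 ≡ qb ℕ.+ d
        cell9  : int st 9 ≡ pb
        cell17 : int st 17 ≡ pb
        cell19 : int st 19 ≡ qb
        scale  : real st 11 ≈ σ
        null   : real st 15 ≈ 0#
        points : ∀ x → x ℕ.< n ℕ.* d → real st (pb ℕ.+ x) ≡ real s₁ (xb ℕ.+ x)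
        root   : ∀ l → l ℕ.< d → real st (qb ℕ.+ l) ≈ 0#

    place-spec : ∀ {s₁} → Base s₁ → int s₁ 9 ≡ xb → int s₁ 17 ≡ pb → real s₁ 11 ≈ σ → real s₁ 15 ≈ 0# → Tri s₁ place
          (Placed s₁)
    place-spec {s₁} base₁ e9 e17 r11 r15 =
      tri-block (mov 6 9 ∷ mov 7 17 ∷ mov 8 0 ∷ mov 9 17 ∷ []) _ >>= λ { {s₂} (f₂ , ≡.refl) →
      let base₂ = base-keep f₂ base₁ in
      copy-spec base₂ (mov-value {s₁} base₁ e9) (mov-value {s₁} base₁ e17) (mov-value {s₁} base₁ (cell0 base₁)) n≤Z
            (s≤s z≤n)
        (ℕ.m≤m+n (xb ℕ.+ n ℕ.* d) _) (ℕ.≤-trans (ℕ.n≤1+n 16) 17≤pb) >>= λ {s₃} (f₃ , copied) →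
      let base₃ = base-keep f₃ base₂
          old = λ a 1≤a a<16 → Copied.old copied a 1≤a (ℕ.<-≤-trans (ℕ.<ᵇ⇒< a 17 a<16) 17≤pb)
      in
      tri-block (mov 19 7 ∷ mov 5 1 ∷ []) _ >>= λ { {s₄} (f₄ , ≡.refl) →
      let base₄ = base-keep f₄ base₃ in
      weaken (tri-for 5 d ℕ.≤-refl (λ ()) (cell3 base₄) (mov-value {s₃} base₃ (cell1 base₃))
        (λ j st → int st 7 ≡ qb ℕ.+ j × (∀ a → a ℕ.< qb → real st a ≡ real s₃ a) × (∀ l → l ℕ.< j → real st
              (qb ℕ.+ l) ≈ 0#))
        (λ j st j<d g (e7 , keep , zeros) → weaken (tri-block (storeᵣ 7 15 ∷ addᵢ 7 7 3 ∷ []) _) λ { _ ≡.refl →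
            increment {a = qb} {j} (cell3 (base-keep g base₄)) e7 ,
            (λ a a< → ≡.trans (update-≢ (real st) (λ e → ℕ.<⇒≢ (ℕ.<-≤-trans a< (ℕ.m≤m+n qb j)) (≡.sym (≡.trans
                  (≡.sym e7) e)))) (keep a a<)) ,
            (λ l l<j → zero′ {s₃} st j l e7 keep zeros (trans (reflexive (old 15 (s≤s z≤n) _)) r15) (ℕ.m≤n⇒m<n∨m≡n
                  (ℕ.≤-pred l<j))) })
        (≡.trans (Copied.target copied) (≡.sym (ℕ.+-identityʳ qb)) , (λ _ _ → ≡.refl) , λ _ ()))
      λ {s₅} f₅ (e7 , keep , zeros) → record
        { base = base-keep f₅ base₄
        ; cell7 = e7
        ; cell9 = ≡.trans (keepᵢ f₅ 9) (≡.trans (keepᵢ f₃ 9) (mov-value {s₁} base₁ e17))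
        ; cell17 = ≡.trans (keepᵢ f₅ 17) (≡.trans (keepᵢ f₃ 17) e17)
        ; cell19 = ≡.trans (keepᵢ f₅ 19) (mov-value {s₃} base₃ (Copied.target copied))
        ; scale = trans (reflexive (≡.trans (keep 11 (ℕ.≤-trans (ℕ.m≤m+n 12 5) 17≤qb)) (old 11 (s≤s z≤n) _))) r11
        ; null = trans (reflexive (≡.trans (keep 15 (ℕ.≤-trans (ℕ.m≤m+n 16 1) 17≤qb)) (old 15 (s≤s z≤n) _))) r15
        ; points = λ x x< → ≡.trans (keep (pb ℕ.+ x) (ℕ.+-monoʳ-< pb x<)) (Copied.fresh copied x x<)
        ; root = zeros
        } } }
      where
      zero′ : ∀ {s₃ : State} st j l → int st 7 ≡ qb ℕ.+ j → (∀ a → a ℕ.< qb → real st a ≡ real s₃ a) → (∀ l →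
            l ℕ.< j → real st (qb ℕ.+ l) ≈ 0#) → real s₃ 15 ≈ 0# →
        (l ℕ.< j ⊎ l ≡ j) → (real st [ int st 7 ↦ real st 15 ]) (qb ℕ.+ l) ≈ 0#
      zero′ st j l e7 keep zeros r15 (inj₁ l<j) = trans (reflexive (update-≢ (real st) (λ e → ℕ.<⇒≢ l<j (≡.sym
            (ℕ.+-cancelˡ-≡ qb j l (≡.trans (≡.sym e7) e)))))) (zeros l l<j)
      zero′ st j l e7 keep zeros r15 (inj₂ ≡.refl) = trans (reflexive (≡.trans (update-≡ (real st) e7) (keep 15
            (ℕ.≤-trans (ℕ.m≤m+n 16 1) 17≤qb)))) r15

    -- The tree is stored like an `n`-ary heap: child `i` of node `p` is node `p n + i + 1`, and `x`
    -- counts the coordinates written behind the root. Cells 0 and 1 are scratch and therefore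
    -- absent from `old`.
    record Grown (s₁ : State) (x : ℕ) (st : State) : Set where
      field
        next     : int st 7 ≡ qb ℕ.+ d ℕ.+ x
        old      : ∀ a → 2 ℕ.≤ a → a ℕ.< qb ℕ.+ d → real st a ≡ real s₁ a
        children : ∀ p i l → i ℕ.< n → l ℕ.< d → (p ℕ.* n ℕ.+ i) ℕ.* d ℕ.+ l ℕ.< x →
          real st (qb ℕ.+ d ℕ.+ ((p ℕ.* n ℕ.+ i) ℕ.* d ℕ.+ l)) ≈ real st (qb ℕ.+ p ℕ.* d ℕ.+ l) + real st
                (pb ℕ.+ i ℕ.* d ℕ.+ l) * σ

    grow-step : ∀ {s₁ st} p i l → i ℕ.< n → l ℕ.< d → int st 3 ≡ 1 → real s₁ 11 ≈ σ →
          int st 15 ≡ qb ℕ.+ p ℕ.* d ℕ.+ l → int st 6 ≡ pb ℕ.+ i ℕ.* d ℕ.+ l →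
      Grown s₁ ((p ℕ.* n ℕ.+ i) ℕ.* d ℕ.+ l) st → Tri st growStep (λ st′ → Grown s₁ (suc
            ((p ℕ.* n ℕ.+ i) ℕ.* d ℕ.+ l)) (⟦ subᵢ 5 5 3 ⟧ᵢ st′) ×
        int st′ 15 ≡ qb ℕ.+ p ℕ.* d ℕ.+ suc l × int st′ 6 ≡ pb ℕ.+ i ℕ.* d ℕ.+ suc l)
    grow-step {s₁} {st} p i l i<n l<d one r11 e15 e6 inv = weaken (tri-block _ _) λ { _ ≡.refl →
        record { next = increment {a = qb ℕ.+ d} {x} one (Grown.next inv)
               ; old = λ a 2≤a a< → ≡.trans (unchanged a 2≤a (ℕ.<-≤-trans a< (ℕ.m≤m+n _ x))) (Grown.old inv a 2≤a a<)
               ; children = λ p′ i′ l′ i′<n l′<d y< → children′ p′ i′ l′ i′<n l′<d (ℕ.m≤n⇒m<n∨m≡n (ℕ.≤-pred y<)) } ,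
        increment {a = qb ℕ.+ p ℕ.* d} {l} one e15 , increment {a = pb ℕ.+ i ℕ.* d} {l} one e6 }
      where
      x = (p ℕ.* n ℕ.+ i) ℕ.* d ℕ.+ l
      a₁ a₂ : ℕ
      a₁ = int st 15
      a₂ = int st 6
      mem₁ = real st [ 0 ↦ real st a₁ ]
      v₁ = mem₁ a₂
      mem₂ = mem₁ [ 1 ↦ v₁ ]
      v₂ = mem₂ 1 * mem₂ 11
      mem₃ = mem₂ [ 1 ↦ v₂ ]
      v₃ = mem₃ 0 + mem₃ 1
      mem₄ = mem₃ [ 0 ↦ v₃ ]
      mem₅ = mem₄ [ int st 7 ↦ mem₄ 0 ]
      unchanged : ∀ a → 2 ℕ.≤ a → a ℕ.< qb ℕ.+ d ℕ.+ x → mem₅ a ≡ real st a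
      unchanged a 2≤a a< = ≡.trans (update-≢ mem₄ (λ e → ℕ.<⇒≢ a< (≡.sym (≡.trans (≡.sym (Grown.next inv)) e))))
        (≡.trans (update-≢ mem₃ 0≢a) (≡.trans (update-≢ mem₂ 1≢a) (≡.trans (update-≢ mem₁ 1≢a) (update-≢
              (real st) 0≢a))))
        where
        0≢a : 0 ≢ a
        0≢a = ℕ.<⇒≢ (ℕ.≤-trans (s≤s z≤n) 2≤a)
        1≢a : 1 ≢ a
        1≢a = ℕ.<⇒≢ 2≤a
      -- Since `p ≤ p n + i`, a parent coordinate lies before the cell being written, hence has been
      -- written already and is not overwritten.
      parent< : ∀ p i l y → l ℕ.< d → (p ℕ.* n ℕ.+ i) ℕ.* d ℕ.+ l ≡ y → qb ℕ.+ p ℕ.* d ℕ.+ l ℕ.< qb ℕ.+ d ℕ.+ y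
      parent< p i l y l<d ≡.refl = ℕ.≤-<-trans (ℕ.≤-reflexive (ℕ.+-assoc qb (p ℕ.* d) l)) (ℕ.<-≤-trans (ℕ.+-monoʳ-< qb
            (ℕ.≤-<-trans
          (ℕ.+-monoˡ-≤ l (ℕ.*-monoˡ-≤ d (ℕ.≤-trans (ℕ.≤-trans (ℕ.≤-reflexive (≡.sym (ℕ.*-identityʳ p)))
                (ℕ.*-monoʳ-≤ p 1≤n)) (ℕ.m≤m+n _ i))))
          (ℕ.≤-trans (ℕ.n<1+n _) (ℕ.+-monoˡ-≤ _ 1≤d)))) (ℕ.≤-reflexive (≡.sym (ℕ.+-assoc qb d _))))
      point< : ∀ i l y → i ℕ.< n → l ℕ.< d → pb ℕ.+ i ℕ.* d ℕ.+ l ℕ.< qb ℕ.+ d ℕ.+ y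
      point< i l y i<n l<d = ℕ.<-≤-trans (ℕ.≤-<-trans (ℕ.≤-reflexive (ℕ.+-assoc pb (i ℕ.* d) l)) (ℕ.+-monoʳ-< pb
            (ℕ.<-≤-trans (ℕ.+-monoʳ-< (i ℕ.* d) l<d)
          (ℕ.≤-trans (ℕ.≤-reflexive (ℕ.+-comm (i ℕ.* d) d)) (ℕ.*-monoˡ-≤ d i<n))))) (ℕ.≤-trans (ℕ.m≤m+n qb d)
                (ℕ.m≤m+n _ y))
      2≤pb+ : ∀ y z → 2 ℕ.≤ pb ℕ.+ y ℕ.+ z
      2≤pb+ y z = ℕ.≤-trans (ℕ.≤-trans (ℕ.m≤m+n 2 15) 17≤pb) (ℕ.≤-trans (ℕ.m≤m+n pb y) (ℕ.m≤m+n _ z))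
      2≤qb+ : ∀ y z → 2 ℕ.≤ qb ℕ.+ y ℕ.+ z
      2≤qb+ y z = ℕ.≤-trans (ℕ.≤-trans (ℕ.m≤m+n 2 15) 17≤qb) (ℕ.≤-trans (ℕ.m≤m+n qb y) (ℕ.m≤m+n _ z))
      parent-kept : ∀ p i l → l ℕ.< d → (p ℕ.* n ℕ.+ i) ℕ.* d ℕ.+ l ℕ.≤ x → mem₅ (qb ℕ.+ p ℕ.* d ℕ.+ l) ≡ real st
            (qb ℕ.+ p ℕ.* d ℕ.+ l)
      parent-kept p i l l<d y≤x = unchanged _ (2≤qb+ _ _) (ℕ.<-≤-trans (parent< p i l _ l<d ≡.refl) (ℕ.+-monoʳ-≤
            (qb ℕ.+ d) y≤x))
      point-kept : ∀ i l → i ℕ.< n → l ℕ.< d → mem₅ (pb ℕ.+ i ℕ.* d ℕ.+ l) ≡ real st (pb ℕ.+ i ℕ.* d ℕ.+ l)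
      point-kept i l i<n l<d = unchanged _ (2≤pb+ _ _) (point< i l x i<n l<d)
      stored : v₃ ≈ real st (qb ℕ.+ p ℕ.* d ℕ.+ l) + real st (pb ℕ.+ i ℕ.* d ℕ.+ l) * σ
      stored = +-cong (reflexive (≡.cong (real st) e15)) (*-cong
        (reflexive (≡.trans (update-≢ (real st) (λ e → ℕ.<⇒≢ (ℕ.<-≤-trans (s≤s z≤n) (2≤pb+ (i ℕ.* d) l))
              (≡.trans e e6))) (≡.cong (real st) e6)))
        (trans (reflexive (Grown.old inv 11 (s≤s (s≤s z≤n)) (ℕ.≤-trans (ℕ.m≤m+n 12 5) (ℕ.≤-trans 17≤qb
              (ℕ.m≤m+n qb d))))) r11))
      children′ : ∀ p′ i′ l′ → i′ ℕ.< n → l′ ℕ.< d → ((p′ ℕ.* n ℕ.+ i′) ℕ.* d ℕ.+ l′ ℕ.< x ⊎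
            (p′ ℕ.* n ℕ.+ i′) ℕ.* d ℕ.+ l′ ≡ x) →
        mem₅ (qb ℕ.+ d ℕ.+ ((p′ ℕ.* n ℕ.+ i′) ℕ.* d ℕ.+ l′)) ≈ mem₅ (qb ℕ.+ p′ ℕ.* d ℕ.+ l′) + mem₅
              (pb ℕ.+ i′ ℕ.* d ℕ.+ l′) * σ
      children′ p′ i′ l′ i′<n l′<d (inj₁ y<x) = trans (reflexive (unchanged _ (2≤qb+ d _) (ℕ.+-monoʳ-<
            (qb ℕ.+ d) y<x)))
        (trans (Grown.children inv p′ i′ l′ i′<n l′<d y<x)
          (sym (+-cong (reflexive (parent-kept p′ i′ l′ l′<d (ℕ.<⇒≤ y<x))) (*-congʳ (reflexive
                (point-kept i′ l′ i′<n l′<d))))))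
      children′ p′ i′ l′ i′<n l′<d (inj₂ e) with quotient-unique {q = p′ ℕ.* n ℕ.+ i′} {p ℕ.* n ℕ.+ i} l′<d l<d e
      ... | e′ , ≡.refl with quotient-unique {q = p′} {p} i′<n i<n e′
      ... | ≡.refl , ≡.refl = trans (reflexive (update-≡ mem₄ (Grown.next inv))) (trans stored
        (sym (+-cong (reflexive (parent-kept p i l l<d ℕ.≤-refl)) (*-congʳ (reflexive (point-kept i l i<n l<d))))))

    grow-spec : ∀ {s₀ s₁} → Placed s₀ s₁ → int s₁ 30 ≡ N → Tri s₁ grow (λ st → Grown s₁
          (N ℕ.* n ℕ.* d) st × int st 18 ≡ pc)
    grow-spec {s₀} {s₁} placed e30 =
      tri-block (addᵢ 18 0 3 ∷ mov 20 30 ∷ []) _ >>= λ { {s₂} (f₂ , ≡.refl) →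
      let base₁ = Placed.base placed
          base₂ = base-keep f₂ base₁
      in
      weaken (tri-for 20 N N≤Z (λ ()) (cell3 base₂) (mov-value {s₁} base₁ e30)
        (λ p st → Grown s₁ ((p ℕ.* n) ℕ.* d) st × int st 18 ≡ n ℕ.+ 1 ℕ.+ p ℕ.* n × int st 19 ≡ qb ℕ.+ p ℕ.* d)
        (λ p st p<N g (grown , e18 , e19) → let base₃ = base-keep g base₂ in
          tri-block (mov 6 17 ∷ mov 11 0 ∷ []) _ >>= λ { {s₃} (f₃ , ≡.refl) → let base₃′ = base-keep f₃ base₃ in
          tri-for 11 n n≤Z (λ ()) (cell3 base₃′) (mov-value {st} base₃ (cell0 base₃))
            (λ i st → Grown s₁ ((p ℕ.* n ℕ.+ i) ℕ.* d) st × int st 18 ≡ n ℕ.+ 1 ℕ.+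
                  (p ℕ.* n ℕ.+ i) × int st 6 ≡ pb ℕ.+ i ℕ.* d)
            (λ i st′ i<n g′ (grown , e18 , e6) → let base₄ = base-keep g′ base₃′ ; e19′ = ≡.trans (keepᵢ g′ 19) e19 in
              tri-block (mov 15 19 ∷ mov 5 1 ∷ []) _ >>= λ { {s₄} (f₄ , ≡.refl) → let base₅ = base-keep f₄ base₄ in
              tri-for 5 d ℕ.≤-refl (λ ()) (cell3 base₅) (mov-value {st′} base₄ (cell1 base₄))
                (λ l st → Grown s₁ ((p ℕ.* n ℕ.+ i) ℕ.* d ℕ.+ l) st × int st 15 ≡ qb ℕ.+ p ℕ.* d ℕ.+ l × int st 6 ≡ pb ℕ.+ i ℕ.* d ℕ.+ l)
                (λ l st l<d g″ (grown , e15 , e6) → weaken (grow-step p i l i<n l<d (cell3 (base-keep g″ base₅))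
                      (Placed.scale placed) e15 e6 grown)
                  λ { {st″} _ (grown , e15 , e6) → ≡.subst (λ x → Grown s₁ x (⟦ subᵢ 5 5 3 ⟧ᵢ st″)) (≡.sym (ℕ.+-suc
                        ((p ℕ.* n ℕ.+ i) ℕ.* d) l)) grown , e15 , e6 })
                (≡.subst (λ x → Grown s₁ x s₄) (≡.sym (ℕ.+-identityʳ _)) (regrown ≡.refl grown) , ≡.trans
                      (mov-value {st′} base₄ e19′) (≡.sym (ℕ.+-identityʳ _)) , ≡.trans e6 (≡.sym (ℕ.+-identityʳ _)))
              >>= λ {s₅} (f₅ , (grown , _ , e6)) → let base₆ = base-keep f₅ base₅ in
              weaken (tri-block (addᵢ 18 18 3 ∷ []) _) λ { {s₆} _ ≡.refl →
                ≡.subst (λ x → Grown s₁ x (⟦ subᵢ 11 11 3 ⟧ᵢ (⟦ addᵢ 18 18 3 ⟧ᵢ s₅)))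
                  (≡.trans (ℕ.+-comm ((p ℕ.* n ℕ.+ i) ℕ.* d) d) (≡.cong (ℕ._* d) (≡.sym (ℕ.+-suc (p ℕ.* n) i))))
                        (regrown ≡.refl grown) ,
                ≡.trans (increment (cell3 base₆) (≡.trans (keepᵢ f₅ 18) e18)) (≡.cong (n ℕ.+ 1 ℕ.+_) (≡.sym (ℕ.+-suc
                      (p ℕ.* n) i))) ,
                ≡.trans e6 (≡.trans (ℕ.+-assoc pb (i ℕ.* d) d) (≡.cong (pb ℕ.+_) (ℕ.+-comm (i ℕ.* d) d))) } })
            (≡.subst (λ x → Grown s₁ (x ℕ.* d) s₃) (≡.sym (ℕ.+-identityʳ (p ℕ.* n))) (regrown ≡.refl grown) ,
                  ≡.trans e18 (≡.cong (n ℕ.+ 1 ℕ.+_) (≡.sym (ℕ.+-identityʳ _))) ,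
              ≡.trans (mov-value {st} base₃ (≡.trans (keepᵢ g 17) (Placed.cell17 placed))) (≡.sym (ℕ.+-identityʳ pb)))
          >>= λ {s₄} (f₄ , (grown , e18 , _)) → let base₄ = base-keep f₄ base₃′ in
          weaken (tri-block (addᵢ 19 19 1 ∷ []) _) λ { _ ≡.refl →
            ≡.subst (λ x → Grown s₁ (x ℕ.* d) (⟦ subᵢ 20 20 3 ⟧ᵢ (⟦ addᵢ 19 19 1 ⟧ᵢ s₄))) (ℕ.+-comm (p ℕ.* n) n)
                  (regrown ≡.refl grown) ,
            ≡.trans e18 (≡.cong (n ℕ.+ 1 ℕ.+_) (ℕ.+-comm (p ℕ.* n) n)) ,
            next-point qb p (≡.trans (keepᵢ f₄ 19) e19) (cell1 base₄) } })
        (record { next = ≡.trans (Placed.cell7 placed) (≡.sym (ℕ.+-identityʳ _)) ; old = λ _ _ _ →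
              ≡.refl ; children = λ _ _ _ _ _ () } ,
          ≡.trans (≡.cong₂ ℕ._+_ (cell0 base₁) (cell3 base₁)) (≡.sym (ℕ.+-identityʳ _)) , ≡.trans
                (Placed.cell19 placed) (≡.sym (ℕ.+-identityʳ qb))))
      λ _ (grown , e18 , _) → grown , e18 }
      where
      regrown : ∀ {x st i} → int st 7 ≡ i 7 → Grown s₁ x st → Grown s₁ x ⟪ i , real st ⟫
      regrown e g = record { next = ≡.trans (≡.sym e)
            (Grown.next g) ; old = Grown.old g ; children = Grown.children g }

  output-spec : ∀ {s₀ M} → Base s₀ → int s₀ 10 ≡ M → M ℕ.≤ Z → (∀ c → c ℕ.< M → M ℕ.* d ℕ.≤ int s₀ (40 ℕ.+ c)) →
    Tri s₀ outputProgram (λ s → int s 0 ≡ M × (∀ c l → c ℕ.< M → l ℕ.< d → real s (c ℕ.* d ℕ.+ l) ≡ real s₀ (int s₀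
          (40 ℕ.+ c) ℕ.+ l)))
  output-spec {s₀} {M} base₀ e10 M≤Z far =
    tri-block (constᵢ 7 0 ∷ mov 20 10 ∷ []) _ >>= λ { {s₁} (f₁ , ≡.refl) →
    let base₁ = base-keep f₁ base₀ in
    sum-for 7 1 M 20 M≤Z (λ ()) (λ ()) (cell3 base₁) (mov-value {s₀} base₀ e10) ≡.refl (cell1 base₁) >>= λ {s₂} (f₂ ,
          e7) →
    let base₂ = base-keep f₂ base₁
        e10₂ = ≡.trans (keepᵢ f₂ 10) e10
    in
    tri-block (constᵢ 19 40 ∷ addᵢ 19 19 10 ∷ mov 20 10 ∷ []) _ >>= λ { {s₃} (f₃ , ≡.refl) →
    let base₃ = base-keep f₃ base₂ in
    tri-for 20 M M≤Z (λ ()) (cell3 base₃) (mov-value {s₂} base₂ e10₂)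
      (λ c st → Σ ℕ λ b → b ℕ.+ c ≡ M × int st 19 ≡ 40 ℕ.+ b × Done (b ℕ.* d) st)
      (λ { c st c<M g (zero , e , _) → ⊥-elim (ℕ.<⇒≢ c<M e)
         ; c st c<M g (suc b , e , e19 , done) →
        let base₄ = base-keep g base₃
            b<M : b ℕ.< M
            b<M = ℕ.≤-trans (ℕ.m≤m+n (suc b) c) (ℕ.≤-reflexive e)
            e19′ : int st 19 ℕ.∸ int st 3 ≡ 40 ℕ.+ b
            e19′ = ≡.trans (≡.cong₂ ℕ._∸_ e19 (cell3 base₄)) (ℕ.m+n∸m≡n 1 (40 ℕ.+ b))
            τb = ≡.trans (≡.cong (int st [ 19 ↦ int st 19 ℕ.∸ int st 3 ]) e19′) (≡.trans (highᵢ g (40 ℕ.+ b)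
                  (ℕ.m≤m+n 40 b)) (highᵢ f₂ (40 ℕ.+ b) (ℕ.m≤m+n 40 b)))
        in
        tri-block (subᵢ 19 19 3 ∷ loadᵢ 6 19 ∷ addᵢ 6 6 1 ∷ mov 5 1 ∷ []) _ >>= λ { {s₄} (f₄ , ≡.refl) →
        let base₅ = base-keep f₄ base₄ in
        weaken (tri-for 5 d ℕ.≤-refl (λ ()) (cell3 base₅) (mov-value {st} base₄ (cell1 base₄))
          (λ j st → Σ ℕ λ r → r ℕ.+ j ≡ d × int st 6 ≡ τ b ℕ.+ r × Done (b ℕ.* d ℕ.+ r) st)
          (λ { j st j<d g′ (zero , e , _) → ⊥-elim (ℕ.<⇒≢ j<d e)
             ; j st j<d g′ (suc r , e , e6 , done) → weaken (step b r st b<M (ℕ.≤-trans (ℕ.m≤m+n (suc r) j)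
                   (ℕ.≤-reflexive e)) (cell3 (base-keep g′ base₅)) e6 done)
                 λ { _ (e6 , done) → r , ≡.trans (ℕ.+-suc r j) e , e6 , done } })
          (d , ℕ.+-identityʳ d , ≡.cong₂ ℕ._+_ τb (cell1 base₄) , ≡.subst (λ y → Done y s₄) (ℕ.+-comm d (b ℕ.* d))
                (redone ≡.refl done)))
        λ { {s₅} f₅ (r , e′ , _ , done) → b , ≡.trans (ℕ.+-suc b c) e , ≡.trans (keepᵢ f₅ 19) e19′ ,
          ≡.subst (λ y → Done y (⟦ subᵢ 20 20 3 ⟧ᵢ s₅)) (≡.trans (≡.cong (b ℕ.* d ℕ.+_) (ℕ.+-cancelʳ-≡ d r 0 e′))
                (ℕ.+-identityʳ _)) (redone ≡.refl done) } } })
      (M , ℕ.+-identityʳ M , ≡.cong (40 ℕ.+_) e10₂ , record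
        { position = e7 ; above = λ a _ → keepᵣ f₂ a
        ; cells = λ c l c<M l<d le → ⊥-elim (ℕ.<⇒≱ (index< c<M l<d) le) })
    >>= λ { {s₄} (f₄ , (b , e , _ , done)) →
    weaken (tri-block (mov 0 10 ∷ []) _) λ { _ ≡.refl →
      mov-value {s₄} (base-keep f₄ base₃) (≡.trans (keepᵢ f₄ 10) e10₂) ,
      (λ c l c<M l<d → Done.cells done c l c<M l<d (≡.subst (λ b → b ℕ.* d ℕ.≤ c ℕ.* d ℕ.+ l) (≡.sym
            (ℕ.+-cancelʳ-≡ M b 0 e)) z≤n)) } } } }
    where
    τ : ℕ → ℕ
    τ c = int s₀ (40 ℕ.+ c)
    index< : ∀ {c l} → c ℕ.< M → l ℕ.< d → c ℕ.* d ℕ.+ l ℕ.< M ℕ.* d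
    index< {c} c<M l<d = ℕ.<-≤-trans (ℕ.+-monoʳ-< (c ℕ.* d) l<d) (ℕ.≤-trans (ℕ.≤-reflexive (ℕ.+-comm (c ℕ.* d) d))
          (ℕ.*-monoˡ-≤ d c<M))
    record Done (y : ℕ) (st : State) : Set where
      field
        position : int st 7 ≡ y
        above    : ∀ a → M ℕ.* d ℕ.≤ a → real st a ≡ real s₀ a
        cells    : ∀ c l → c ℕ.< M → l ℕ.< d → y ℕ.≤ c ℕ.* d ℕ.+ l → real st (c ℕ.* d ℕ.+ l) ≡ real s₀ (τ c ℕ.+ l)
    redone : ∀ {y st i} → int st 7 ≡ i 7 → Done y st → Done y ⟪ i , real st ⟫
    redone e g = record { position = ≡.trans (≡.sym e)
          (Done.position g) ; above = Done.above g ; cells = Done.cells g }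
    step : ∀ b r st → b ℕ.< M → r ℕ.< d → int st 3 ≡ 1 → int st 6 ≡ τ b ℕ.+ suc r → Done (b ℕ.* d ℕ.+ suc r) st →
      Tri st outputStep (λ st′ → int st′ 6 ≡ τ b ℕ.+ r × Done (b ℕ.* d ℕ.+ r) (⟦ subᵢ 5 5 3 ⟧ᵢ st′))
    step b r st b<M r<d one e6 done = weaken (tri-block _ _) λ { _ ≡.refl → e6′ , record
        { position = e7′
        ; above = λ a le → ≡.trans (untouched a (ℕ.<-≤-trans (index< b<M r<d) le)) (Done.above done a le)
        ; cells = λ c l c<M l<d le → cell c l c<M l<d (ℕ.m≤n⇒m<n∨m≡n le) } }
      where
      y = b ℕ.* d ℕ.+ r
      minus-one : ∀ {x z a m} → z ≡ 1 → x ≡ a ℕ.+ suc m → x ℕ.∸ z ≡ a ℕ.+ m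
      minus-one {a = a} {m} ≡.refl ≡.refl = ≡.cong (ℕ._∸ 1) (ℕ.+-suc a m)
      e6′ : int st 6 ℕ.∸ int st 3 ≡ τ b ℕ.+ r
      e6′ = minus-one {a = τ b} {r} one e6
      e7′ : int st 7 ℕ.∸ int st 3 ≡ y
      e7′ = minus-one {a = b ℕ.* d} {r} one (Done.position done)
      v = real st (int st 6 ℕ.∸ int st 3)
      mem₁ = real st [ 0 ↦ v ]
      mem₂ = mem₁ [ int st 7 ℕ.∸ int st 3 ↦ v ]
      untouched : ∀ a → y ℕ.< a → mem₂ a ≡ real st a
      untouched a y<a = ≡.trans (update-≢ mem₁ (λ e → ℕ.<⇒≢ y<a (≡.trans (≡.sym e7′) e))) (update-≢ (real st) (ℕ.<⇒≢
            (ℕ.≤-trans (s≤s z≤n) y<a)))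
      cell : ∀ c l → c ℕ.< M → l ℕ.< d → (y ℕ.< c ℕ.* d ℕ.+ l ⊎ y ≡ c ℕ.* d ℕ.+ l) → mem₂ (c ℕ.* d ℕ.+ l) ≡ real s₀
            (τ c ℕ.+ l)
      cell c l c<M l<d (inj₁ y<) = ≡.trans (untouched _ y<) (Done.cells done c l c<M l<d (≡.subst (ℕ._≤ c ℕ.* d ℕ.+ l)
            (≡.sym (ℕ.+-suc (b ℕ.* d) r)) y<))
      cell c l c<M l<d (inj₂ e) with quotient-unique {q = b} {c} r<d l<d e
      ... | ≡.refl , ≡.refl = ≡.trans (update-≡ mem₁ e7′) (≡.trans (≡.cong (real st) e6′) (Done.above done _
            (ℕ.≤-trans (far b b<M) (ℕ.m≤m+n _ r))))

mainProgram kMeansProgram : Program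
mainProgram = scalars ⨾ countNodes ⨾ pad ⨾ place ⨾ grow ⨾ initProgram ⨾ searchProgram
kMeansProgram = relocate ⨾ if (leᵢ 0 32) initProgram mainProgram ⨾ outputProgram

-- Correctness of the algorithm

least : (P : ℕ → Set) → (∀ m → Dec (P m)) → ∀ N → P N → Σ ℕ λ s → P s × (∀ m → m ℕ.< s → ¬ P m)
least P P? zero p = 0 , p , λ _ ()
least P P? (suc N) p with P? 0
... | yes q = 0 , q , λ _ ()
... | no ¬q = let s , ps , min = least (P ∘ suc) (P? ∘ suc) N p in
  suc s , ps , λ { zero _ → ¬q ; (suc m) (s≤s m<s) → min m m<s }

nodes< : ∀ {n} j → 2 ℕ.≤ n → nodes n j ℕ.< n ℕ.^ j
nodes< zero 2≤n = s≤s z≤n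
nodes< {n} (suc j) 2≤n = begin
  2 ℕ.+ n ℕ.* nodes n j ≤⟨ ℕ.+-monoˡ-≤ _ 2≤n ⟩
  n ℕ.+ n ℕ.* nodes n j ≡⟨ ≡.sym (ℕ.*-suc n (nodes n j)) ⟩
  n ℕ.* suc (nodes n j) ≤⟨ ℕ.*-monoʳ-≤ n (nodes< j 2≤n) ⟩
  n ℕ.* n ℕ.^ j ∎
  where open ℕ.≤-Reasoning

≤nodes : ∀ {n} j → 1 ℕ.≤ n → j ℕ.≤ nodes n j
≤nodes zero 1≤n = z≤n
≤nodes {n} (suc j) 1≤n = s≤s (ℕ.≤-trans (≤nodes j 1≤n) (ℕ.≤-trans (ℕ.≤-reflexive (≡.sym (ℕ.*-identityˡ _)))
      (ℕ.*-monoˡ-≤ (nodes n j) 1≤n)))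

nodes-mono : ∀ {n i j} → i ℕ.≤ j → nodes n i ℕ.≤ nodes n j
nodes-mono z≤n = z≤n
nodes-mono {n} (s≤s p) = s≤s (ℕ.*-monoʳ-≤ n (nodes-mono p))

module Numbers (n k s t : ℕ) (1≤k : 1 ℕ.≤ k) (1≤s : 1 ℕ.≤ s) (4k<n : 4 ℕ.* k ℕ.< n) (t≤ : t ℕ.≤ 16 ℕ.* k ℕ.* s) where
  open ℕ.≤-Reasoning

  Z : ℕ
  Z = n ℕ.^ (4 ℕ.+ s)

  5≤n : 5 ℕ.≤ n
  5≤n = ℕ.≤-trans (s≤s (ℕ.*-monoʳ-≤ 4 1≤k)) 4k<n

  2≤n : 2 ℕ.≤ n
  2≤n = ℕ.≤-trans (s≤s (s≤s z≤n)) 5≤n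

  1≤n : 1 ℕ.≤ n
  1≤n = ℕ.≤-trans (s≤s z≤n) 5≤n

  instance
    n≢0 : NonZero n
    n≢0 = ℕ.>-nonZero 1≤n

  ^-≤ : ∀ i j → i ℕ.≤ j → n ℕ.^ i ℕ.≤ n ℕ.^ j
  ^-≤ i j = ℕ.^-monoʳ-≤ n {i} {j}

  nodes≤Z : nodes n s ℕ.≤ Z
  nodes≤Z = ℕ.≤-trans (ℕ.<⇒≤ (nodes< s 2≤n)) (^-≤ s (4 ℕ.+ s) (ℕ.m≤n+m s 4))

  s≤Z : s ℕ.≤ Z
  s≤Z = ℕ.≤-trans (≤nodes s 1≤n) nodes≤Z

  n≤Z : n ℕ.≤ Z
  n≤Z = ℕ.≤-trans (ℕ.≤-reflexive (≡.sym (ℕ.^-identityʳ n))) (^-≤ 1 (4 ℕ.+ s) (s≤s z≤n))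

  k≤Z : k ℕ.≤ Z
  k≤Z = ℕ.≤-trans (ℕ.m≤m+n k _) (ℕ.≤-trans (ℕ.<⇒≤ 4k<n) n≤Z)

  pool≤Z : n ℕ.+ 1 ℕ.+ nodes n s ℕ.* n ℕ.≤ Z
  pool≤Z = begin
    n ℕ.+ 1 ℕ.+ nodes n s ℕ.* n ≡⟨ ≡.cong (ℕ._+ nodes n s ℕ.* n) (ℕ.+-comm n 1) ⟩
    suc (suc (nodes n s) ℕ.* n) ≤⟨ s≤s (ℕ.*-monoˡ-≤ n (nodes< s 2≤n)) ⟩
    1 ℕ.+ n ℕ.^ s ℕ.* n ≡⟨ ≡.cong (1 ℕ.+_) (ℕ.*-comm (n ℕ.^ s) n) ⟩
    1 ℕ.+ n ℕ.^ suc s ≤⟨ ℕ.+-monoˡ-≤ (n ℕ.^ suc s) (ℕ.m^n>0 n (suc s)) ⟩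
    n ℕ.^ suc s ℕ.+ n ℕ.^ suc s ≡⟨ ≡.cong (n ℕ.^ suc s ℕ.+_) (≡.sym (ℕ.+-identityʳ _)) ⟩
    2 ℕ.* n ℕ.^ suc s ≤⟨ ℕ.*-monoˡ-≤ _ 2≤n ⟩
    n ℕ.^ (2 ℕ.+ s) ≤⟨ ^-≤ (2 ℕ.+ s) (4 ℕ.+ s) (ℕ.+-monoˡ-≤ s (s≤s (s≤s (z≤n {2})))) ⟩
    Z ∎

  -- `16 k s + 4 k ≤ 5 (4 k) s`, and here `5 ≤ n`, `4 k < n` and `s ≤ n^s`.
  size≤Z : t ℕ.+ 4 ℕ.* k ℕ.≤ Z
  size≤Z = begin
    t ℕ.+ 4 ℕ.* k ≤⟨ ℕ.+-mono-≤ t≤ (ℕ.≤-reflexive (≡.sym (ℕ.*-identityʳ (4 ℕ.* k)))) ⟩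
    16 ℕ.* k ℕ.* s ℕ.+ 4 ℕ.* k ℕ.* 1 ≤⟨ ℕ.+-monoʳ-≤ (16 ℕ.* k ℕ.* s) (ℕ.*-monoʳ-≤ (4 ℕ.* k) 1≤s) ⟩
    16 ℕ.* k ℕ.* s ℕ.+ 4 ℕ.* k ℕ.* s ≡⟨ ≡.cong (ℕ._+ 4 ℕ.* k ℕ.* s) (≡.cong (ℕ._* s) (ℕ.*-assoc 4 4 k)) ⟩
    4 ℕ.* (4 ℕ.* k) ℕ.* s ℕ.+ 4 ℕ.* k ℕ.* s ≡⟨ ≡.sym (ℕ.*-distribʳ-+ s (4 ℕ.* (4 ℕ.* k)) (4 ℕ.* k)) ⟩
    (4 ℕ.* (4 ℕ.* k) ℕ.+ 4 ℕ.* k) ℕ.* s ≡⟨ ≡.cong (ℕ._* s) (ℕ.+-comm (4 ℕ.* (4 ℕ.* k)) (4 ℕ.* k)) ⟩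
    5 ℕ.* (4 ℕ.* k) ℕ.* s ≤⟨ ℕ.*-monoˡ-≤ s (ℕ.*-mono-≤ 5≤n (ℕ.<⇒≤ 4k<n)) ⟩
    n ℕ.* n ℕ.* s ≤⟨ ℕ.*-monoʳ-≤ (n ℕ.* n) (ℕ.≤-trans (≤nodes s 1≤n) (ℕ.<⇒≤ (nodes< s 2≤n))) ⟩
    n ℕ.* n ℕ.* n ℕ.^ s ≡⟨ ℕ.*-assoc n n _ ⟩
    n ℕ.^ (2 ℕ.+ s) ≤⟨ ^-≤ (2 ℕ.+ s) (4 ℕ.+ s) (ℕ.+-monoˡ-≤ s (s≤s (s≤s (z≤n {2})))) ⟩
    Z ∎

-- Choice of the parameters s and t

module Parameters (R : CompleteOrderedField) where
  open FieldProperties R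
  open ExponentialProperties R
  open Transcendental R

  -- The two-sided conditions say that `s` and `t` are the counts at which the loops of `scalars`
  -- stop. The crude bound `t≤` serves to fit the loops under `Z`; the logarithmic bound on the
  -- output is `size-bound`.
  record Precision (e : Carrier) (k : ℕ) : Set where
    κ : Carrier
    κ = 1# - fromℕ k ⁻¹
    field
      s t : ℕ
      below-s : ∀ m → m ℕ.< s → fromℕ m * e ≤ fromℕ 4
      above-s : ∀ m → fromℕ m * e ≤ fromℕ 4 → m ℕ.< s
      below-t : ∀ m → m ℕ.< t → e ≤ fromℕ 64 * κ ^ m
      above-t : ∀ m → e ≤ fromℕ 64 * κ ^ m → m ℕ.< t
      1≤s : 1 ℕ.≤ s
      t≤ : t ℕ.≤ 16 ℕ.* k ℕ.* s
      4≤se : fromℕ 4 ≤ fromℕ s * e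
      64κ≤e : fromℕ 64 * κ ^ t ≤ e

  module _ {e : Carrier} {k : ℕ} (0<e : 0# < e) (1≤k : 1 ℕ.≤ k) (bounded : Bounded (e ⁻¹)) where
    private
      κ = 1# - fromℕ k ⁻¹
      N = proj₁ bounded

      0<k : 0# < fromℕ k
      0<k = <-≤-trans 0<1 (1≤fromℕ 1≤k)

      0≤u : 0# ≤ fromℕ k ⁻¹
      0≤u = 0≤⁻¹ 0<k

      u≤1 : fromℕ k ⁻¹ ≤ 1#
      u≤1 = *-cancelˡ-≤ 0<k (≤-respˡ (sym (⁻¹-inverseʳ 0<k)) (≤-respʳ (sym (*-identityʳ _)) (1≤fromℕ 1≤k)))

      Large : ℕ → Set
      Large m = ¬ fromℕ m * e ≤ fromℕ 4

      large : Large (1 ℕ.+ 4 ℕ.* N)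
      large le = <⇒≱ 0<e (≤-by ((fromℕ 4 - fromℕ (1 ℕ.+ 4 ℕ.* N) * e) + fromℕ 4 * (e * (fromℕ N - e ⁻¹)))
        (0≤+ (slack le) (*-nonNeg (0≤fromℕ 4) (*-nonNeg (<⇒≤ 0<e) (slack (proj₂ bounded)))))
        (trans (+-congˡ (+-congʳ (+-congˡ (-‿cong (*-congʳ (+-congˡ (fromℕ-* 4 N)))))))
          (trans (solve 3 (λ e n i → e :+ ((K 4 :- (K 1 :+ K 4 :* n) :* e) :+ K 4 :* (e :* (n :- i))) := K 4 :*
                (K 1 :- e :* i)) refl e (fromℕ N) (e ⁻¹))
            (trans (*-congˡ (trans (+-congˡ (-‿cong (⁻¹-inverseʳ 0<e))) (-‿inverseʳ 1#))) (zeroʳ _)))))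

      choose-s = least Large (λ m → ¬? (fromℕ m * e ≤? fromℕ 4)) (1 ℕ.+ 4 ℕ.* N) large
      s = proj₁ choose-s

      decided : ∀ {x y} → ¬ ¬ x ≤ y → x ≤ y
      decided {x} {y} nn with x ≤? y
      ... | yes p = p
      ... | no ¬p = contradiction ¬p nn

      below-s : ∀ m → m ℕ.< s → fromℕ m * e ≤ fromℕ 4
      below-s m m<s = decided (proj₂ (proj₂ choose-s) m m<s)

      4<se : Large s
      4<se = proj₁ (proj₂ choose-s)

      above-s : ∀ m → fromℕ m * e ≤ fromℕ 4 → m ℕ.< s
      above-s m le = ℕ.≰⇒> λ s≤m → 4<se (≤-trans (*-monoʳ (<⇒≤ 0<e) (fromℕ-mono s≤m)) le)

      1≤s : 1 ℕ.≤ s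
      1≤s = above-s 0 (≤-respˡ (sym (zeroˡ e)) (0≤fromℕ 4))

      Small : ℕ → Set
      Small m = ¬ e ≤ fromℕ 64 * κ ^ m

      M = 16 ℕ.* k ℕ.* s

      small : Small M
      -- Here `M / k = 16 s`, so `bernoulli` gives `κ^M (1 + 16 s) ≤ 1`. If `e ≤ 64 κ^M`, then
      -- `e + 16 s e ≤ 64`, although `s e ≥ 4` and `e` is positive.
      small le = <⇒≱ 0<e (≤-by
        ( fromℕ 16 * (fromℕ s * e - fromℕ 4)
        + (fromℕ 64 * κ ^ M - e) * (1# + fromℕ M * fromℕ k ⁻¹) + fromℕ 64 * (1# - κ ^ M *
              (1# + fromℕ M * fromℕ k ⁻¹)))
        (0≤+ (0≤+ (*-nonNeg (0≤fromℕ 16) (slack (<⇒≤ (≰⇒> 4<se)))) (*-nonNeg (slack le) (0≤+ 0≤1 (*-nonNeg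
              (0≤fromℕ M) 0≤u))))
             (*-nonNeg (0≤fromℕ 64) (slack (bernoulli (fromℕ k ⁻¹) M 0≤u u≤1))))
        (trans (solve 4 (λ e s x y → e :+ (K 16 :* (s :* e :- K 4) :+ (K 64 :* x :- e) :* (K 1 :+ y) :+ K 64 :*
              (K 1 :- x :* (K 1 :+ y))) := K 16 :* s :* e :- e :* y) refl e (fromℕ s) (κ ^ M) (fromℕ M * fromℕ k ⁻¹))
          (trans (+-congˡ (-‿cong (*-congˡ M/k))) (solve 2 (λ e s → K 16 :* s :* e :- e :* (K 16 :* s) := K 0) refl e
                (fromℕ s)))))
        where
        M/k : fromℕ M * fromℕ k ⁻¹ ≈ fromℕ 16 * fromℕ s
        M/k = trans (*-congʳ (trans (fromℕ-* (16 ℕ.* k) s) (*-congʳ (fromℕ-* 16 k))))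
          (trans (solve 4 (λ a k s i → (a :* k) :* s :* i := (k :* i) :* (a :* s)) refl (fromℕ 16) (fromℕ k) (fromℕ s)
                (fromℕ k ⁻¹)) (trans (*-congʳ (⁻¹-inverseʳ 0<k)) (*-identityˡ _)))

      choose-t = least Small (λ m → ¬? (e ≤? fromℕ 64 * κ ^ m)) M small
      t = proj₁ choose-t

      κ≤1 : κ ≤ 1#
      κ≤1 = ≤-by (fromℕ k ⁻¹) 0≤u (solve 1 (λ u → (K 1 :- u) :+ u := K 1) refl (fromℕ k ⁻¹))

      κ-antitone : ∀ {i j} → i ℕ.≤ j → κ ^ j ≤ κ ^ i
      κ-antitone {j = zero} z≤n = ≤-refl
      κ-antitone {j = suc j} z≤n = ≤-respʳ (*-identityˡ 1#) (*-mono (slack u≤1) (0≤^ j (slack u≤1)) κ≤1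
            (κ-antitone {0} {j} z≤n))
      κ-antitone (s≤s p) = *-monoˡ (slack u≤1) (κ-antitone p)

    precision : Precision e k
    precision = record
      { s = s ; t = t ; below-s = below-s ; above-s = above-s
      ; below-t = λ m m<t → decided (proj₂ (proj₂ choose-t) m m<t)
      ; above-t = λ m le → ℕ.≰⇒> λ t≤m → proj₁ (proj₂ choose-t) (≤-trans le (*-monoˡ (0≤fromℕ 64) (κ-antitone t≤m)))
      ; 1≤s = 1≤s ; t≤ = ℕ.≮⇒≥ λ M<t → proj₂ (proj₂ choose-t) M M<t small
      ; 4≤se = <⇒≤ (≰⇒> 4<se) ; 64κ≤e = <⇒≤ (≰⇒> (proj₁ (proj₂ choose-t))) }

    -- If `t = j + 1`, then `j` still satisfies `e ≤ 64 κ^j`, and `decay-length` gives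
    -- `j ≤ k (L + 63)`. The constant is `68 = 63 + 4 + 1`, the final 1 paying for the step from `j`
    -- to `t`.
    size-bound : ∀ {L} (p : Precision e k) → 0# ≤ L → Exp L (e ⁻¹) → fromℕ
          (Precision.t p ℕ.+ 4 ℕ.* k) ≤ fromℕ 68 * fromℕ k + fromℕ k * L
    size-bound {L} p 0≤L lim = go (Precision.t p) (Precision.below-t p)
      where
      go : ∀ t → (∀ m → m ℕ.< t → e ≤ fromℕ 64 * κ ^ m) → fromℕ (t ℕ.+ 4 ℕ.* k) ≤ fromℕ 68 * fromℕ k + fromℕ k * L
      go zero _ = ≤-by (fromℕ 64 * fromℕ k + fromℕ k * L) (0≤+ (*-nonNeg (0≤fromℕ 64) (<⇒≤ 0<k)) (*-nonNeg
            (<⇒≤ 0<k) 0≤L))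
        (trans (+-congʳ (fromℕ-* 4 k)) (solve 2 (λ k x → K 4 :* k :+ (K 64 :* k :+ x) := K 68 :* k :+ x) refl
              (fromℕ k) (fromℕ k * L)))
      go (suc j) below = ≤-by (fromℕ k * (L + fromℕ 63 - fromℕ j * fromℕ k ⁻¹) + (fromℕ k - 1#))
        (0≤+ (*-nonNeg (<⇒≤ 0<k) (slack (decay-length j 0≤u u≤1 0<e (below j ℕ.≤-refl) lim 0≤L))) (slack
              (1≤fromℕ 1≤k)))
        (trans (+-cong (+-congˡ (trans (fromℕ-+ j (4 ℕ.* k)) (+-congˡ (fromℕ-* 4 k)))) refl)
          (trans (solve 4 (λ k i j L → (K 1 :+ (j :+ K 4 :* k)) :+ (k :* (L :+ K 63 :- j :* i) :+ (k :- K 1)) :=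
                (K 68 :* k :+ k :* L) :+ j :* (K 1 :- k :* i)) refl (fromℕ k) (fromℕ k ⁻¹) (fromℕ j) L)
            (trans (+-congˡ (trans (*-congˡ (trans (+-congˡ (-‿cong (⁻¹-inverseʳ 0<k))) (-‿inverseʳ 1#))) (zeroʳ _)))
                  (+-identityʳ _))))

    -- The exponent s + 4 of Z is O(1/e), and 1/e ≤ L/e² since L ≥ ½ and 1/e ≥ 2.
    exponent-bound : ∀ {L} B (p : Precision e k) → fromℕ 2 ≤ e ⁻¹ → ½ ≤ L →
      fromℕ ((4 ℕ.+ Precision.s p) ℕ.* B) ≤ fromℕ (10 ℕ.* B) * L * (e ⁻¹) ^ 2
    exponent-bound {L} B p 2≤i ½≤L = ≤-respˡ (sym (fromℕ-* (4 ℕ.+ s′) B)) (≤-respʳ (trans (solve 3 (λ b l i → b :*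
          (K 10 :* l :* (i :* (i :* K 1))) := (K 10 :* b) :* l :* (i :* (i :* K 1))) refl (fromℕ B) L i) (*-congʳ
          (*-congʳ (sym (fromℕ-* 10 B)))))
        (≤-respˡ (*-comm _ _) (*-monoˡ (0≤fromℕ B) exponent)))
      where
      s′ = Precision.s p
      i = e ⁻¹
      0≤i = 0≤⁻¹ 0<e
      s≤ : ∀ s → (∀ m → m ℕ.< s → fromℕ m * e ≤ fromℕ 4) → fromℕ s ≤ 1# + fromℕ 4 * i
      s≤ zero _ = 0≤+ 0≤1 (*-nonNeg (0≤fromℕ 4) 0≤i)
      s≤ (suc m) below = +-mono ≤-refl (≤-respˡ (trans (*-assoc _ _ _) (trans (*-congˡ (⁻¹-inverseʳ 0<e))
            (*-identityʳ _))) (*-monoʳ 0≤i (below m ℕ.≤-refl)))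
      exponent : fromℕ (4 ℕ.+ s′) ≤ fromℕ 10 * L * (i * (i * 1#))
      -- The chain behind the slack terms: `s + 4 ≤ 5 + 4 i ≤ 10 i ≤ 5 i² ≤ 10 L i²`, by `i ≥ 2` and
      -- `L ≥ ½`.
      exponent = ≤-by ((1# + fromℕ 4 * i - fromℕ s′) + (fromℕ 3 * (i - fromℕ 2)) + 1# + fromℕ 3 * i + fromℕ 10 *
            (½ * i * (i - fromℕ 2)) + fromℕ 10 * (i * i * (L - ½)))
        (0≤+ (0≤+ (0≤+ (0≤+ (0≤+ (slack (s≤ s′ (Precision.below-s p))) (*-nonNeg (0≤fromℕ 3) (slack 2≤i))) 0≤1)
              (*-nonNeg (0≤fromℕ 3) 0≤i))
          (*-nonNeg (0≤fromℕ 10) (*-nonNeg (*-nonNeg (<⇒≤ 0<½) 0≤i) (slack 2≤i)))) (*-nonNeg (0≤fromℕ 10) (*-nonNeg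
                (*-nonNeg 0≤i 0≤i) (slack ½≤L))))
        (trans (+-congʳ (fromℕ-+ 4 s′)) (trans (solve 4 (λ s i h L → (K 4 :+ s) :+ ((K 1 :+ K 4 :* i :- s) :+ (K 3 :*
              (i :- K 2)) :+ K 1 :+ K 3 :* i :+ K 10 :* (h :* i :* (i :- K 2)) :+ K 10 :* (i :* i :* (L :- h)))
             := K 10 :* L :* (i :* (i :* K 1)) :+ K 10 :* i :* (K 1 :- (h :+ h))) refl (fromℕ s′) i ½ L)
          (trans (+-congˡ (trans (*-congˡ (trans (+-congˡ (-‿cong ½+½)) (-‿inverseʳ 1#))) (zeroʳ _)))
                (+-identityʳ _))))

-- The specification of the whole program

module Correctness (R : CompleteOrderedField) (n d k : ℕ) (1≤n : 1 ℕ.≤ n) (1≤d : 1 ℕ.≤ d) (1≤k : 1 ℕ.≤ k)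
                   (X : Vector (Vector (CompleteOrderedField.Carrier R) d) n) (ε : CompleteOrderedField.Carrier R)
                   (0<ε : CompleteOrderedField._<_ R (CompleteOrderedField.0# R) ε)
                   (p : Parameters.Precision R (CompleteOrderedField._⊓_ R ε (CompleteOrderedField.½ R)) k) where
  open FieldProperties R
  open Parameters R
  open Precision p
  open Clustering R
  open KMeans R
  open RealRAM R

  e : Carrier
  e = ε ⊓ ½

  σ : Carrier
  σ = fromℕ s ⁻¹

  Z : ℕ
  Z = n ℕ.^ (4 ℕ.+ s)

  n≤Z : n ℕ.≤ Z
  n≤Z = ℕ.≤-trans (ℕ.≤-reflexive (≡.sym (ℕ.^-identityʳ n))) (ℕ.^-monoʳ-≤ n {{ℕ.>-nonZero 1≤n}} {1} {4 ℕ.+ s}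
        (s≤s z≤n))

  open Triples R Z d
  open Execution R Z n d n≤Z
  open Searching R Z n d n≤Z
  open Search R Z n d n≤Z
  open Preparation R Z n d n≤Z

  s₀ : State
  s₀ = input k X ε

  input-point : ∀ i l → real s₀ (1 ℕ.+ (toℕ i ℕ.* d ℕ.+ toℕ l)) ≡ X i l
  input-point i l with toℕ i ℕ.* d ℕ.+ toℕ l ℕ.<? n ℕ.* d
  ... | yes a<nd = ≡.trans (≡.cong (concat X) (Fin.toℕ-injective (≡.trans (Fin.toℕ-fromℕ< a<nd) position)))
        (≡.cong (λ (x , y) → X x y) (Fin.remQuot-combine i l))
    where
    position : toℕ i ℕ.* d ℕ.+ toℕ l ≡ toℕ (combine i l)
    position = ≡.trans (≡.cong (ℕ._+ toℕ l) (ℕ.*-comm (toℕ i) d)) (≡.sym (Fin.toℕ-combine i l))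
  ... | no ¬a<nd = contradiction (≡.subst (ℕ._< n ℕ.* d) position (Fin.toℕ<n (combine i l))) ¬a<nd
    where
    position : toℕ (combine i l) ≡ toℕ i ℕ.* d ℕ.+ toℕ l
    position = ≡.trans (Fin.toℕ-combine i l) (≡.cong (ℕ._+ toℕ l) (ℕ.*-comm d (toℕ i)))

  cell< : ∀ {a} (i : Fin a) (l : Fin d) → toℕ i ℕ.* d ℕ.+ toℕ l ℕ.< a ℕ.* d
  cell< i l = ℕ.<-≤-trans (ℕ.+-monoʳ-< (toℕ i ℕ.* d) (Fin.toℕ<n l)) (ℕ.≤-trans (ℕ.≤-reflexive (ℕ.+-comm
        (toℕ i ℕ.* d) d)) (ℕ.*-monoˡ-≤ d (Fin.toℕ<n i)))

  transfer : ∀ {m} {Y Y′ : Vector (Point d) n} {S S′ : Vector (Point d) (suc m)} → (∀ i → Y i ≋ Y′ i) → (∀ c →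
        S c ≋ S′ c) → cost Y S ≤ cost Y′ S′
  transfer {Y = Y} {Y′} {S} {S′} p q = sum-mono λ i → ≤-respʳ (sym (Costs.distance-nearest Y′ S′ i))
    (≤-respʳ (‖-‖²-cong (p i) (q (Costs.nearest Y′ S′ i))) (minimum≤ (λ c → ‖ Y i - S c ‖²) (Costs.nearest Y′ S′ i)))

  Good : ∀ {m} → Vector (Point d) (suc m) → Set
  Good S = ∀ {m*} (S* : Vector (Point d) (suc m*)) → suc m* ℕ.≤ k → cost X S ≤ (1# + ε) * cost X S*

  -- The common result of both branches before the output is written. `good` speaks of any `S` that
  -- agrees with the stored centers, so it applies to the copy made afterwards; `far` guarantees
  -- that this copying destroys no center still to be read.
  record Outcome (st : State) : Set where
    field
      {m}  : ℕ
      len  : int st 10 ≡ suc m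
      fits : suc m ℕ.≤ Z
      base : Base st
      far  : ∀ c → c ℕ.< suc m → suc m ℕ.* d ℕ.≤ int st (40 ℕ.+ c)
      size : suc m ℕ.≤ 4 ℕ.* k ⊎ suc m ≡ t ℕ.+ 4 ℕ.* k
      good : (S : Vector (Point d) (suc m)) → (∀ c l → S c l ≈ real st (int st (40 ℕ.+ toℕ c) ℕ.+ toℕ l)) → Good S

  0≤1+ε : 0# ≤ 1# + ε
  0≤1+ε = 0≤+ 0≤1 (<⇒≤ 0<ε)

  positive : Σ ℕ λ n₁ → suc n₁ ≡ n
  positive = ℕ.pred n , ℕ.suc-pred n {{ℕ.>-nonZero 1≤n}}

  few-points : ∀ {s₁} → Relocated s₀ k s₁ → n ℕ.≤ 4 ℕ.* k → Tri s₁ initProgram Outcome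
  few-points {s₁} rel n≤4k = weaken (init-spec (Relocated.base rel) (Relocated.cell9 rel)) λ {s₂} f filled →
        outcome f filled positive
    where
    outcome : ∀ {s₂} → Frame initProgram s₁ s₂ → (∀ c → c ℕ.< n → int s₂ (40 ℕ.+ c) ≡ 17 ℕ.+ n ℕ.* d ℕ.+ c ℕ.* d) →
          (Σ ℕ λ n₁ → suc n₁ ≡ n) → Outcome s₂
    outcome {s₂} f filled (n₁ , n≡) = record
      { len = ≡.trans (keepᵢ f 10) (≡.trans (Relocated.cell10 rel) (≡.sym n≡))
      ; fits = ≡.subst (ℕ._≤ Z) (≡.sym n≡) n≤Z
      ; base = base-keep f (Relocated.base rel)
      ; far = λ c c<n → ≡.subst₂ (λ x y → x ℕ.* d ℕ.≤ y) (≡.sym n≡) (≡.sym (filled c (≡.subst (c ℕ.<_) n≡ c<n)))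
          (ℕ.≤-trans (ℕ.m≤n+m (n ℕ.* d) 17) (ℕ.m≤m+n _ (c ℕ.* d)))
      ; size = inj₁ (≡.subst (ℕ._≤ 4 ℕ.* k) (≡.sym n≡) n≤4k)
      ; good = λ S S≈ S* _ → ≤-trans (Costs.cost-self X S λ i → cast (≡.sym n≡) i , λ l → trans (S≈ (cast
            (≡.sym n≡) i) l) (reflexive (located i l)))
          (*-nonNeg 0≤1+ε (Costs.0≤cost X S*))
      }
      where
      located : ∀ i l → real s₂ (int s₂ (40 ℕ.+ toℕ (cast (≡.sym n≡) i)) ℕ.+ toℕ l) ≡ X i l
      located i l = ≡.trans (≡.cong (λ x → real s₂ (int s₂ (40 ℕ.+ x) ℕ.+ toℕ l)) (Fin.toℕ-cast (≡.sym n≡) i))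
        (≡.trans (keepᵣ f _) (≡.trans (≡.cong (real s₁) (≡.trans (≡.cong (ℕ._+ toℕ l) (filled (toℕ i) (Fin.toℕ<n i)))
              (ℕ.+-assoc (17 ℕ.+ n ℕ.* d) (toℕ i ℕ.* d) (toℕ l))))
          (≡.trans (Relocated.points rel _ (cell< i l)) (input-point i l))))

  0<s : 0# < fromℕ s
  0<s = <-≤-trans 0<1 (1≤fromℕ 1≤s)

  0≤e : 0# ≤ e
  0≤e = ⊓-glb (<⇒≤ 0<ε) (<⇒≤ 0<½)

  0≤σ : 0# ≤ σ
  0≤σ = 0≤⁻¹ 0<s

  4σ≤e : fromℕ 4 * σ ≤ e
  4σ≤e = ≤-respʳ (trans (solve 3 (λ s e i → s :* e :* i := (s :* i) :* e) refl (fromℕ s) e σ) (trans (*-congʳ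
        (⁻¹-inverseʳ 0<s)) (*-identityˡ e))) (*-monoʳ 0≤σ 4≤se)

  0≤κ : 0# ≤ κ
  0≤κ = slack (*-cancelˡ-≤ 0<k (≤-respˡ (sym (⁻¹-inverseʳ 0<k)) (≤-respʳ (sym (*-identityʳ _)) (1≤fromℕ 1≤k))))
    where
    0<k : 0# < fromℕ k
    0<k = <-≤-trans 0<1 (1≤fromℕ 1≤k)

  -- (1 + e/4)² ≤ 1 + e ≤ 1 + ε.
  approximation : ∀ {f f′ f*} → 0# ≤ f* → f ≤ f′ + κ ^ t * (fromℕ 13 * f′) → f′ ≤ (1# + σ) * f* → f ≤ (1# + ε) * f*
  approximation {f} {f′} {f*} 0≤f* f≤ f′≤ = *-cancelˡ-≤ (0<fromℕ 15) (≤-by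
    ( fromℕ 16 * (f′ + κ ^ t * (fromℕ 13 * f′) - f) + (fromℕ 16 + fromℕ 208 * κ ^ t) * ((1# + σ) * f* - f′)
    + fromℕ 4 * (1# + σ) * f* * (e - fromℕ 52 * κ ^ t) + (fromℕ 4 + e) * (e - fromℕ 4 * σ) * f*
    + (1# - e) * e * f* + fromℕ 7 * e * f* + fromℕ 16 * (ε - e) * f*)
    (0≤+ (0≤+ (0≤+ (0≤+ (0≤+ (0≤+ (*-nonNeg (0≤fromℕ 16) (slack f≤))
      (*-nonNeg (0≤+ (0≤fromℕ 16) (*-nonNeg (0≤fromℕ 208) (0≤^ t 0≤κ))) (slack f′≤)))
      (*-nonNeg (*-nonNeg (*-nonNeg (0≤fromℕ 4) (0≤+ 0≤1 0≤σ)) 0≤f*) (slack 52κ≤e)))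
      (*-nonNeg (*-nonNeg (0≤+ (0≤fromℕ 4) 0≤e) (slack 4σ≤e)) 0≤f*))
      (*-nonNeg (*-nonNeg (slack e≤1) 0≤e) 0≤f*)) (*-nonNeg (*-nonNeg (0≤fromℕ 7) 0≤e) 0≤f*)) (*-nonNeg (*-nonNeg
            (0≤fromℕ 16) (slack (x⊓y≤x ε ½))) 0≤f*))
    (solve 7 (λ f g h κ σ e ε → K 16 :* f :+ (K 16 :* (g :+ κ :* (K 13 :* g) :- f) :+ (K 16 :+ K 208 :* κ) :*
          ((K 1 :+ σ) :* h :- g)
        :+ K 4 :* (K 1 :+ σ) :* h :* (e :- K 52 :* κ) :+ (K 4 :+ e) :* (e :- K 4 :* σ) :* h :+
              (K 1 :- e) :* e :* h :+ K 7 :* e :* h :+ K 16 :* (ε :- e) :* h)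
        := K 16 :* ((K 1 :+ ε) :* h)) refl f f′ f* (κ ^ t) σ e ε))
    where
    e≤1 : e ≤ 1#
    e≤1 = ≤-trans (x⊓y≤y ε ½) (<⇒≤ ½<1)
    -- `52 = 4 · 13`: the remaining relative excess `13 κ^t` is at most `e/4`.
    52κ≤e : fromℕ 52 * κ ^ t ≤ e
    52κ≤e = ≤-trans (*-monoʳ (0≤^ t 0≤κ) (fromℕ-mono (ℕ.m≤m+n 52 12))) 64κ≤e

  module ManyPoints (4k<n : 4 ℕ.* k ℕ.< n) where
    open Numbers n k s t 1≤k 1≤s 4k<n t≤ using (s≤Z; k≤Z; size≤Z; nodes≤Z; pool≤Z)

    t≤Z : t ℕ.≤ Z
    t≤Z = ℕ.≤-trans (ℕ.m≤m+n t _) size≤Z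

    open Building s t k σ s≤Z size≤Z nodes≤Z 1≤n 1≤d
    open Scalars k 1≤k k≤Z ε 0<ε s t s≤Z t≤Z using (scalars-spec)

    16≤pb : 16 ℕ.≤ pb
    16≤pb = ℕ.≤-trans (ℕ.n≤1+n 16) 17≤pb

    n≤pc : n ℕ.≤ pc
    n≤pc = ℕ.≤-trans (ℕ.m≤m+n n 1) (ℕ.m≤m+n (n ℕ.+ 1) (N ℕ.* n))

    pad-spec : ∀ {s₁} → Base s₁ → int s₁ 7 ≡ xb ℕ.+ n ℕ.* d → int s₁ 29 ≡ t → int s₁ 32 ≡ 4 ℕ.* k → Tri s₁ pad (λ st →
          int st 17 ≡ pb)
    pad-spec {s₁} base₁ e7 e29 e32 = tri-block (mov 17 7 ∷ addᵢ 20 29 32 ∷ []) _ >>= λ { {s₂} (f₂ , ≡.refl) →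
      let base₂ = base-keep f₂ base₁ in
      sum-for 17 1 (t ℕ.+ 4 ℕ.* k) 20 size≤Z (λ ()) (λ ()) (cell3 base₂) (≡.cong₂ ℕ._+_ e29 e32)
            (mov-value {s₁} base₁ e7) (cell1 base₂) }

    module Search-phase {s₁ s₅ s₆ : State} (placed : Placed s₁ s₅) (grown : Grown s₅ (N ℕ.* n ℕ.* d) s₆)
          (f : Frame grow s₅ s₆)
      (points : ∀ x → x ℕ.< n ℕ.* d → real s₁ (xb ℕ.+ x) ≡ real s₀ (1 ℕ.+ x))
      (e10 : int s₆ 10 ≡ n) (e18 : int s₆ 18 ≡ pc) (e29 : int s₆ 29 ≡ t) (e32 : int s₆ 32 ≡ 4 ℕ.* k) where

      mem : ℕ → Carrier
      mem = real s₆

      open Memory mem pb 16≤pb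
      open Run mem pb pc 16≤pb (ℕ.≤-trans 1≤n n≤pc) pool≤Z n≤pc k 1≤k 4k<n
      open Local mem pb pc 16≤pb (ℕ.≤-trans 1≤n n≤pc) pool≤Z using (Pool; 16≤pool)
      open Costs X′

      base₆ : Base s₆
      base₆ = base-keep f (Placed.base placed)

      X′≋X : ∀ i → X′ i ≋ X i
      X′≋X i l = reflexive (≡.trans (≡.cong mem (ℕ.+-assoc pb (toℕ i ℕ.* d) (toℕ l)))
        (≡.trans (Grown.old grown _ (ℕ.≤-trans (ℕ.≤-trans (ℕ.m≤m+n 2 15) 17≤pb) (ℕ.m≤m+n pb _)) (ℕ.<-≤-trans
              (ℕ.+-monoʳ-< pb (cell< i l)) (ℕ.m≤m+n qb d)))
          (≡.trans (Placed.points placed _ (cell< i l)) (≡.trans (points _ (cell< i l)) (input-point i l)))))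

      -- In heap order the node numbers below `nodes n (suc j)` are those of depth at most `j`, so a
      -- child of level `j` is in level `suc j`.
      Level : ℕ → Point d → Set
      Level j y = Σ ℕ λ a → a ℕ.< nodes n (suc j) × (∀ l → mem (qb ℕ.+ a ℕ.* d ℕ.+ toℕ l) ≈ y l)

      levels : Levels s σ Level
      levels = record
        { sσ≈1 = ⁻¹-inverseʳ 0<s
        ; 0≤σ = 0≤σ
        ; root = (λ l → mem (qb ℕ.+ 0 ℕ.+ toℕ l)) , (0 , s≤s z≤n , λ _ → refl) , root-zero
        ; child = child
        }
        where
        root-zero : ∀ l → mem (qb ℕ.+ 0 ℕ.+ toℕ l) ≈ 0#
        root-zero l = trans (reflexive (≡.trans (≡.cong (λ x → mem (x ℕ.+ toℕ l)) (ℕ.+-identityʳ qb))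
          (Grown.old grown _ (ℕ.≤-trans (ℕ.≤-trans (ℕ.m≤m+n 2 15) 17≤qb) (ℕ.m≤m+n qb _)) (ℕ.+-monoʳ-< qb
                (Fin.toℕ<n l))))) (Placed.root placed (toℕ l) (Fin.toℕ<n l))
        child : ∀ {j y} → j ℕ.< s → Level j y → ∀ i → Σ (Point d) λ y′ → Level (suc j) y′ × (∀ l →
              y′ l ≈ y l + σ * X′ i l)
        child {j} {y} j<s (a , a< , y≈) i = (λ l → mem (qb ℕ.+ b ℕ.* d ℕ.+ toℕ l)) , (b , b< , λ _ → refl) , λ l →
            trans (reflexive (≡.cong mem (address l)))
              (trans (Grown.children grown a (toℕ i) (toℕ l) (Fin.toℕ<n i) (Fin.toℕ<n l) (index l)) (+-cong (y≈ l)
                    (*-comm _ _)))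
          where
          b = suc (a ℕ.* n ℕ.+ toℕ i)
          address : ∀ l → qb ℕ.+ b ℕ.* d ℕ.+ toℕ l ≡ qb ℕ.+ d ℕ.+ ((a ℕ.* n ℕ.+ toℕ i) ℕ.* d ℕ.+ toℕ l)
          address l = ≡.trans (≡.cong (ℕ._+ toℕ l) (≡.sym (ℕ.+-assoc qb d ((a ℕ.* n ℕ.+ toℕ i) ℕ.* d)))) (ℕ.+-assoc
                (qb ℕ.+ d) ((a ℕ.* n ℕ.+ toℕ i) ℕ.* d) (toℕ l))
          an+i< : a ℕ.* n ℕ.+ toℕ i ℕ.< nodes n (suc j) ℕ.* n
          an+i< = ℕ.<-≤-trans (ℕ.+-monoʳ-< (a ℕ.* n) (Fin.toℕ<n i)) (ℕ.≤-trans (ℕ.≤-reflexive (ℕ.+-comm (a ℕ.* n) n))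
                (ℕ.*-monoˡ-≤ n a<))
          b< : b ℕ.< nodes n (suc (suc j))
          b< = s≤s (ℕ.<-≤-trans an+i< (ℕ.≤-reflexive (ℕ.*-comm (nodes n (suc j)) n)))
          index : ∀ l → (a ℕ.* n ℕ.+ toℕ i) ℕ.* d ℕ.+ toℕ l ℕ.< N ℕ.* n ℕ.* d
          index l = ℕ.<-≤-trans (ℕ.+-monoʳ-< ((a ℕ.* n ℕ.+ toℕ i) ℕ.* d) (Fin.toℕ<n l))
            (ℕ.≤-trans (ℕ.≤-reflexive (ℕ.+-comm ((a ℕ.* n ℕ.+ toℕ i) ℕ.* d) d)) (ℕ.*-monoˡ-≤ d (ℕ.≤-trans an+i<
                  (ℕ.*-monoˡ-≤ n (nodes-mono j<s)))))

      open Candidates levels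

      solution : ∀ {m*} (S* : Vector (Point d) (suc m*)) → suc m* ℕ.≤ k → Σ Solution λ S → optimum S ≤
            (1# + σ) * cost X S*
      solution S* m*<k =
        let S′ , candidates , le = candidate-solution S* in
        record { size≤k = m*<k ; set = S′ ; in-pool = λ c → let j , j≤s , a , a< , y≈ = candidates c in
            -- The `n` data points precede the nodes in the pool, so node `a` is candidate `n + a`.
            qb ℕ.+ a ℕ.* d , (n ℕ.+ a , pool-index a (ℕ.<-≤-trans a< (nodes-mono {n} (s≤s j≤s))) ,
              ≡.trans (ℕ.+-assoc pb (n ℕ.* d) (a ℕ.* d)) (≡.cong (pb ℕ.+_) (≡.sym (ℕ.*-distribʳ-+ d n a)))) , y≈ } ,
        ≤-trans le (*-monoˡ (0≤+ 0≤1 0≤σ) (transfer {S = S*} {S*} X′≋X (λ _ _ → refl)))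
        where
        pool-index : ∀ a → a ℕ.< suc (n ℕ.* N) → n ℕ.+ a ℕ.< pc
        pool-index a a< = ℕ.<-≤-trans (ℕ.+-monoʳ-< n a<) (ℕ.≤-reflexive (≡.trans (≡.cong (λ x → n ℕ.+ suc x)
              (ℕ.*-comm n N)) (≡.sym (ℕ.+-assoc n 1 (N ℕ.* n)))))

      initial : ∀ {s₇} → Frame initProgram s₆ s₇ → (∀ c → c ℕ.< n → int s₇ (40 ℕ.+ c) ≡ pb ℕ.+ c ℕ.* d) → (Σ ℕ λ n₁ →
            suc n₁ ≡ n) → Reduced 0 s₇
      initial {s₇} g filled (n₁ , n≡) = n₁ , ≡.trans (ℕ.+-identityʳ (suc n₁)) n≡ ,
        record { ctx = record { base = base-keep g base₆ ; cell9 = ≡.trans (keepᵢ g 9) (≡.trans (keepᵢ f 9)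
              (Placed.cell9 placed))
                              ; null = trans (reflexive (≡.trans (keepᵣ g 15) (Grown.old grown 15 (s≤s (s≤s z≤n))
                                    (ℕ.≤-trans (ℕ.m≤m+n 16 1) (ℕ.≤-trans 17≤qb (ℕ.m≤m+n qb d))))))
                                    (Placed.null placed)
                              ; high = λ a _ → keepᵣ g a }
               ; cell10 = ≡.trans (keepᵢ g 10) (≡.trans e10 (≡.sym n≡))
               ; cell17 = ≡.trans (keepᵢ g 17) (≡.trans (keepᵢ f 17) (Placed.cell17 placed))
               ; cell18 = ≡.trans (keepᵢ g 18) e18
               ; pool = λ c c<n → let c<n′ = ≡.subst (c ℕ.<_) n≡ c<n in c , ℕ.<-≤-trans c<n′ n≤pc , filled c c<n′ } ,
        λ S → ≤-respʳ (sym (*-identityˡ _)) (≤-by (0# - value n₁ s₇) (slack (cost-self (centers {suc n₁}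
              (array s₇)) self))
          (solve 2 (λ v h → (v :+ h) :+ (K 0 :- v) := h) refl (value n₁ s₇) (fromℕ 8 * optimum S)))
        where
        self : ∀ i → X′ i ∈̇ centers {suc n₁} (array s₇)
        self i = cast (≡.sym n≡) i , λ l → reflexive (≡.cong (λ x → point x l) (≡.trans (≡.cong (array s₇)
              (Fin.toℕ-cast (≡.sym n≡) i)) (filled (toℕ i) (Fin.toℕ<n i))))

      search-phase : Tri s₆ (initProgram ⨾ searchProgram) Outcome
      search-phase = init-spec base₆ (≡.trans (keepᵢ f 9) (Placed.cell9 placed)) >>= λ {s₇} (g , filled) →
        weaken (search-spec t size≤Z (initial g filled positive) (≡.trans (keepᵢ g 32) e32) (≡.trans
              (keepᵢ g 29) e29))
        λ { {s₈} _ (m , m≡ , φ , bound) → record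
          { len = Phase.cell10 φ
          ; fits = ≡.subst (ℕ._≤ Z) (≡.sym m≡) size≤Z
          ; base = Ctx.base (Phase.ctx φ)
          ; far = λ c c<m → let q , _ , a≡ = Phase.pool φ c c<m in
              ℕ.≤-trans (ℕ.≤-reflexive (≡.cong (ℕ._* d) m≡)) (ℕ.≤-trans (ℕ.m≤n+m _ (xb ℕ.+ n ℕ.* d)) (ℕ.≤-trans
                    (ℕ.m≤m+n pb (q ℕ.* d)) (ℕ.≤-reflexive (≡.sym a≡))))
          ; size = inj₂ m≡
          ; good = λ S S≈ S* m*<k → let S′ , le = solution S* m*<k in
              approximation (Costs.0≤cost X S*)
                (≤-trans (transfer {S = S} {centers {suc m} (array s₈)} (λ i l → sym (X′≋X i l)) (λ c l → trans
                      (S≈ c l) (reflexive (Ctx.high (Phase.ctx φ) _ (ℕ.≤-trans (16≤pool (Phase.pool φ (toℕ c)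
                      (Fin.toℕ<n c))) (ℕ.m≤m+n _ (toℕ l))))))) (bound S′)) le
          } }

    main-spec : ∀ {s₁} → Relocated s₀ k s₁ → Tri s₁ mainProgram Outcome
    main-spec {s₁} rel =
      scalars-spec rel ≡.refl 1≤s below-s above-s below-t above-t >>= λ {s₂} (f₂ , sc) →
      nodes-spec (Scaled.base sc) (Scaled.cell28 sc) s≤Z >>= λ {s₃} (f₃ , e30) →
      let base₃ = base-keep f₃ (Scaled.base sc)
          e29 = ≡.trans (keepᵢ f₃ 29) (Scaled.cell29 sc)
          e32 = ≡.trans (keepᵢ f₃ 32) (≡.trans (keepᵢ f₂ 32) (Relocated.cell32 rel))
      in
      pad-spec base₃ (≡.trans (keepᵢ f₃ 7) (Scaled.cell7 sc)) e29 e32 >>= λ {s₄} (f₄ , e17) →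
      place-spec (base-keep f₄ base₃) (≡.trans (keepᵢ f₄ 9) (≡.trans (keepᵢ f₃ 9) (Scaled.cell9 sc))) e17
        (trans (reflexive (≡.trans (keepᵣ f₄ 11) (keepᵣ f₃ 11))) (Scaled.scale sc)) (trans (reflexive (≡.trans
              (keepᵣ f₄ 15) (keepᵣ f₃ 15))) (Scaled.null sc)) >>= λ {s₅} (f₅ , placed) →
      grow-spec placed (≡.trans (keepᵢ f₅ 30) (≡.trans (keepᵢ f₄ 30) e30)) >>= λ {s₆} (f₆ , (grown , e18)) →
      Search-phase.search-phase placed grown f₆
        (λ x x< → let 16≤ = ℕ.≤-trans (ℕ.≤-trans (ℕ.n≤1+n 16) (ℕ.m≤m+n 17 (n ℕ.* d))) (ℕ.m≤m+n xb x) in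
          ≡.trans (≡.trans (highᵣ f₄ _ 16≤) (≡.trans (highᵣ f₃ _ 16≤) (highᵣ f₂ _ 16≤))) (Relocated.points rel x x<))
        (≡.trans (keepᵢ f₆ 10) (≡.trans (keepᵢ f₅ 10) (≡.trans (keepᵢ f₄ 10) (≡.trans (keepᵢ f₃ 10)
              (Scaled.cell10 sc)))))
        e18
        (≡.trans (keepᵢ f₆ 29) (≡.trans (keepᵢ f₅ 29) (≡.trans (keepᵢ f₄ 29) e29)))
        (≡.trans (keepᵢ f₆ 32) (≡.trans (keepᵢ f₅ 32) (≡.trans (keepᵢ f₄ 32) e32)))

  outcome-spec : ∀ {s₁} → Relocated s₀ k s₁ → Tri s₁ (if (leᵢ 0 32) initProgram mainProgram) Outcome
  outcome-spec {s₁} rel = tri-if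
    (λ le → few-points rel (≡.subst₂ ℕ._≤_ (cell0 (Relocated.base rel)) (Relocated.cell32 rel) le))
    (λ ¬le → ManyPoints.main-spec (ℕ.≰⇒> λ le → ¬le (≡.subst₂ ℕ._≤_ (≡.sym (cell0 (Relocated.base rel))) (≡.sym
          (Relocated.cell32 rel)) le)) rel)

  record Result (st : State) : Set where
    field
      {m}  : ℕ
      len  : outputSize st ≡ suc m
      size : suc m ℕ.≤ 4 ℕ.* k ⊎ suc m ≡ t ℕ.+ 4 ℕ.* k
      good : Good (output {d} {suc m} st)

  kMeans-spec : Tri s₀ kMeansProgram Result
  kMeans-spec = relocate-spec ≡.refl ≡.refl ≡.refl ≡.refl >>= λ (_ , rel) →
    outcome-spec rel >>= λ {s₂} (_ , out) → let open Outcome out in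
    weaken (output-spec base len fits far) λ { {s₃} _ (len , cells) → record
      { len = len ; size = size
      ; good = good (output {d} {suc m} s₃) (λ c l → reflexive (cells (toℕ c) (toℕ l) (Fin.toℕ<n c)
            (Fin.toℕ<n l))) } }

-- Time, size and quality of the output

module Conclusion (R : CompleteOrderedField) (A B : ℕ)
                  (bounded-by : ∀ Z d → 1 ℕ.≤ Z → 1 ℕ.≤ d → bound Z d kMeansProgram ℕ.≤ A ℕ.* (Z ℕ.^ B ℕ.* d)) where
  open FieldProperties R
  open ExponentialProperties R
  open Transcendental R
  open KMeans R
  open RealRAM R
  open Parameters R

  theorem : ∀ n d k → 1 ℕ.≤ n → 1 ℕ.≤ d → 1 ℕ.≤ k → (X : Vector (Point d) n) → ∀ ε → 0# < ε → ∀ L P →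
    Ln ((ε ⊓ ½) ⁻¹) L → Power (fromℕ n) (fromℕ (10 ℕ.* B) * L * ((ε ⊓ ½) ⁻¹) ^ 2) P →
    Σ ℕ λ time → Σ State λ final → Σ ℕ λ m →
      ⟨ kMeansProgram , input k X ε ⟩⇓[ time ] final ×
      outputSize final ≡ suc m ×
      fromℕ time ≤ fromℕ A * P * fromℕ d * fromℕ k ×
      fromℕ (suc m) ≤ fromℕ 68 * fromℕ k + fromℕ k * L ×
      (∀ {m*} (S* : Vector (Point d) (suc m*)) → IsOptimal k X S* →
        cost X (output {d} {suc m} final) ≤ (1# + ε) * cost X S*)
  theorem n d k 1≤n 1≤d 1≤k X ε 0<ε L P ln-L (l , ln-l , power) = conclude kMeans-spec
    where
    e = ε ⊓ ½
    0<e : 0# < e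
    0<e = 0<⊓ 0<ε 0<½
    2≤1/e : fromℕ 2 ≤ e ⁻¹
    2≤1/e = *-cancelˡ-≤ 0<e (≤-respʳ (sym (⁻¹-inverseʳ 0<e)) (≤-respʳ ½+½ (≤-respˡ (solve 1 (λ e →
          e :+ e := e :* K 2) refl e) (+-mono (x⊓y≤y ε ½) (x⊓y≤y ε ½)))))
    ½≤L : ½ ≤ L
    ½≤L = Exp-≥2 2≤1/e ln-L
    0≤L : 0# ≤ L
    0≤L = ≤-trans (<⇒≤ 0<½) ½≤L
    1/e-bounded : Bounded (e ⁻¹)
    1/e-bounded = Exp-bounded 0≤L ln-L
    p : Precision e k
    p = precision 0<e 1≤k 1/e-bounded
    open Precision p using (s; t)
    open Correctness R n d k 1≤n 1≤d 1≤k X ε 0<ε p using (Z; Result; kMeans-spec)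
    open Triples R Z d
    -- `Z ℕ.^ B` is `n ℕ.^ q`. It is compared with `P` through logarithms: `exponent-bound`,
    -- multiplied by `l = ln n`, bounds `q l` by the argument whose exponential is `P`.
    q = (4 ℕ.+ s) ℕ.* B
    0≤l : 0# ≤ l
    0≤l = Exp-nonneg (1≤fromℕ 1≤n) ln-l
    n^q≤P : fromℕ n ^ q ≤ P
    n^q≤P = Exp-power q 0≤l (0≤fromℕ n) ln-l power (*-monoʳ 0≤l (exponent-bound 0<e 1≤k 1/e-bounded B p 2≤1/e ½≤L))
    total : fromℕ (t ℕ.+ 4 ℕ.* k) ≤ fromℕ 68 * fromℕ k + fromℕ k * L
    total = size-bound 0<e 1≤k 1/e-bounded p 0≤L ln-L
    size-bounded : ∀ {m} → suc m ℕ.≤ 4 ℕ.* k ⊎ suc m ≡ t ℕ.+ 4 ℕ.* k → fromℕ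
          (suc m) ≤ fromℕ 68 * fromℕ k + fromℕ k * L
    size-bounded (inj₁ le) = ≤-trans (fromℕ-mono (ℕ.≤-trans le (ℕ.m≤n+m (4 ℕ.* k) t))) total
    size-bounded (inj₂ e)  = ≤-respˡ (reflexive (≡.cong fromℕ (≡.sym e))) total
    time-bounded : ∀ {time} → time ℕ.≤ bound Z d kMeansProgram → fromℕ time ≤ fromℕ A * P * fromℕ d * fromℕ k
    time-bounded {time} le = begin
      fromℕ time ≤⟨ fromℕ-mono (ℕ.≤-trans le (bounded-by Z d (ℕ.m^n>0 n {{ℕ.>-nonZero 1≤n}} (4 ℕ.+ s)) 1≤d)) ⟩
      fromℕ (A ℕ.* (Z ℕ.^ B ℕ.* d)) ≡⟨ ≡.cong (λ x → fromℕ (A ℕ.* (x ℕ.* d))) (ℕ.^-*-assoc n (4 ℕ.+ s) B) ⟩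
      fromℕ (A ℕ.* (n ℕ.^ q ℕ.* d)) ≈⟨ trans (fromℕ-* A (n ℕ.^ q ℕ.* d)) (*-congˡ (trans (fromℕ-* (n ℕ.^ q) d)
            (*-congʳ (fromℕ-^ n q)))) ⟩
      fromℕ A * (fromℕ n ^ q * fromℕ d) ≈⟨ sym (*-assoc (fromℕ A) (fromℕ n ^ q) (fromℕ d)) ⟩
      fromℕ A * fromℕ n ^ q * fromℕ d ≤⟨ *-monoʳ (0≤fromℕ d) (*-monoˡ (0≤fromℕ A) n^q≤P) ⟩
      fromℕ A * P * fromℕ d ≈⟨ sym (*-identityʳ _) ⟩
      fromℕ A * P * fromℕ d * 1# ≤⟨ *-monoˡ (*-nonNeg (*-nonNeg (0≤fromℕ A) (≤-trans (0≤^ q (0≤fromℕ n)) n^q≤P))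
            (0≤fromℕ d)) (1≤fromℕ 1≤k) ⟩
      fromℕ A * P * fromℕ d * fromℕ k ∎
      where open ≤R
    conclude : Tri (input k X ε) kMeansProgram Result → _
    conclude tri = let r = post tri in
      time tri , final tri , Result.m r , run tri , Result.len r , time-bounded (time≤ tri) , size-bounded
            (Result.size r) ,
      λ {_} S* optimal → Result.good r S* (proj₁ optimal)

lemma4 :
    Σ Program λ algorithm → Σ ℕ λ A → Σ ℕ λ B → Σ ℕ λ C →
    (R : CompleteOrderedField) →
    let open CompleteOrderedField R
        open Transcendental R
        open KMeans R
        open RealRAM R
    in
    (n d k : ℕ) .{{_ : NonZero n}} .{{_ : NonZero d}} .{{_ : NonZero k}} →
    (X : Vector (Point d) n) → Injective _≡_ _≋_ X →
    (ε : Carrier) → 0# < ε →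
    -- L = ln (1/ε) and P = n^(B·L/ε²), with ε capped at ½: both O-bounds are
    -- asymptotic for small ε (log (1/ε) vanishes at 1 and is negative beyond).
    (L P : Carrier) →
    Ln ((ε ⊓ ½) ⁻¹) L →
    Power (fromℕ n) (fromℕ B * L * ((ε ⊓ ½) ⁻¹) ^ 2) P →
    Σ ℕ λ time → Σ State λ final → Σ ℕ λ m →
      ⟨ algorithm , input k X ε ⟩⇓[ time ] final ×
      outputSize final ≡ suc m ×
      fromℕ time ≤ fromℕ A * P * fromℕ d * fromℕ k ×
      fromℕ (suc m) ≤ fromℕ C * fromℕ k + fromℕ k * L ×
      (∀ {m*} (S* : Vector (Point d) (suc m*)) → IsOptimal k X S* →
        cost X (output {d} {suc m} final) ≤ (1# + ε) * cost X S*)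
-- The factor 10 comes from `exponent-bound`, the constant 68 from `size-bound`.
lemma4 = kMeansProgram , coefficient kMeansProgram , 10 ℕ.* Z-degree kMeansProgram , 68 ,
  λ R n d k X _ ε 0<ε L P ln-L power →
    Conclusion.theorem R (coefficient kMeansProgram) (Z-degree kMeansProgram) bounded-by n d k
      (ℕ.>-nonZero⁻¹ n) (ℕ.>-nonZero⁻¹ d) (ℕ.>-nonZero⁻¹ k) X ε 0<ε L P ln-L power
  where
  bounded-by : ∀ Z d → 1 ℕ.≤ Z → 1 ℕ.≤ d →
    bound Z d kMeansProgram ℕ.≤ coefficient kMeansProgram ℕ.* (Z ℕ.^ Z-degree kMeansProgram ℕ.* d)
  -- `d-degree kMeansProgram` evaluates to 1, because no loop over the coordinates is nested in
  -- another one.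
  bounded-by Z d 1≤Z 1≤d = ≡.subst (λ x → bound Z d kMeansProgram ℕ.≤ coefficient kMeansProgram ℕ.*
        (Z ℕ.^ Z-degree kMeansProgram ℕ.* x))
    (ℕ.^-identityʳ d) (bound≤ 1≤Z 1≤d kMeansProgram)
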